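{- Let $q\in\mathbb{C}$ with $|q|<1$. Then $$\sum_{n=0}^{\infty}\frac{q^{(n^2+3n)/2}(-q;q)_{n}}{(q;q^2)_{n+1}(q;q)_{n+1}} =\frac{(q^{10};q^{10})_{\infty}}{(q;q)_{\infty}(q;q^2)_{\infty}(-q^3,-q^4,-q^6,-q^7;q^{10})_{\infty}}.$$
   Context: For $|q|<1$, $x\in\mathbb{C}$ and an integer $n\ge 0$: $(x;q)_n=\prod_{j=0}^{n-1}(1-xq^j)$ (so $(x;q)_0=1$), $(x;q)_\infty=\prod_{j=0}^{\infty}(1-xq^j)$, and $(x_1,\dots,x_k;q)_\infty=\prod_{i=1}^k (x_i;q)_\infty$. The same notation is used with base $q^m$ in place of $q$. -}

module Defs where

open import Level using (_⊔_) renaming (suc to lsuc)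
open import Data.Nat.Base as ℕ using (ℕ)
open import Data.Fin.Base using (toℕ)
open import Data.Product.Base using (_×_; _,_; proj₁; proj₂; ∃-syntax)
open import Data.Sum.Base using (_⊎_)
open import Relation.Binary.Core using (Rel)
open import Relation.Binary.Structures using (IsStrictPartialOrder)
open import Algebra.Bundles using (CommutativeRing; RawRing; Semiring)
open import Algebra.Apartness.Bundles using (HeytingField)
import Algebra.Definitions.RawSemiring as RawSemiringDefinitions
import Algebra.Properties.Ring as RingProperties
import Relation.Binary.Reasoning.Setoid as SetoidReasoning

-- The real numbers, given axiomatically as a Cauchy-complete Archimedean
-- ordered field.  The axioms use apartness and strict order, so that they hold
-- of the constructive Cauchy reals; read classically (x # y as x ≠ y) they
-- characterise ℝ up to isomorphism.
record RealField c ℓ₁ ℓ₂ : Set (lsuc (c ⊔ ℓ₁ ⊔ ℓ₂)) where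
  field
    heytingField : HeytingField c ℓ₁ ℓ₂

  open HeytingField heytingField public

  commutativeRing : CommutativeRing c ℓ₁
  commutativeRing = record { isCommutativeRing = isCommutativeRing }

  open RawSemiringDefinitions (Semiring.rawSemiring (CommutativeRing.semiring commutativeRing)) public
    using () renaming (_×_ to _·_)

  infix 4 _<_
  field
    _<_                  : Rel Carrier ℓ₂
    isStrictPartialOrder : IsStrictPartialOrder _≈_ _<_
    <⇒#                  : ∀ {x y} → x < y → x # y
    #⇒<⊎>                : ∀ {x y} → x # y → x < y ⊎ y < x
    +-monoʳ-<            : ∀ z {x y} → x < y → z + x < z + y
    *-pos                : ∀ {x y} → 0# < x → 0# < y → 0# < x * y
    archimedean          : ∀ x → ∃[ n ] (x < n · 1#)

  -- |x - y| < ε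
  Close : Carrier → Carrier → Carrier → Set ℓ₂
  Close ε x y = (x - y < ε) × (y - x < ε)

  field
    complete : (s : ℕ → Carrier) →
      (∀ ε → 0# < ε → ∃[ N ] (∀ m n → N ℕ.≤ m → N ℕ.≤ n → Close ε (s m) (s n))) →
      ∃[ L ] (∀ ε → 0# < ε → ∃[ N ] (∀ n → N ℕ.≤ n → Close ε (s n) L))

module Complex {c ℓ₁ ℓ₂} (𝓡 : RealField c ℓ₁ ℓ₂) where

  private
    module ℝ = RealField 𝓡

  infix 5 _+i_
  record ℂ : Set c where
    constructor _+i_
    field
      re : ℝ.Carrier
      im : ℝ.Carrier

  open ℂ public

  infix 4 _≈ᶜ_
  _≈ᶜ_ : Rel ℂ ℓ₁
  z ≈ᶜ w = (re z ℝ.≈ re w) × (im z ℝ.≈ im w)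

  ℂ-rawRing : RawRing c ℓ₁
  ℂ-rawRing = record
    { Carrier = ℂ
    ; _≈_     = _≈ᶜ_
    ; _+_     = λ z w → (re z ℝ.+ re w) +i (im z ℝ.+ im w)
    ; _*_     = λ z w → (re z ℝ.* re w ℝ.- im z ℝ.* im w) +i
                        (re z ℝ.* im w ℝ.+ im z ℝ.* re w)
    ; -_      = λ z → (ℝ.- re z) +i (ℝ.- im z)
    ; 0#      = ℝ.0# +i ℝ.0#
    ; 1#      = ℝ.1# +i ℝ.0#
    }

  open RawRing ℂ-rawRing public
    using (_+_; _*_; -_; 0#; 1#)

  open RawSemiringDefinitions (RawRing.rawSemiring ℂ-rawRing) public
    using (_^_; sum; product)

  infixl 6 _-_
  _-_ : ℂ → ℂ → ℂ
  z - w = z + (- w)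

  ∣_∣² : ℂ → ℝ.Carrier
  ∣ z ∣² = re z ℝ.* re z ℝ.+ im z ℝ.* im z

  -- |z| < r, squared to avoid the square root
  infix 4 ∣_∣<_
  ∣_∣<_ : ℂ → ℝ.Carrier → Set ℓ₂
  ∣ z ∣< r = (ℝ.0# ℝ.< r) × (∣ z ∣² ℝ.< r ℝ.* r)

  NonZero : ℂ → Set ℓ₂
  NonZero z = ∣ z ∣² ℝ.# ℝ.0#

  -- `#⇒invertible` yields an inverse of ∣ z ∣² - 0, which equals ∣ z ∣²;
  -- `*-inverseʳ` below confirms that this is the multiplicative inverse of z.
  inverse : (z : ℂ) → NonZero z → ℂ
  inverse z z≠0 = (re z ℝ.* k) +i ((ℝ.- im z) ℝ.* k)
    where k = proj₁ (ℝ.#⇒invertible z≠0)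

  infixl 7 _/_[_]
  _/_[_] : ℂ → (w : ℂ) → NonZero w → ℂ
  z / w [ w≠0 ] = z * inverse w w≠0

  *-inverseʳ : ∀ z (z≠0 : NonZero z) → z * inverse z z≠0 ≈ᶜ 1#
  *-inverseʳ (a +i b) z≠0 = real , imaginary
    where
    open CommutativeRing ℝ.commutativeRing using (ring; setoid)
    open RingProperties ring
    open SetoidReasoning setoid
    k = proj₁ (ℝ.#⇒invertible z≠0)

    b[-bk]≈-[bbk] : b ℝ.* ((ℝ.- b) ℝ.* k) ℝ.≈ ℝ.- (b ℝ.* b ℝ.* k)
    b[-bk]≈-[bbk] = begin
      b ℝ.* ((ℝ.- b) ℝ.* k)   ≈⟨ ℝ.*-assoc b (ℝ.- b) k ⟨
      b ℝ.* (ℝ.- b) ℝ.* k     ≈⟨ ℝ.*-congʳ (-‿distribʳ-* b b) ⟨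
      (ℝ.- (b ℝ.* b)) ℝ.* k   ≈⟨ -‿distribˡ-* (b ℝ.* b) k ⟨
      ℝ.- (b ℝ.* b ℝ.* k)     ∎

    real : a ℝ.* (a ℝ.* k) ℝ.- b ℝ.* ((ℝ.- b) ℝ.* k) ℝ.≈ ℝ.1#
    real = begin
      a ℝ.* (a ℝ.* k) ℝ.- b ℝ.* ((ℝ.- b) ℝ.* k)
        ≈⟨ ℝ.+-cong (ℝ.sym (ℝ.*-assoc a a k)) (ℝ.-‿cong b[-bk]≈-[bbk]) ⟩
      a ℝ.* a ℝ.* k ℝ.- (ℝ.- (b ℝ.* b ℝ.* k))
        ≈⟨ ℝ.+-congˡ (-‿involutive (b ℝ.* b ℝ.* k)) ⟩
      a ℝ.* a ℝ.* k ℝ.+ b ℝ.* b ℝ.* k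
        ≈⟨ ℝ.distribʳ k (a ℝ.* a) (b ℝ.* b) ⟨
      (a ℝ.* a ℝ.+ b ℝ.* b) ℝ.* k
        ≈⟨ ℝ.*-congʳ (ℝ.trans (ℝ.+-congˡ -0#≈0#) (ℝ.+-identityʳ _)) ⟨
      (a ℝ.* a ℝ.+ b ℝ.* b ℝ.- ℝ.0#) ℝ.* k
        ≈⟨ proj₂ (proj₂ (ℝ.#⇒invertible z≠0)) ⟩
      ℝ.1# ∎

    imaginary : a ℝ.* ((ℝ.- b) ℝ.* k) ℝ.+ b ℝ.* (a ℝ.* k) ℝ.≈ ℝ.0#
    imaginary = begin
      a ℝ.* ((ℝ.- b) ℝ.* k) ℝ.+ b ℝ.* (a ℝ.* k)
        ≈⟨ ℝ.+-cong (ℝ.sym (ℝ.*-assoc a (ℝ.- b) k)) (ℝ.sym (ℝ.*-assoc b a k)) ⟩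
      a ℝ.* (ℝ.- b) ℝ.* k ℝ.+ b ℝ.* a ℝ.* k
        ≈⟨ ℝ.distribʳ k (a ℝ.* (ℝ.- b)) (b ℝ.* a) ⟨
      (a ℝ.* (ℝ.- b) ℝ.+ b ℝ.* a) ℝ.* k
        ≈⟨ ℝ.*-congʳ (ℝ.+-cong (ℝ.sym (-‿distribʳ-* a b)) (ℝ.*-comm b a)) ⟩
      (ℝ.- (a ℝ.* b) ℝ.+ a ℝ.* b) ℝ.* k
        ≈⟨ ℝ.*-congʳ (ℝ.-‿inverseˡ (a ℝ.* b)) ⟩
      ℝ.0# ℝ.* k
        ≈⟨ ℝ.zeroˡ k ⟩
      ℝ.0# ∎

  infix 4 _⟶_
  _⟶_ : (ℕ → ℂ) → ℂ → Set (c ⊔ ℓ₂)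
  s ⟶ L = ∀ ε → ℝ.0# ℝ.< ε → ∃[ N ] (∀ n → N ℕ.≤ n → ∣ s n - L ∣< ε)

  infix 4 ∑∞_⟶_
  ∑∞_⟶_ : (ℕ → ℂ) → ℂ → Set (c ⊔ ℓ₂)
  ∑∞ f ⟶ S = (λ N → sum {N} (λ i → f (toℕ i))) ⟶ S

  -- The finite q-Pochhammer symbol (x ; q)_n.
  ⟨_﹔_⟩_ : ℂ → ℂ → ℕ → ℂ
  ⟨ x ﹔ q ⟩ n = product {n} (λ j → 1# - x * q ^ toℕ j)

  -- (x ; q)_∞ = P, as convergence of the partial products.
  infix 4 ⟨_﹔_⟩∞⟶_
  ⟨_﹔_⟩∞⟶_ : ℂ → ℂ → ℂ → Set (c ⊔ ℓ₂)
  ⟨ x ﹔ q ⟩∞⟶ P = (λ n → ⟨ x ﹔ q ⟩ n) ⟶ P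

-- Write (a)_n = (a ; q)_n and 𝓢 for the sum.  Shifting the index by one turns 1 + 2 q 𝓢 into
-- Σ (-1)_n q^{n(n+1)/2} β_n with β_n = 1 / ((q)_n (q ; q²)_n), and Bailey's lemma (ρ₁ = -1, ρ₂ → ∞)
-- applied to the Bailey pair with α_{2s} = (-1)^s q^{3s²-s} (1 + q^{2s}), α_{2s+1} = 0 gives
--   1 + 2 q 𝓢 = (-q)_∞ / (q)_∞ · φ(-q⁵),   φ(-q⁵) = Σ_{s ∈ ℤ} (-1)^s q^{5s²} = (q⁵ ; q¹⁰)_∞² (q¹⁰ ; q¹⁰)_∞.
-- Here Bailey's lemma is proved at a finite level N and Tannery's theorem takes N to infinity.
-- Since φ(-q) = (q)_∞ / (-q)_∞, the theorem becomes the product formula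
--   φ(-q⁵) - φ(-q) = 2 q (q¹⁰ ; q¹⁰)_∞ / (-q³, -q⁴, -q⁶, -q⁷ ; q¹⁰)_∞.
-- Clearing denominators, this is a case of Weierstrass' three-term theta relation.  It follows by
-- expanding all the products of two theta functions involved by Schröter's formula
-- (Σ over ℤ² split by the parity of m + n), after which both sides agree term by term.

module Submission where

open import Data.Nat.Base using (ℕ; suc)
open import Data.Product.Base using (_×_; Σ-syntax; ∃-syntax)
open import Defs
import Data.Nat.Base as ℕ

open import Level using (_⊔_) renaming (suc to lsuc)
open import Algebra.Bundles using (CommutativeRing; RawRing)
import Algebra.Apartness.Properties.HeytingCommutativeRing as HeytingProperties
import Algebra.Properties.AbelianGroup as AbelianGroupProperties
import Algebra.Properties.Ring as RingProperties
import Algebra.Properties.Semiring.Exp as SemiringExp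
import Algebra.Properties.Semiring.Mult.TCOptimised as SemiringMult
import Algebra.Solver.Ring as RingSolver
import Algebra.Solver.Ring.AlmostCommutativeRing as ACR
open import Data.Empty using (⊥-elim)
open import Data.Fin.Base using (toℕ)
open import Data.Integer.Base as ℤ using (ℤ; +_; -[1+_])
import Data.Integer.Properties as ℤ
open import Data.Integer.Solver using (module +-*-Solver)
open import Data.List.Base using (List; []; _∷_; foldr)
open import Data.Maybe.Base using (Maybe; just; nothing)
open import Data.Nat.Base using (zero)
import Data.Nat.DivMod as ℕ
import Data.Nat.Properties as ℕ
open import Data.Nat.Solver using () renaming (module +-*-Solver to ℕSolver)
open import Data.Product.Base using (_,_; proj₁; proj₂)
open import Data.Sum.Base using (_⊎_; inj₁; inj₂; [_,_]′)
open import Function.Base using (_∘_; case_of_)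
open import Relation.Binary.PropositionalEquality.Core as ≡ using (_≡_)
import Relation.Binary.Reasoning.Setoid as SetoidReasoning
open import Relation.Binary.Structures using (IsStrictPartialOrder)
open import Relation.Nullary.Decidable.Core using (yes; no)
open import Relation.Nullary.Negation.Core using (¬_)

-- The value q = 0 is allowed and whether q vanishes cannot be decided, so no negative power of q
-- may be written. Theta terms therefore have the form a^T(m) b^T(-m), reciprocals of Pochhammer
-- symbols are carried along as sequences of their own, and identities are stated with denominators
-- cleared. Only the final cancellation of 2 q divides by q. At a finite level the Bailey pair and
-- the inner sum of Bailey's lemma both satisfy first-order recurrences. Wilf-Zeilberger
-- certificates reduce these to polynomial identities for the ring solver, so no theory of basic
-- hypergeometric series is required. The product formula becomes a three-term relation as follows.
-- Multiply by the missing factors (-q, -q², -q⁸, -q⁹ ; q¹⁰)_∞, so that all residues modulo 10 not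
-- divisible by 5 are present. Then φ(-q⁵) is a common factor of both terms on the left, by Euler's
-- identity at the bases q and q⁵. What remains is the difference of the products of the factors 1 +
-- q^k and 1 - q^k over those residues, which is the left side of Weierstrass' relation.

module IntegerCoefficients {c ℓ} (R : CommutativeRing c ℓ) where
  open CommutativeRing R
  open RingProperties ring
  open AbelianGroupProperties +-abelianGroup using (⁻¹-∙-comm)
  open SetoidReasoning setoid
  open SemiringMult semiring using (1+×; ×-homo-+; ×1-homo-*) renaming (_×_ to _·_)

  fromℤ : ℤ.ℤ → Carrier
  fromℤ (ℤ.+ n)      = n · 1#
  fromℤ ℤ.-[1+ n ]   = - (suc n · 1#)

  private
    1+a-[1+b] : ∀ a b → (1# + a) - (1# + b) ≈ a - b
    1+a-[1+b] a b = begin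
      (1# + a) + - (1# + b)      ≈⟨ +-congˡ (⁻¹-∙-comm 1# b) ⟨
      (1# + a) + (- 1# + - b)    ≈⟨ +-congʳ (+-comm 1# a) ⟩
      (a + 1#) + (- 1# + - b)    ≈⟨ +-assoc a 1# _ ⟩
      a + (1# + (- 1# + - b))    ≈⟨ +-congˡ (+-assoc 1# (- 1#) (- b)) ⟨
      a + ((1# + - 1#) + - b)    ≈⟨ +-congˡ (+-congʳ (-‿inverseʳ 1#)) ⟩
      a + (0# + - b)             ≈⟨ +-congˡ (+-identityˡ (- b)) ⟩
      a - b                      ∎

    ⊖-homo : ∀ m n → fromℤ (m ℤ.⊖ n) ≈ m · 1# - n · 1#
    ⊖-homo m       zero    = sym (trans (+-congˡ -0#≈0#) (+-identityʳ _))
    ⊖-homo zero    (suc n) = sym (+-identityˡ _)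
    ⊖-homo (suc m) (suc n) = begin
      fromℤ (suc m ℤ.⊖ suc n)             ≡⟨ ≡.cong fromℤ (ℤ.[1+m]⊖[1+n]≡m⊖n m n) ⟩
      fromℤ (m ℤ.⊖ n)                     ≈⟨ ⊖-homo m n ⟩
      m · 1# - n · 1#                     ≈⟨ 1+a-[1+b] _ _ ⟨
      (1# + m · 1#) - (1# + n · 1#)       ≈⟨ +-cong (1+× m 1#) (-‿cong (1+× n 1#)) ⟨
      suc m · 1# - suc n · 1#             ∎

  +-homo : ∀ i j → fromℤ (i ℤ.+ j) ≈ fromℤ i + fromℤ j
  +-homo (ℤ.+ m)    (ℤ.+ n)    = ×-homo-+ 1# m n
  +-homo (ℤ.+ m)    ℤ.-[1+ n ] = ⊖-homo m (suc n)
  +-homo ℤ.-[1+ m ] (ℤ.+ n)    = trans (⊖-homo n (suc m)) (+-comm _ _)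
  +-homo ℤ.-[1+ m ] ℤ.-[1+ n ] = begin
    - (suc (suc (m ℕ.+ n)) · 1#)          ≡⟨ ≡.cong (λ k → - (suc k · 1#)) (≡.sym (ℕ.+-suc m n)) ⟩
    - ((suc m ℕ.+ suc n) · 1#)            ≈⟨ -‿cong (×-homo-+ 1# (suc m) (suc n)) ⟩
    - (suc m · 1# + suc n · 1#)           ≈⟨ ⁻¹-∙-comm _ _ ⟨
    - (suc m · 1#) + - (suc n · 1#)       ∎

  -‿homo : ∀ i → fromℤ (ℤ.- i) ≈ - fromℤ i
  -‿homo (ℤ.+ zero)    = sym -0#≈0#
  -‿homo (ℤ.+ (suc n)) = refl
  -‿homo ℤ.-[1+ n ]    = sym (-‿involutive _)

  private
    *-homo-+ : ∀ m j → fromℤ (ℤ.+ m ℤ.* j) ≈ (m · 1#) * fromℤ j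
    *-homo-+ m (ℤ.+ n)    = trans (reflexive (≡.cong fromℤ (≡.sym (ℤ.pos-* m n)))) (×1-homo-* m n)
    *-homo-+ m ℤ.-[1+ n ] = begin
      fromℤ (ℤ.+ m ℤ.* ℤ.- ℤ.+ suc n)     ≡⟨ ≡.cong fromℤ (≡.sym (ℤ.neg-distribʳ-* (ℤ.+ m) (ℤ.+ suc n))) ⟩
      fromℤ (ℤ.- (ℤ.+ m ℤ.* ℤ.+ suc n))   ≈⟨ -‿homo (ℤ.+ m ℤ.* ℤ.+ suc n) ⟩
      - fromℤ (ℤ.+ m ℤ.* ℤ.+ suc n)       ≈⟨ -‿cong (*-homo-+ m (ℤ.+ suc n)) ⟩
      - ((m · 1#) * (suc n · 1#))         ≈⟨ -‿distribʳ-* _ _ ⟩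
      (m · 1#) * - (suc n · 1#)           ∎

  *-homo : ∀ i j → fromℤ (i ℤ.* j) ≈ fromℤ i * fromℤ j
  *-homo (ℤ.+ m)    j = *-homo-+ m j
  *-homo ℤ.-[1+ m ] j = begin
    fromℤ (ℤ.- ℤ.+ suc m ℤ.* j)           ≡⟨ ≡.cong fromℤ (≡.sym (ℤ.neg-distribˡ-* (ℤ.+ suc m) j)) ⟩
    fromℤ (ℤ.- (ℤ.+ suc m ℤ.* j))         ≈⟨ -‿homo (ℤ.+ suc m ℤ.* j) ⟩
    - fromℤ (ℤ.+ suc m ℤ.* j)             ≈⟨ -‿cong (*-homo-+ (suc m) j) ⟩
    - ((suc m · 1#) * fromℤ j)            ≈⟨ -‿distribˡ-* _ _ ⟩
    - (suc m · 1#) * fromℤ j              ∎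

  ℤ-rawRing : RawRing _ _
  ℤ-rawRing = record { _≈_ = _≡_ ; _+_ = ℤ._+_ ; _*_ = ℤ._*_ ; -_ = ℤ.-_ ; 0# = ℤ.+ 0 ; 1# = ℤ.+ 1 }

  -- Equality in an abstract ring is undecidable, whereas integer coefficients can be compared;
  -- normalising with them lets the solver recognise cancellations such as x - x.
  morphism : ℤ-rawRing ACR.-Raw-AlmostCommutative⟶ ACR.fromCommutativeRing R
  morphism = record
    { ⟦_⟧ = fromℤ ; +-homo = +-homo ; *-homo = *-homo ; -‿homo = -‿homo
    ; 0-homo = refl ; 1-homo = refl }

  private
    _≟_ : ∀ i j → Maybe (fromℤ i ≈ fromℤ j)
    i ≟ j with i ℤ.≟ j
    ... | yes i≡j = just (reflexive (≡.cong fromℤ i≡j))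
    ... | no  _   = nothing

  open RingSolver ℤ-rawRing (ACR.fromCommutativeRing R) morphism _≟_ public
    using (solve; _:=_; _:+_; _:*_; _:-_; :-_; _:^_; con; Polynomial)

  :0 :1 :2 : ∀ {n} → Polynomial n
  :0 = con (ℤ.+ 0)
  :1 = con (ℤ.+ 1)
  :2 = con (ℤ.+ 2)

-- Weak inequalities, reciprocals and powers in a constructive ordered field

module RealOrder {c ℓ₁ ℓ₂} (𝓡 : RealField c ℓ₁ ℓ₂) where
  open RealField 𝓡
  open IsStrictPartialOrder isStrictPartialOrder public
    using (<-resp-≈) renaming (irrefl to <-irrefl; trans to <-trans; asym to <-asym)
  open IntegerCoefficients commutativeRing
  open HeytingProperties heytingCommutativeRing using (1#0; #-congˡ; #-congʳ)
  open CommutativeRing commutativeRing using (setoid; semiring)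
  open SemiringExp semiring using (_^_; ^-homo-*) public

  infix 4 _≤_
  -- As a negation of the strict order, a weak inequality may be proved by cases that are only
  -- classically exhaustive.
  _≤_ : Carrier → Carrier → Set ℓ₂
  x ≤ y = ¬ (y < x)

  <-resp : ∀ {x x′ y y′} → x ≈ x′ → y ≈ y′ → x < y → x′ < y′
  <-resp p q x<y = proj₂ <-resp-≈ p (proj₁ <-resp-≈ q x<y)

  ≤-resp : ∀ {x x′ y y′} → x ≈ x′ → y ≈ y′ → x ≤ y → x′ ≤ y′
  ≤-resp p q x≤y y′<x′ = x≤y (<-resp (sym q) (sym p) y′<x′)

  <⇒≤ : ∀ {x y} → x < y → x ≤ y
  <⇒≤ = <-asym

  ≤-reflexive : ∀ {x y} → x ≈ y → x ≤ y
  ≤-reflexive x≈y = <-irrefl (sym x≈y)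

  ≤-refl : ∀ {x} → x ≤ x
  ≤-refl = ≤-reflexive refl

  <-cotrans : ∀ {x y} → x < y → ∀ z → x < z ⊎ z < y
  <-cotrans {x} {y} x<y z with #-cotrans (<⇒# x<y) z
  ... | inj₁ x#z with #⇒<⊎> x#z
  ...   | inj₁ x<z = inj₁ x<z
  ...   | inj₂ z<x = inj₂ (<-trans z<x x<y)
  <-cotrans {x} {y} x<y z | inj₂ z#y with #⇒<⊎> z#y
  ...   | inj₁ z<y = inj₂ z<y
  ...   | inj₂ y<z = inj₁ (<-trans x<y y<z)

  ≤-trans : ∀ {x y z} → x ≤ y → y ≤ z → x ≤ z
  ≤-trans {y = y} x≤y y≤z z<x with <-cotrans z<x y
  ... | inj₁ z<y = y≤z z<y
  ... | inj₂ y<x = x≤y y<x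

  <-≤-trans : ∀ {x y z} → x < y → y ≤ z → x < z
  <-≤-trans {z = z} x<y y≤z with <-cotrans x<y z
  ... | inj₁ x<z = x<z
  ... | inj₂ z<y = ⊥-elim (y≤z z<y)

  ≤-<-trans : ∀ {x y z} → x ≤ y → y < z → x < z
  ≤-<-trans {x = x} x≤y y<z with <-cotrans y<z x
  ... | inj₁ y<x = ⊥-elim (x≤y y<x)
  ... | inj₂ x<z = x<z

  ≤-antisym : ∀ {x y} → x ≤ y → y ≤ x → x ≈ y
  ≤-antisym x≤y y≤x = proj₁ (tight _ _) λ x#y → [ y≤x , x≤y ]′ (#⇒<⊎> x#y)

  x<y⇒0<y-x : ∀ {x y} → x < y → 0# < y - x
  x<y⇒0<y-x {x} {y} x<y = <-resp (-‿inverseˡ x) (+-comm (- x) y) (+-monoʳ-< (- x) x<y)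

  0<y-x⇒x<y : ∀ {x y} → 0# < y - x → x < y
  0<y-x⇒x<y {x} {y} 0<y-x = <-resp (+-identityʳ x)
    (solve 2 (λ x y → x :+ (y :- x) := y) refl x y) (+-monoʳ-< x 0<y-x)

  ≤-by : ∀ {x y d} → y - x ≈ d → 0# ≤ d → x ≤ y
  ≤-by {x} {y} {d} y-x≈d 0≤d y<x = 0≤d (0<y-x⇒x<y (<-resp refl
    (trans (solve 2 (λ x y → x :- y := :0 :- (y :- x)) refl x y) (+-congˡ (-‿cong y-x≈d)))
    (x<y⇒0<y-x y<x)))

  0≤y-x : ∀ {x y} → x ≤ y → 0# ≤ y - x
  0≤y-x {x} {y} x≤y y-x<0 = x≤y (0<y-x⇒x<y (<-resp refl
    (solve 2 (λ x y → :0 :- (y :- x) := x :- y) refl x y) (x<y⇒0<y-x y-x<0)))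

  <-by : ∀ {x y d} → y - x ≈ d → 0# < d → x < y
  <-by y-x≈d 0<d = 0<y-x⇒x<y (<-resp refl (sym y-x≈d) 0<d)

  0≤+ : ∀ {x y} → 0# ≤ x → 0# ≤ y → 0# ≤ x + y
  0≤+ {x} {y} 0≤x 0≤y x+y<0 =
    0≤y (≤-<-trans (≤-by (solve 2 (λ x y → (x :+ y) :- y := x) refl x y) 0≤x) x+y<0)

  0<+ : ∀ {x y} → 0# < x → 0# ≤ y → 0# < x + y
  0<+ {x} {y} 0<x 0≤y = <-≤-trans 0<x (≤-by (solve 2 (λ x y → (x :+ y) :- x := y) refl x y) 0≤y)

  +-mono-≤ : ∀ {x x′ y y′} → x ≤ x′ → y ≤ y′ → x + y ≤ x′ + y′
  +-mono-≤ {x} {x′} {y} {y′} p q = ≤-by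
    (solve 4 (λ x x′ y y′ → (x′ :+ y′) :- (x :+ y) := (x′ :- x) :+ (y′ :- y)) refl x x′ y y′)
    (0≤+ (0≤y-x p) (0≤y-x q))

  -- The order is not decidable, but its three cases cannot all fail, by tightness; this is enough
  -- whenever the goal is a negation, as every weak inequality is.
  trichotomy : ∀ x y {a} {A : Set a} → (x < y → ¬ A) → (x ≈ y → ¬ A) → (y < x → ¬ A) → ¬ A
  trichotomy x y lt eq gt a = eq (≤-antisym (λ y<x → gt y<x a) (λ x<y → lt x<y a)) a

  0<⊎≈ : ∀ {x a} {A : Set a} → 0# ≤ x → (0# < x → ¬ A) → (x ≈ 0# → ¬ A) → ¬ A
  0<⊎≈ 0≤x lt eq = trichotomy 0# _ lt (λ 0≈x → eq (sym 0≈x)) (λ x<0 _ → 0≤x x<0)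

  0≤* : ∀ {x y} → 0# ≤ x → 0# ≤ y → 0# ≤ x * y
  0≤* {x} {y} 0≤x 0≤y =
    0<⊎≈ 0≤x (λ 0<x → 0<⊎≈ 0≤y
      (λ 0<y → <⇒≤ (*-pos 0<x 0<y))
      (λ y≈0 → ≤-reflexive (sym (trans (*-congˡ y≈0) (zeroʳ x)))))
      (λ x≈0 → ≤-reflexive (sym (trans (*-congʳ x≈0) (zeroˡ y))))

  0≤x² : ∀ x → 0# ≤ x * x
  0≤x² x = trichotomy 0# x
    (λ 0<x → <⇒≤ (*-pos 0<x 0<x))
    (λ 0≈x → ≤-reflexive (sym (trans (*-congʳ (sym 0≈x)) (zeroˡ x))))
    (λ x<0 → let 0<-x = x<y⇒0<y-x x<0 in
      <⇒≤ (<-resp refl (solve 1 (λ x → (:0 :- x) :* (:0 :- x) := x :* x) refl x) (*-pos 0<-x 0<-x)))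

  0<1 : 0# < 1#
  0<1 with #⇒<⊎> 1#0
  ... | inj₁ 1<0 = ⊥-elim (0≤x² 1# (<-resp (sym (*-identityˡ 1#)) refl 1<0))
  ... | inj₂ 0<1 = 0<1

  0≤1 : 0# ≤ 1#
  0≤1 = <⇒≤ 0<1

  *-mono-≤ : ∀ {x x′ y y′} → 0# ≤ x → 0# ≤ y′ → x ≤ x′ → y ≤ y′ → x * y ≤ x′ * y′
  *-mono-≤ {x} {x′} {y} {y′} 0≤x 0≤y′ p q = ≤-by
    (solve 4 (λ x x′ y y′ → x′ :* y′ :- x :* y := (x′ :- x) :* y′ :+ x :* (y′ :- y)) refl x x′ y y′)
    (0≤+ (0≤* (0≤y-x p) 0≤y′) (0≤* 0≤x (0≤y-x q)))

  *-monoˡ-≤ : ∀ {x y y′} → 0# ≤ x → y ≤ y′ → x * y ≤ x * y′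
  *-monoˡ-≤ {x} {y} {y′} 0≤x q = ≤-by
    (solve 3 (λ x y y′ → x :* y′ :- x :* y := x :* (y′ :- y)) refl x y y′) (0≤* 0≤x (0≤y-x q))

  *-monoˡ-< : ∀ {x y y′} → 0# < x → y < y′ → x * y < x * y′
  *-monoˡ-< {x} {y} {y′} 0<x q = <-by
    (solve 3 (λ x y y′ → x :* y′ :- x :* y := x :* (y′ :- y)) refl x y y′) (*-pos 0<x (x<y⇒0<y-x q))

  ²-cancel-≤ : ∀ {x y} → 0# ≤ y → x * x ≤ y * y → x ≤ y
  ²-cancel-≤ {x} {y} 0≤y x²≤y² y<x = x²≤y² (<-by
    (solve 2 (λ x y → x :* x :- y :* y := (x :- y) :* (x :- y) :+ (x :- y) :* (y :+ y)) refl x y)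
    (0<+ (*-pos 0<x-y 0<x-y) (0≤* (<⇒≤ 0<x-y) (0≤+ 0≤y 0≤y))))
    where 0<x-y = x<y⇒0<y-x y<x

  x*y≈1⇒0<y : ∀ {x y} → 0# < x → x * y ≈ 1# → 0# < y
  x*y≈1⇒0<y {x} {y} 0<x xy≈1 with #⇒<⊎> (invertible⇒# (x , trans (*-congˡ (x-0 y)) xy≈1 , trans (*-congʳ (x-0 y)) (trans (*-comm y x) xy≈1)))
    where
    x-0 : ∀ y → y - 0# ≈ y
    x-0 = solve 1 (λ y → y :- :0 := y) refl
  ... | inj₁ y<0 = ⊥-elim (<-asym 0<1 (<-resp xy≈1 (zeroʳ x) (*-monoˡ-< 0<x y<0)))
  ... | inj₂ 0<y = 0<y

  reciprocal : ∀ {x} → 0# < x → ∃[ y ] (0# < y × x * y ≈ 1#)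
  reciprocal {x} 0<x = y , x*y≈1⇒0<y 0<x x*y≈1 , x*y≈1
    where
    inv = #⇒invertible (#-sym (<⇒# 0<x))
    y = proj₁ inv
    x*y≈1 : x * y ≈ 1#
    x*y≈1 = trans (*-congʳ (solve 1 (λ x → x := x :- :0) refl x)) (proj₂ (proj₂ inv))

  half : ∀ {ε} → 0# < ε → ∃[ δ ] (0# < δ × δ + δ ≈ ε)
  half {ε} 0<ε = let h , 0<h , 2h≈1 = reciprocal (0<+ 0<1 0≤1) in
    h * ε , *-pos 0<h 0<ε ,
    trans (solve 2 (λ h ε → h :* ε :+ h :* ε := (:1 :+ :1) :* h :* ε) refl h ε)
          (trans (*-congʳ 2h≈1) (*-identityˡ ε))

  0≤· : ∀ n → 0# ≤ n · 1#
  0≤· zero    = ≤-refl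
  0≤· (suc n) = 0≤+ 0≤1 (0≤· n)

  0≤^ : ∀ {x} → 0# ≤ x → ∀ n → 0# ≤ x ^ n
  0≤^ 0≤x zero    = 0≤1
  0≤^ 0≤x (suc n) = 0≤* 0≤x (0≤^ 0≤x n)

  0<^ : ∀ {x} → 0# < x → ∀ n → 0# < x ^ n
  0<^ 0<x zero    = 0<1
  0<^ 0<x (suc n) = *-pos 0<x (0<^ 0<x n)

  -- (1 - r)(1 + r + ... + rⁿ⁻¹) = 1 - rⁿ, and every summand is at least rⁿ.
  n[1-r]rⁿ≤1-rⁿ : ∀ {r} → 0# ≤ r → r ≤ 1# → ∀ n → n · 1# * ((1# - r) * r ^ n) ≤ 1# - r ^ n
  n[1-r]rⁿ≤1-rⁿ {r} 0≤r r≤1 zero    = ≤-reflexive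
    (solve 1 (λ r → :0 :* ((:1 :- r) :* :1) := :1 :- :1) refl r)
  n[1-r]rⁿ≤1-rⁿ {r} 0≤r r≤1 (suc n) = ≤-by
    (solve 3 (λ r R N → (:1 :- r :* R) :- (:1 :+ N) :* ((:1 :- r) :* (r :* R)) :=
        ((:1 :- R) :- N :* ((:1 :- r) :* R)) :+ (:1 :+ N) :* ((:1 :- r) :* (:1 :- r) :* R))
      refl r (r ^ n) (n · 1#))
    (0≤+ (0≤y-x (n[1-r]rⁿ≤1-rⁿ 0≤r r≤1 n))
         (0≤* (0≤· (suc n)) (0≤* (0≤x² (1# - r)) (0≤^ 0≤r n))))

  ^-mono-≤1 : ∀ {r} → 0# ≤ r → r ≤ 1# → ∀ n → r ^ n ≤ 1#
  ^-mono-≤1 0≤r r≤1 zero    = ≤-refl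
  ^-mono-≤1 {r} 0≤r r≤1 (suc n) = ≤-resp refl (*-identityˡ 1#)
    (*-mono-≤ 0≤r 0≤1 r≤1 (^-mono-≤1 0≤r r≤1 n))

  ^-antimono : ∀ {r} → 0# ≤ r → r ≤ 1# → ∀ {m n} → m ℕ.≤ n → r ^ n ≤ r ^ m
  ^-antimono 0≤r r≤1 {n = n} ℕ.z≤n = ^-mono-≤1 0≤r r≤1 n
  ^-antimono 0≤r r≤1 (ℕ.s≤s m≤n)   = *-monoˡ-≤ 0≤r (^-antimono 0≤r r≤1 m≤n)

  -- If n exceeds K = 1 / ((1 - r) ε), then ε < rⁿ would give 1 < n (1 - r) rⁿ, against
  -- `n[1-r]rⁿ≤1-rⁿ`.
  ^-null : ∀ {r} → 0# ≤ r → r < 1# → ∀ {ε} → 0# < ε → ∃[ n ] (r ^ n ≤ ε)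
  ^-null {r} 0≤r r<1 {ε} 0<ε = n , λ ε<rⁿ → <-irrefl refl (<-≤-trans (1<_ ε<rⁿ) (≤-trans (n[1-r]rⁿ≤1-rⁿ 0≤r (<⇒≤ r<1) n) 1-rⁿ≤1))
    where
    0<1-r = x<y⇒0<y-x r<1
    recip = reciprocal (*-pos 0<1-r 0<ε)
    K = proj₁ recip
    n = proj₁ (archimedean K)
    K<n = proj₂ (archimedean K)
    1-rⁿ≤1 : 1# - r ^ n ≤ 1#
    1-rⁿ≤1 = ≤-by (solve 1 (λ x → :1 :- (:1 :- x) := x) refl (r ^ n)) (0≤^ 0≤r n)
    1<_ : ε < r ^ n → 1# < n · 1# * ((1# - r) * r ^ n)
    1< ε<rⁿ = <-trans
      (<-resp (proj₂ (proj₂ recip)) (*-comm _ _) (*-monoˡ-< (*-pos 0<1-r 0<ε) K<n))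
      (*-monoˡ-< (<-trans (proj₁ (proj₂ recip)) K<n) (*-monoˡ-< 0<1-r ε<rⁿ))

module Real {c ℓ₁ ℓ₂} (𝓡 : RealField c ℓ₁ ℓ₂) where
  open RealField 𝓡 public
  open RealOrder 𝓡 public
  open IntegerCoefficients commutativeRing public

-- Normed rings, and the complex numbers as an instance

record NormedRing {c ℓ₁ ℓ₂} (𝓡 : RealField c ℓ₁ ℓ₂) : Set (lsuc (c ⊔ ℓ₁ ⊔ ℓ₂)) where
  private
    module ℝ = Real 𝓡
  field
    commutativeRing : CommutativeRing c ℓ₁
  open CommutativeRing commutativeRing public
  infix 4 ∥_∥≤_
  -- The norm enters only through its upper bounds, so no square root is needed.
  field
    ∥_∥≤_     : Carrier → ℝ.Carrier → Set ℓ₂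
    ∥∥-resp   : ∀ {z w r s} → z ≈ w → r ℝ.≤ s → ∥ z ∥≤ r → ∥ w ∥≤ s
    ∥∥⇒0≤     : ∀ {z r} → ∥ z ∥≤ r → ℝ.0# ℝ.≤ r
    ∥0∥       : ∥ 0# ∥≤ ℝ.0#
    ∥1∥       : ∥ 1# ∥≤ ℝ.1#
    ∥+∥       : ∀ {z w r s} → ∥ z ∥≤ r → ∥ w ∥≤ s → ∥ z + w ∥≤ r ℝ.+ s
    ∥*∥       : ∀ {z w r s} → ∥ z ∥≤ r → ∥ w ∥≤ s → ∥ z * w ∥≤ r ℝ.* s
    ∥-∥       : ∀ {z r} → ∥ z ∥≤ r → ∥ - z ∥≤ r
    bounded   : ∀ z → ∃[ r ] ∥ z ∥≤ r
    ∥∥-tight  : ∀ {z} → (∀ ε → ℝ.0# ℝ.< ε → ∥ z ∥≤ ε) → z ≈ 0#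
    complete  : ∀ (s : ℕ → Carrier) →
      (∀ ε → ℝ.0# ℝ.< ε → ∃[ N ] (∀ m n → N ℕ.≤ m → N ℕ.≤ n → ∥ s m - s n ∥≤ ε)) →
      ∃[ L ] (∀ ε → ℝ.0# ℝ.< ε → ∃[ N ] (∀ n → N ℕ.≤ n → ∥ s n - L ∥≤ ε))
    -- The bound K = 1 / (1 - r) on the inverse is what makes the reciprocal of an infinite
    -- Pochhammer product an infinite product of the same convergent kind.
    geometric : ∀ {x r K} → ∥ x ∥≤ r → r ℝ.< ℝ.1# → (ℝ.1# ℝ.- r) ℝ.* K ℝ.≈ ℝ.1# →
      ∃[ w ] ((1# - x) * w ≈ 1# × ∥ w ∥≤ K)
    2-unit    : ∃[ w ] (1# + 1#) * w ≈ 1#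
    ≈-stable  : ∀ {z w} → ¬ ¬ (z ≈ w) → z ≈ w
    -- The dichotomy itself is not constructive; doubly negated, together with `≈-stable`, it
    -- suffices for proving an equation by cases on z.
    ≈0⊎unit   : ∀ z → ¬ ¬ (z ≈ 0# ⊎ ∃[ w ] z * w ≈ 1#)

module ComplexNormed {c ℓ₁ ℓ₂} (𝓡 : RealField c ℓ₁ ℓ₂) where
  open Complex 𝓡
  private
    module ℝ = Real 𝓡
  open ℝ using (_≤_; _<_; _≈_; solve; _:=_; _:+_; _:*_; _:-_; :-_; :0; :1; :2)

  ℂ-commutativeRing : CommutativeRing c ℓ₁
  ℂ-commutativeRing = record
    { Carrier = ℂ ; _≈_ = _≈ᶜ_ ; _+_ = _+_ ; _*_ = _*_ ; -_ = -_ ; 0# = 0# ; 1# = 1#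
    ; isCommutativeRing = record
      { isRing = record
        { +-isAbelianGroup = record
          { isGroup = record
            { isMonoid = record
              { isSemigroup = record
                { isMagma = record
                  { isEquivalence = record
                    { refl  = ℝ.refl , ℝ.refl
                    ; sym   = λ (p , q) → ℝ.sym p , ℝ.sym q
                    ; trans = λ (p , q) (p′ , q′) → ℝ.trans p p′ , ℝ.trans q q′ }
                  ; ∙-cong = λ (p , q) (p′ , q′) → ℝ.+-cong p p′ , ℝ.+-cong q q′ }
                ; assoc = λ _ _ _ → ℝ.+-assoc _ _ _ , ℝ.+-assoc _ _ _ }
              ; identity = (λ _ → ℝ.+-identityˡ _ , ℝ.+-identityˡ _)
                         , (λ _ → ℝ.+-identityʳ _ , ℝ.+-identityʳ _) }
            ; inverse = (λ _ → ℝ.-‿inverseˡ _ , ℝ.-‿inverseˡ _)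
                      , (λ _ → ℝ.-‿inverseʳ _ , ℝ.-‿inverseʳ _)
            ; ⁻¹-cong = λ (p , q) → ℝ.-‿cong p , ℝ.-‿cong q }
          ; comm = λ _ _ → ℝ.+-comm _ _ , ℝ.+-comm _ _ }
        ; *-cong = λ (p , q) (p′ , q′) →
            ℝ.+-cong (ℝ.*-cong p p′) (ℝ.-‿cong (ℝ.*-cong q q′)) ,
            ℝ.+-cong (ℝ.*-cong p q′) (ℝ.*-cong q p′)
        ; *-assoc = λ (a +i b) (a′ +i b′) (a″ +i b″) →
            solve 6 (λ a b a′ b′ a″ b″ →
              (a :* a′ :- b :* b′) :* a″ :- (a :* b′ :+ b :* a′) :* b″ :=
              a :* (a′ :* a″ :- b′ :* b″) :- b :* (a′ :* b″ :+ b′ :* a″))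
              ℝ.refl a b a′ b′ a″ b″ ,
            solve 6 (λ a b a′ b′ a″ b″ →
              (a :* a′ :- b :* b′) :* b″ :+ (a :* b′ :+ b :* a′) :* a″ :=
              a :* (a′ :* b″ :+ b′ :* a″) :+ b :* (a′ :* a″ :- b′ :* b″))
              ℝ.refl a b a′ b′ a″ b″
        ; *-identity =
            (λ (a +i b) → solve 2 (λ a b → :1 :* a :- :0 :* b := a) ℝ.refl a b ,
                          solve 2 (λ a b → :1 :* b :+ :0 :* a := b) ℝ.refl a b) ,
            (λ (a +i b) → solve 2 (λ a b → a :* :1 :- b :* :0 := a) ℝ.refl a b ,
                          solve 2 (λ a b → a :* :0 :+ b :* :1 := b) ℝ.refl a b)
        ; distrib =
            (λ (a +i b) (a′ +i b′) (a″ +i b″) →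
              solve 6 (λ a b a′ b′ a″ b″ →
                a :* (a′ :+ a″) :- b :* (b′ :+ b″) :=
                (a :* a′ :- b :* b′) :+ (a :* a″ :- b :* b″)) ℝ.refl a b a′ b′ a″ b″ ,
              solve 6 (λ a b a′ b′ a″ b″ →
                a :* (b′ :+ b″) :+ b :* (a′ :+ a″) :=
                (a :* b′ :+ b :* a′) :+ (a :* b″ :+ b :* a″)) ℝ.refl a b a′ b′ a″ b″) ,
            (λ (a +i b) (a′ +i b′) (a″ +i b″) →
              solve 6 (λ a b a′ b′ a″ b″ →
                (a′ :+ a″) :* a :- (b′ :+ b″) :* b :=
                (a′ :* a :- b′ :* b) :+ (a″ :* a :- b″ :* b)) ℝ.refl a b a′ b′ a″ b″ ,
              solve 6 (λ a b a′ b′ a″ b″ →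
                (a′ :+ a″) :* b :+ (b′ :+ b″) :* a :=
                (a′ :* b :+ b′ :* a) :+ (a″ :* b :+ b″ :* a)) ℝ.refl a b a′ b′ a″ b″)
        }
      ; *-comm = λ (a +i b) (a′ +i b′) →
          solve 4 (λ a b a′ b′ → a :* a′ :- b :* b′ := a′ :* a :- b′ :* b) ℝ.refl a b a′ b′ ,
          solve 4 (λ a b a′ b′ → a :* b′ :+ b :* a′ := a′ :* b :+ b′ :* a) ℝ.refl a b a′ b′
      }
    }

  ∣∣²-cong : ∀ {z w} → z ≈ᶜ w → ∣ z ∣² ≈ ∣ w ∣²
  ∣∣²-cong (p , q) = ℝ.+-cong (ℝ.*-cong p p) (ℝ.*-cong q q)

  ∣∣²-homo-* : ∀ z w → ∣ z * w ∣² ≈ ∣ z ∣² ℝ.* ∣ w ∣²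
  ∣∣²-homo-* (a +i b) (a′ +i b′) = solve 4 (λ a b a′ b′ →
      (a :* a′ :- b :* b′) :* (a :* a′ :- b :* b′) :+ (a :* b′ :+ b :* a′) :* (a :* b′ :+ b :* a′)
      := (a :* a :+ b :* b) :* (a′ :* a′ :+ b′ :* b′)) ℝ.refl a b a′ b′

  0≤∣∣² : ∀ z → ℝ.0# ≤ ∣ z ∣²
  0≤∣∣² (a +i b) = ℝ.0≤+ (ℝ.0≤x² a) (ℝ.0≤x² b)

  re²≤∣∣² : ∀ z → re z ℝ.* re z ≤ ∣ z ∣²
  re²≤∣∣² (a +i b) = ℝ.≤-by (solve 2 (λ a b → (a :+ b) :- a := b) ℝ.refl _ _) (ℝ.0≤x² b)

  im²≤∣∣² : ∀ z → im z ℝ.* im z ≤ ∣ z ∣²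
  im²≤∣∣² (a +i b) = ℝ.≤-by (solve 2 (λ a b → (a :+ b) :- b := a) ℝ.refl _ _) (ℝ.0≤x² a)

  infix 4 ∥_∥≤_
  ∥_∥≤_ : ℂ → ℝ.Carrier → Set ℓ₂
  ∥ z ∥≤ r = (ℝ.0# ≤ r) × (∣ z ∣² ≤ r ℝ.* r)

  private
    neg² : ∀ x → (ℝ.- x) ℝ.* (ℝ.- x) ≈ x ℝ.* x
    neg² = solve 1 (λ x → (:- x) :* (:- x) := x :* x) ℝ.refl

    re≤ : ∀ {z r} → ∥ z ∥≤ r → re z ≤ r
    re≤ {z} (0≤r , h) = ℝ.²-cancel-≤ 0≤r (ℝ.≤-trans (re²≤∣∣² z) h)
    im≤ : ∀ {z r} → ∥ z ∥≤ r → im z ≤ r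
    im≤ {z} (0≤r , h) = ℝ.²-cancel-≤ 0≤r (ℝ.≤-trans (im²≤∣∣² z) h)

    ∥-∥ : ∀ {z r} → ∥ z ∥≤ r → ∥ - z ∥≤ r
    ∥-∥ {a +i b} (0≤r , h) = 0≤r , ℝ.≤-resp (ℝ.sym (ℝ.+-cong (neg² a) (neg² b))) ℝ.refl h

    ∥*∥ : ∀ {z w r s} → ∥ z ∥≤ r → ∥ w ∥≤ s → ∥ z * w ∥≤ r ℝ.* s
    ∥*∥ {z} {w} {r} {s} (0≤r , h) (0≤s , k) = ℝ.0≤* 0≤r 0≤s ,
      ℝ.≤-resp (ℝ.sym (∣∣²-homo-* z w))
        (solve 2 (λ r s → (r :* r) :* (s :* s) := (r :* s) :* (r :* s)) ℝ.refl r s)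
        (ℝ.*-mono-≤ (0≤∣∣² z) (ℝ.0≤* 0≤s 0≤s) h k)

    -- Cauchy-Schwarz for the cross term: re (z w̄) is a component of z w̄, whose modulus is |z| |w|.
    ∥+∥ : ∀ {z w r s} → ∥ z ∥≤ r → ∥ w ∥≤ s → ∥ z + w ∥≤ r ℝ.+ s
    ∥+∥ {a +i b} {a′ +i b′} {r} {s} (0≤r , h) (0≤s , k) = ℝ.0≤+ 0≤r 0≤s , ℝ.≤-by
      (solve 6 (λ a b a′ b′ r s →
        (r :+ s) :* (r :+ s) :- ((a :+ a′) :* (a :+ a′) :+ (b :+ b′) :* (b :+ b′)) :=
        ((r :* r :- (a :* a :+ b :* b)) :+ (s :* s :- (a′ :* a′ :+ b′ :* b′)))
          :+ ((r :* s :- (a :* a′ :- b :* (:- b′))) :+ (r :* s :- (a :* a′ :- b :* (:- b′)))))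
        ℝ.refl a b a′ b′ r s)
      (ℝ.0≤+ (ℝ.0≤+ (ℝ.0≤y-x h) (ℝ.0≤y-x k)) (ℝ.0≤+ (ℝ.0≤y-x cross) (ℝ.0≤y-x cross)))
      where
      cross = re≤ {(a +i b) * (a′ +i (ℝ.- b′))} {r ℝ.* s}
        (∥*∥ {a +i b} {a′ +i (ℝ.- b′)} (0≤r , h)
          (0≤s , ℝ.≤-resp (ℝ.+-congˡ (ℝ.sym (neg² b′))) ℝ.refl k))

    0≤∀ε : ∀ {x} → (∀ ε → ℝ.0# < ε → x ≤ ε) → x ≤ ℝ.0#
    0≤∀ε {x} h 0<x = let δ , 0<δ , 2δ≈x = ℝ.half 0<x in
      h δ 0<δ (ℝ.<-by (ℝ.trans (ℝ.+-congʳ (ℝ.sym 2δ≈x)) (solve 1 (λ δ → (δ :+ δ) :- δ := δ) ℝ.refl δ)) 0<δ)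

    -re≤ : ∀ {z r} → ∥ z ∥≤ r → ℝ.- re z ≤ r
    -re≤ h = re≤ (∥-∥ h)
    -im≤ : ∀ {z r} → ∥ z ∥≤ r → ℝ.- im z ≤ r
    -im≤ h = im≤ (∥-∥ h)

    ±≤0 : ∀ {x} → x ≤ ℝ.0# → ℝ.- x ≤ ℝ.0# → x ≈ ℝ.0#
    ±≤0 {x} p q = ℝ.≤-antisym p (ℝ.≤-by (solve 1 (λ x → x :- :0 := :0 :- (:- x)) ℝ.refl x) (ℝ.0≤y-x q))

    tight : ∀ {z} → (∀ ε → ℝ.0# < ε → ∥ z ∥≤ ε) → z ≈ᶜ 0#
    tight h = ±≤0 (0≤∀ε λ ε p → re≤ (h ε p)) (0≤∀ε λ ε p → -re≤ (h ε p)) ,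
              ±≤0 (0≤∀ε λ ε p → im≤ (h ε p)) (0≤∀ε λ ε p → -im≤ (h ε p))

    ²≤² : ∀ {x δ} → x ≤ δ → ℝ.- x ≤ δ → x ℝ.* x ≤ δ ℝ.* δ
    ²≤² {x} {δ} p q = ℝ.≤-by
      (solve 2 (λ x δ → δ :* δ :- x :* x := (δ :- x) :* (δ :- (:- x))) ℝ.refl x δ)
      (ℝ.0≤* (ℝ.0≤y-x p) (ℝ.0≤y-x q))

    close⇒²≤² : ∀ {x y δ} → ℝ.Close δ x y → (x ℝ.- y) ℝ.* (x ℝ.- y) ≤ δ ℝ.* δ
    close⇒²≤² {x} {y} {δ} (p , q) = ²≤² (ℝ.<⇒≤ p)
      (ℝ.≤-resp (solve 2 (λ x y → y :- x := :- (x :- y)) ℝ.refl x y) ℝ.refl (ℝ.<⇒≤ q))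

    δ<ε : ∀ {δ ε} → ℝ.0# < δ → δ ℝ.+ δ ≈ ε → δ < ε
    δ<ε {δ} 0<δ 2δ≈ε = ℝ.<-by (ℝ.trans (ℝ.+-congʳ (ℝ.sym 2δ≈ε)) (solve 1 (λ δ → (δ :+ δ) :- δ := δ) ℝ.refl δ)) 0<δ

    2δ²≤ε² : ∀ {δ ε} → δ ℝ.+ δ ≈ ε → δ ℝ.* δ ℝ.+ δ ℝ.* δ ≤ ε ℝ.* ε
    2δ²≤ε² {δ} 2δ≈ε = ℝ.≤-resp ℝ.refl (ℝ.*-cong 2δ≈ε 2δ≈ε)
      (ℝ.≤-by (solve 1 (λ δ → (δ :+ δ) :* (δ :+ δ) :- (δ :* δ :+ δ :* δ) := δ :* δ :+ δ :* δ) ℝ.refl δ)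
        (ℝ.0≤+ (ℝ.0≤x² δ) (ℝ.0≤x² δ)))

    Limit : (ℕ → ℂ) → ℂ → Set _
    Limit s L = ∀ ε → ℝ.0# < ε → ∃[ N ] (∀ n → N ℕ.≤ n → ∥ s n - L ∥≤ ε)

    ℝ-Limit : (ℕ → ℝ.Carrier) → ℝ.Carrier → Set _
    ℝ-Limit s L = ∀ ε → ℝ.0# < ε → ∃[ N ] (∀ n → N ℕ.≤ n → ℝ.Close ε (s n) L)

    componentwise : ∀ (s : ℕ → ℂ) L → ℝ-Limit (λ n → re (s n)) (re L) → ℝ-Limit (λ n → im (s n)) (im L) →
      Limit s L
    componentwise s L lim-re lim-im ε 0<ε =
      let δ , 0<δ , 2δ≈ε = ℝ.half 0<ε
          N , h = lim-re δ 0<δ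
          N′ , h′ = lim-im δ 0<δ
      in N ℕ.⊔ N′ , λ n ≤n → ℝ.<⇒≤ 0<ε , ℝ.≤-trans
        (ℝ.+-mono-≤ (close⇒²≤² (h n (ℕ.m⊔n≤o⇒m≤o N N′ ≤n))) (close⇒²≤² (h′ n (ℕ.m⊔n≤o⇒n≤o N N′ ≤n))))
        (2δ²≤ε² 2δ≈ε)

    ℝ-complete : (s : ℕ → ℝ.Carrier) →
      (∀ ε → ℝ.0# < ε → ∃[ N ] (∀ m n → N ℕ.≤ m → N ℕ.≤ n → s m ℝ.- s n ≤ ε)) → ∃[ L ] ℝ-Limit s L
    ℝ-complete s cauchy = ℝ.complete s λ ε 0<ε →
      let δ , 0<δ , 2δ≈ε = ℝ.half 0<ε
          N , h = cauchy δ 0<δ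
      in N , λ m n N≤m N≤n →
          ℝ.≤-<-trans (h m n N≤m N≤n) (δ<ε 0<δ 2δ≈ε) ,
          ℝ.≤-<-trans (h n m N≤n N≤m) (δ<ε 0<δ 2δ≈ε)

    complete : ∀ (s : ℕ → ℂ) →
      (∀ ε → ℝ.0# < ε → ∃[ N ] (∀ m n → N ℕ.≤ m → N ℕ.≤ n → ∥ s m - s n ∥≤ ε)) →
      ∃[ L ] Limit s L
    complete s cauchy =
      let Lʳ , lim-re = ℝ-complete (λ n → re (s n)) λ ε 0<ε →
            let N , h = cauchy ε 0<ε in N , λ m n N≤m N≤n → re≤ {s m - s n} (h m n N≤m N≤n)
          Lⁱ , lim-im = ℝ-complete (λ n → im (s n)) λ ε 0<ε →
            let N , h = cauchy ε 0<ε in N , λ m n N≤m N≤n → im≤ {s m - s n} (h m n N≤m N≤n)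
      in (Lʳ +i Lⁱ) , componentwise s (Lʳ +i Lⁱ) lim-re lim-im

    -- The real part of 1 - x is at least 1 - r > 0, which makes 1 - x invertible; multiplicativity
    -- of the squared modulus turns this lower bound into the upper bound on the inverse.
    geometric : ∀ {x r K} → ∥ x ∥≤ r → r < ℝ.1# → (ℝ.1# ℝ.- r) ℝ.* K ≈ ℝ.1# →
      ∃[ w ] ((1# - x) * w ≈ᶜ 1# × ∥ w ∥≤ K)
    geometric {x@(a +i b)} {r} {K} ∥x∥≤r r<1 1-rK≈1 = w , ww≈1 , ℝ.<⇒≤ 0<K , ∣w∣²≤K²
      where
      0<1-r = ℝ.x<y⇒0<y-x r<1
      0<K = ℝ.x*y≈1⇒0<y 0<1-r 1-rK≈1
      lower : (ℝ.1# ℝ.- r) ℝ.* (ℝ.1# ℝ.- r) ≤ ∣ 1# - x ∣²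
      lower = ℝ.≤-trans
        (ℝ.*-mono-≤ (ℝ.<⇒≤ 0<1-r) (ℝ.≤-trans (ℝ.<⇒≤ 0<1-r) 1-r≤1-a) 1-r≤1-a 1-r≤1-a)
        (re²≤∣∣² (1# - x))
        where
        1-r≤1-a : ℝ.1# ℝ.- r ≤ ℝ.1# ℝ.- a
        1-r≤1-a = ℝ.≤-by (solve 2 (λ a r → (:1 :- a) :- (:1 :- r) := r :- a) ℝ.refl a r)
          (ℝ.0≤y-x (re≤ ∥x∥≤r))
      nz : NonZero (1# - x)
      nz = ℝ.#-sym (ℝ.<⇒# (ℝ.<-≤-trans (ℝ.*-pos 0<1-r 0<1-r) lower))
      w = inverse (1# - x) nz
      ww≈1 = *-inverseʳ (1# - x) nz
      ∣w∣²≤K² : ∣ w ∣² ≤ K ℝ.* K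
      ∣w∣²≤K² = ℝ.≤-resp
        (ℝ.trans (solve 3 (λ W r K → (W :* (K :* K)) :* ((:1 :- r) :* (:1 :- r)) := W :* (((:1 :- r) :* K) :* ((:1 :- r) :* K))) ℝ.refl ∣ w ∣² r K)
          (ℝ.trans (ℝ.*-congˡ (ℝ.trans (ℝ.*-cong 1-rK≈1 1-rK≈1) (ℝ.*-identityˡ _))) (ℝ.*-identityʳ _)))
        (ℝ.trans (solve 3 (λ W K Z → (W :* (K :* K)) :* Z := (K :* K) :* (Z :* W)) ℝ.refl ∣ w ∣² K ∣ 1# - x ∣²)
          (ℝ.trans (ℝ.*-congˡ (ℝ.trans (ℝ.sym (∣∣²-homo-* (1# - x) w)) (ℝ.trans (∣∣²-cong ww≈1) one))) (ℝ.*-identityʳ _)))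
        (ℝ.*-monoˡ-≤ (ℝ.0≤* (0≤∣∣² w) (ℝ.0≤x² K)) lower)
        where
        one : ∣ 1# ∣² ≈ ℝ.1#
        one = solve 0 (:1 :* :1 :+ :0 :* :0 := :1) ℝ.refl

    ℝ-stable : ∀ {x y} → ¬ ¬ (x ≈ y) → x ≈ y
    ℝ-stable ¬¬x≈y = proj₁ (ℝ.tight _ _) λ x#y → ¬¬x≈y λ x≈y → ℝ.#-irrefl x≈y x#y

    ≈-stable : ∀ {z w} → ¬ ¬ (z ≈ᶜ w) → z ≈ᶜ w
    ≈-stable h = ℝ-stable (λ k → h λ p → k (proj₁ p)) , ℝ-stable (λ k → h λ p → k (proj₂ p))

    ∣∣²≈0⇒≈0 : ∀ {z} → ∣ z ∣² ≈ ℝ.0# → z ≈ᶜ 0#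
    ∣∣²≈0⇒≈0 {z} eq = tight λ ε 0<ε → ℝ.<⇒≤ 0<ε , ℝ.≤-resp (ℝ.sym eq) ℝ.refl (ℝ.0≤x² ε)

    2-unit : ∃[ w ] (1# + 1#) * w ≈ᶜ 1#
    2-unit = let h , _ , 2h≈1 = ℝ.reciprocal (ℝ.0<+ ℝ.0<1 ℝ.0≤1) in
      (h +i ℝ.0#) ,
      ℝ.trans (solve 1 (λ h → (:1 :+ :1) :* h :- (:0 :+ :0) :* :0 := (:1 :+ :1) :* h) ℝ.refl h) 2h≈1 ,
      solve 1 (λ h → (:1 :+ :1) :* :0 :+ (:0 :+ :0) :* h := :0) ℝ.refl h

    -- Refuting invertibility means that ∣ z ∣² is not apart from 0, hence equals 0 by tightness,
    -- and then z is 0.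
    ≈0⊎unit : ∀ z → ¬ ¬ (z ≈ᶜ 0# ⊎ ∃[ w ] z * w ≈ᶜ 1#)
    ≈0⊎unit z k = k (inj₁ (∣∣²≈0⇒≈0 (proj₁ (ℝ.tight _ _) λ nz → k (inj₂ (inverse z nz , *-inverseʳ z nz)))))

  complexNormedRing : NormedRing 𝓡
  complexNormedRing = record
    { commutativeRing = ℂ-commutativeRing
    ; ∥_∥≤_ = ∥_∥≤_
    ; ∥∥-resp = λ z≈w r≤s (0≤r , h) → ℝ.≤-trans 0≤r r≤s ,
        ℝ.≤-resp (∣∣²-cong z≈w) ℝ.refl (ℝ.≤-trans h (ℝ.*-mono-≤ 0≤r (ℝ.≤-trans 0≤r r≤s) r≤s r≤s))
    ; ∥∥⇒0≤ = proj₁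
    ; ∥0∥ = ℝ.≤-refl , ℝ.≤-reflexive (solve 0 (:0 :* :0 :+ :0 :* :0 := :0 :* :0) ℝ.refl)
    ; ∥1∥ = ℝ.0≤1 , ℝ.≤-reflexive (solve 0 (:1 :* :1 :+ :0 :* :0 := :1 :* :1) ℝ.refl)
    ; ∥+∥ = λ {z} {w} → ∥+∥ {z} {w}
    ; ∥*∥ = λ {z} {w} → ∥*∥ {z} {w}
    ; ∥-∥ = λ {z} → ∥-∥ {z}
    ; bounded = λ z → ℝ.1# ℝ.+ ∣ z ∣² , ℝ.0≤+ ℝ.0≤1 (0≤∣∣² z) , ℝ.≤-by
        (solve 1 (λ x → (:1 :+ x) :* (:1 :+ x) :- x := (:1 :+ x) :+ x :* x) ℝ.refl ∣ z ∣²)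
        (ℝ.0≤+ (ℝ.0≤+ ℝ.0≤1 (0≤∣∣² z)) (ℝ.0≤x² ∣ z ∣²))
    ; ∥∥-tight = tight
    ; complete = complete
    ; geometric = λ {x} → geometric {x}
    ; 2-unit = 2-unit
    ; ≈-stable = ≈-stable
    ; ≈0⊎unit = ≈0⊎unit
    }

-- Finite sums and products

module FiniteSums {c ℓ} (R : CommutativeRing c ℓ) where
  open CommutativeRing R
  open IntegerCoefficients R
  open SetoidReasoning setoid

  ∑ : ℕ → (ℕ → Carrier) → Carrier
  ∑ zero    f = 0#
  ∑ (suc n) f = f 0 + ∑ n (f ∘ suc)

  ∏ : ℕ → (ℕ → Carrier) → Carrier
  ∏ zero    f = 1#
  ∏ (suc n) f = f 0 * ∏ n (f ∘ suc)

  ∑-cong< : ∀ n {f g} → (∀ k → k ℕ.< n → f k ≈ g k) → ∑ n f ≈ ∑ n g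
  ∑-cong< zero    h = refl
  ∑-cong< (suc n) h = +-cong (h 0 (ℕ.s≤s ℕ.z≤n)) (∑-cong< n λ k k<n → h (suc k) (ℕ.s≤s k<n))

  ∑-cong : ∀ n {f g} → (∀ k → f k ≈ g k) → ∑ n f ≈ ∑ n g
  ∑-cong n h = ∑-cong< n λ k _ → h k

  ∏-cong : ∀ n {f g} → (∀ k → f k ≈ g k) → ∏ n f ≈ ∏ n g
  ∏-cong zero    h = refl
  ∏-cong (suc n) h = *-cong (h 0) (∏-cong n (h ∘ suc))

  ∑-last : ∀ n f → ∑ (suc n) f ≈ ∑ n f + f n
  ∑-last zero    f = +-comm _ _
  ∑-last (suc n) f = trans (+-congˡ (∑-last n (f ∘ suc))) (sym (+-assoc _ _ _))

  ∏-last : ∀ n f → ∏ (suc n) f ≈ ∏ n f * f n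
  ∏-last zero    f = *-comm _ _
  ∏-last (suc n) f = trans (*-congˡ (∏-last n (f ∘ suc))) (sym (*-assoc _ _ _))

  ∑-+ : ∀ n f g → ∑ n (λ k → f k + g k) ≈ ∑ n f + ∑ n g
  ∑-+ zero    f g = sym (+-identityˡ 0#)
  ∑-+ (suc n) f g = trans (+-congˡ (∑-+ n (f ∘ suc) (g ∘ suc)))
    (solve 4 (λ a b c d → (a :+ b) :+ (c :+ d) := (a :+ c) :+ (b :+ d)) refl _ _ _ _)

  ∏-* : ∀ n f g → ∏ n (λ k → f k * g k) ≈ ∏ n f * ∏ n g
  ∏-* zero    f g = sym (*-identityˡ 1#)
  ∏-* (suc n) f g = trans (*-congˡ (∏-* n (f ∘ suc) (g ∘ suc)))
    (solve 4 (λ a b c d → (a :* b) :* (c :* d) := (a :* c) :* (b :* d)) refl _ _ _ _)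

  ∑-*ˡ : ∀ n a f → ∑ n (λ k → a * f k) ≈ a * ∑ n f
  ∑-*ˡ zero    a f = sym (zeroʳ a)
  ∑-*ˡ (suc n) a f = trans (+-congˡ (∑-*ˡ n a (f ∘ suc))) (sym (distribˡ a _ _))

  ∑-0 : ∀ n {f} → (∀ k → k ℕ.< n → f k ≈ 0#) → ∑ n f ≈ 0#
  ∑-0 zero    h = refl
  ∑-0 (suc n) h = trans (+-cong (h 0 (ℕ.s≤s ℕ.z≤n)) (∑-0 n λ k k<n → h (suc k) (ℕ.s≤s k<n))) (+-identityˡ 0#)

  ∏-1 : ∀ n {f} → (∀ k → f k ≈ 1#) → ∏ n f ≈ 1#
  ∏-1 zero    h = refl
  ∏-1 (suc n) h = trans (*-cong (h 0) (∏-1 n (h ∘ suc))) (*-identityˡ 1#)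

  ∑-split : ∀ m n f → ∑ (m ℕ.+ n) f ≈ ∑ m f + ∑ n (λ k → f (m ℕ.+ k))
  ∑-split zero    n f = sym (+-identityˡ _)
  ∑-split (suc m) n f = trans (+-congˡ (∑-split m n (f ∘ suc))) (sym (+-assoc _ _ _))

  ∏-split : ∀ m n f → ∏ (m ℕ.+ n) f ≈ ∏ m f * ∏ n (λ k → f (m ℕ.+ k))
  ∏-split zero    n f = sym (*-identityˡ _)
  ∏-split (suc m) n f = trans (*-congˡ (∏-split m n (f ∘ suc))) (sym (*-assoc _ _ _))

  ∑-comm : ∀ m n (f : ℕ → ℕ → Carrier) → ∑ m (λ i → ∑ n (λ j → f i j)) ≈ ∑ n (λ j → ∑ m (λ i → f i j))
  ∑-comm zero    n f = sym (∑-0 n λ _ _ → refl)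
  ∑-comm (suc m) n f = trans (+-congˡ (∑-comm m n (f ∘ suc))) (sym (∑-+ n (f 0) _))

  -- Consecutive partial products differ by the last product times `a k`. Read as a series, the
  -- product inherits convergence from `∑-converges`.
  ∏-1+ : ∀ n (a : ℕ → Carrier) → ∏ n (λ k → 1# + a k) ≈ 1# + ∑ n (λ k → ∏ k (λ j → 1# + a j) * a k)
  ∏-1+ zero    a = sym (+-identityʳ 1#)
  ∏-1+ (suc n) a = begin
    ∏ (suc n) b                                    ≈⟨ ∏-last n b ⟩
    ∏ n b * (1# + a n)                             ≈⟨ solve 2 (λ x y → x :* (:1 :+ y) := x :+ x :* y) refl _ _ ⟩
    ∏ n b + ∏ n b * a n                            ≈⟨ +-congʳ (∏-1+ n a) ⟩
    (1# + ∑ n (λ k → ∏ k b * a k)) + ∏ n b * a n   ≈⟨ +-assoc _ _ _ ⟩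
    1# + (∑ n (λ k → ∏ k b * a k) + ∏ n b * a n)   ≈⟨ +-congˡ (∑-last n _) ⟨
    1# + ∑ (suc n) (λ k → ∏ k b * a k)             ∎
    where
    b : ℕ → Carrier
    b k = 1# + a k

-- Limits, geometric domination, Tannery's theorem and infinite products

module Limits {c ℓ₁ ℓ₂} {𝓡 : RealField c ℓ₁ ℓ₂} (𝓝 : NormedRing 𝓡) where
  open NormedRing 𝓝
  open FiniteSums commutativeRing
  open IntegerCoefficients commutativeRing
  open SemiringExp semiring using (_^_)
  open SetoidReasoning setoid
  private module ℝ = Real 𝓡

  infix 4 _⟶_
  _⟶_ : (ℕ → Carrier) → Carrier → Set _
  s ⟶ L = ∀ ε → ℝ.0# ℝ.< ε → ∃[ N ] (∀ n → N ℕ.≤ n → ∥ s n - L ∥≤ ε)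

  ∥∥-cong : ∀ {z w r} → z ≈ w → ∥ z ∥≤ r → ∥ w ∥≤ r
  ∥∥-cong z≈w = ∥∥-resp z≈w ℝ.≤-refl

  ∥∥-mono : ∀ {z r s} → r ℝ.≤ s → ∥ z ∥≤ r → ∥ z ∥≤ s
  ∥∥-mono = ∥∥-resp refl

  ∥≈0∥ : ∀ {z r} → z ≈ 0# → ℝ.0# ℝ.≤ r → ∥ z ∥≤ r
  ∥≈0∥ z≈0 0≤r = ∥∥-resp (sym z≈0) 0≤r ∥0∥

  ∥^∥ : ∀ {z r} → ∥ z ∥≤ r → ∀ n → ∥ z ^ n ∥≤ r ℝ.^ n
  ∥^∥ h zero    = ∥1∥
  ∥^∥ h (suc n) = ∥*∥ h (∥^∥ h n)

  lim-cong : ∀ {s t L M} → (∀ n → s n ≈ t n) → L ≈ M → s ⟶ L → t ⟶ M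
  lim-cong h L≈M lim ε 0<ε = let N , k = lim ε 0<ε in
    N , λ n N≤n → ∥∥-cong (+-cong (h n) (-‿cong L≈M)) (k n N≤n)

  lim-const : ∀ L → (λ _ → L) ⟶ L
  lim-const L ε 0<ε = 0 , λ _ _ → ∥≈0∥ (-‿inverseʳ L) (ℝ.<⇒≤ 0<ε)

  lim-+ : ∀ {s t L M} → s ⟶ L → t ⟶ M → (λ n → s n + t n) ⟶ L + M
  lim-+ lim lim′ ε 0<ε =
    let δ , 0<δ , 2δ≈ε = ℝ.half 0<ε
        N , h  = lim δ 0<δ
        N′ , k = lim′ δ 0<δ
    in N ℕ.⊔ N′ , λ n ≤n → ∥∥-resp
      (solve 4 (λ s t L M → (s :- L) :+ (t :- M) := (s :+ t) :- (L :+ M)) refl _ _ _ _)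
      (ℝ.≤-reflexive 2δ≈ε)
      (∥+∥ (h n (ℕ.m⊔n≤o⇒m≤o N N′ ≤n)) (k n (ℕ.m⊔n≤o⇒n≤o N N′ ≤n)))

  lim-neg : ∀ {s L} → s ⟶ L → (λ n → - s n) ⟶ - L
  lim-neg lim ε 0<ε = let N , h = lim ε 0<ε in
    N , λ n N≤n → ∥∥-cong (solve 2 (λ s L → :- (s :- L) := :- s :- :- L) refl _ _) (∥-∥ (h n N≤n))

  lim-sub : ∀ {s t L M} → s ⟶ L → t ⟶ M → (λ n → s n - t n) ⟶ L - M
  lim-sub lim lim′ = lim-+ lim (lim-neg lim′)

  lim-null : ∀ {s L} → (λ n → s n - L) ⟶ 0# → s ⟶ L
  lim-null lim ε 0<ε = let N , h = lim ε 0<ε in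
    N , λ n N≤n → ∥∥-cong (solve 1 (λ x → x :- :0 := x) refl _) (h n N≤n)

  null-lim : ∀ {s L} → s ⟶ L → (λ n → s n - L) ⟶ 0#
  null-lim lim ε 0<ε = let N , h = lim ε 0<ε in
    N , λ n N≤n → ∥∥-cong (solve 1 (λ x → x := x :- :0) refl _) (h n N≤n)

  lim-subsequence : ∀ {s L} (g : ℕ → ℕ) → (∀ n → n ℕ.≤ g n) → s ⟶ L → (s ∘ g) ⟶ L
  lim-subsequence g n≤gn lim ε 0<ε = let N , h = lim ε 0<ε in
    N , λ n N≤n → h (g n) (ℕ.≤-trans N≤n (n≤gn n))

  lim-eventually : ∀ {s t L} M → (∀ n → M ℕ.≤ n → s n ≈ t n) → s ⟶ L → t ⟶ L
  lim-eventually M eq lim ε 0<ε = let N , h = lim ε 0<ε in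
    M ℕ.⊔ N , λ n ≤n → ∥∥-cong (+-congʳ (eq n (ℕ.m⊔n≤o⇒m≤o M N ≤n))) (h n (ℕ.m⊔n≤o⇒n≤o M N ≤n))

  EventuallyBounded : (ℕ → Carrier) → Set _
  EventuallyBounded s = ∃[ B ] ∃[ N ] (∀ n → N ℕ.≤ n → ∥ s n ∥≤ B)

  convergent⇒bounded : ∀ {s L} → s ⟶ L → EventuallyBounded s
  convergent⇒bounded {s} {L} lim =
    let B , ∥L∥≤B = bounded L
        N , h = lim ℝ.1# ℝ.0<1
    in ℝ.1# ℝ.+ B , N , λ n N≤n →
      ∥∥-cong (solve 2 (λ s L → (s :- L) :+ L := s) refl (s n) L) (∥+∥ (h n N≤n) ∥L∥≤B)

  -- Here δ is ε / (1 + B); the added 1 keeps the divisor positive when B may be 0.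
  shrink : ∀ {B ε} → ℝ.0# ℝ.≤ B → ℝ.0# ℝ.< ε → ∃[ δ ] (ℝ.0# ℝ.< δ × B ℝ.* δ ℝ.≤ ε)
  shrink {B} {ε} 0≤B 0<ε =
    let K , 0<K , [1+B]K≈1 = ℝ.reciprocal (ℝ.0<+ ℝ.0<1 0≤B) in
    K ℝ.* ε , ℝ.*-pos 0<K 0<ε , ℝ.≤-resp ℝ.refl
      (ℝ.trans (ℝ.sym (ℝ.*-assoc _ K ε)) (ℝ.trans (ℝ.*-congʳ [1+B]K≈1) (ℝ.*-identityˡ ε)))
      (ℝ.*-mono-≤ 0≤B (ℝ.<⇒≤ (ℝ.*-pos 0<K 0<ε))
        (ℝ.≤-by (ℝ.solve 1 (λ B → (ℝ.:1 ℝ.:+ B) ℝ.:- B ℝ.:= ℝ.:1) ℝ.refl B) ℝ.0≤1) ℝ.≤-refl)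

  null-* : ∀ {s t} → s ⟶ 0# → EventuallyBounded t → (λ n → t n * s n) ⟶ 0#
  null-* {s} {t} lim (B , N , h) ε 0<ε =
    let δ , 0<δ , Bδ≤ε = shrink (∥∥⇒0≤ (h N ℕ.≤-refl)) 0<ε
        N′ , k = lim δ 0<δ
    in N ℕ.⊔ N′ , λ n ≤n → ∥∥-resp (solve 2 (λ t s → t :* (s :- :0) := t :* s :- :0) refl (t n) (s n)) Bδ≤ε
      (∥*∥ (h n (ℕ.m⊔n≤o⇒m≤o N N′ ≤n)) (k n (ℕ.m⊔n≤o⇒n≤o N N′ ≤n)))

  lim-* : ∀ {s t L M} → s ⟶ L → t ⟶ M → (λ n → s n * t n) ⟶ L * M
  lim-* {s} {t} {L} {M} lim lim′ = lim-null (lim-cong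
    (λ n → solve 4 (λ s t L M → s :* (t :- M) :+ M :* (s :- L) := s :* t :- L :* M) refl (s n) (t n) L M)
    (+-identityˡ 0#)
    (lim-+ (null-* (null-lim lim′) (convergent⇒bounded lim))
           (null-* (null-lim lim) (convergent⇒bounded (lim-const M)))))

  lim-*ˡ : ∀ {s L} a → s ⟶ L → (λ n → a * s n) ⟶ a * L
  lim-*ˡ a = lim-* (lim-const a)

  lim-unique : ∀ {s L M} → s ⟶ L → s ⟶ M → L ≈ M
  lim-unique {s} {L} {M} lim lim′ = begin
    L             ≈⟨ solve 2 (λ L M → L := (L :- M) :+ M) refl L M ⟩
    (L - M) + M   ≈⟨ +-congʳ (∥∥-tight L-M-small) ⟩
    0# + M        ≈⟨ +-identityˡ M ⟩
    M             ∎
    where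
    L-M-small : ∀ ε → ℝ.0# ℝ.< ε → ∥ L - M ∥≤ ε
    L-M-small ε 0<ε = let N , h = lim-sub lim′ lim ε 0<ε in
      ∥∥-cong (solve 3 (λ s L M → (s :- s) :- (M :- L) := L :- M) refl (s N) L M) (h N ℕ.≤-refl)

  lim-∑ : ∀ n {f : ℕ → ℕ → Carrier} {g} → (∀ k → (λ N → f N k) ⟶ g k) → (λ N → ∑ n (f N)) ⟶ ∑ n g
  lim-∑ zero    h = lim-const 0#
  lim-∑ (suc n) h = lim-+ (h 0) (lim-∑ n (h ∘ suc))

  module Geometric {r : ℝ.Carrier} (0≤r : ℝ.0# ℝ.≤ r) (r<1 : r ℝ.< ℝ.1#) where

    private
      r≤1 = ℝ.<⇒≤ r<1
      recip = ℝ.reciprocal (ℝ.x<y⇒0<y-x r<1)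

    K : ℝ.Carrier
    K = proj₁ recip

    0≤K : ℝ.0# ℝ.≤ K
    0≤K = ℝ.<⇒≤ (proj₁ (proj₂ recip))

    [1-r]K≈1 : (ℝ.1# ℝ.- r) ℝ.* K ℝ.≈ ℝ.1#
    [1-r]K≈1 = proj₂ (proj₂ recip)

    1+rK≈K : ℝ.1# ℝ.+ r ℝ.* K ℝ.≈ K
    1+rK≈K = ℝ.trans (ℝ.+-congʳ (ℝ.sym [1-r]K≈1))
      (ℝ.solve 2 (λ r K → (ℝ.:1 ℝ.:- r) ℝ.:* K ℝ.:+ r ℝ.:* K ℝ.:= K) ℝ.refl r K)

    Dominated : ℝ.Carrier → (ℕ → Carrier) → Set _
    Dominated C f = ∀ k → ∥ f k ∥≤ C ℝ.* r ℝ.^ k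

    dominated⇒0≤ : ∀ {C f} → Dominated C f → ℝ.0# ℝ.≤ C
    dominated⇒0≤ {C} dom = ℝ.≤-resp ℝ.refl (ℝ.*-identityʳ C) (∥∥⇒0≤ (dom 0))

    dominated-suc : ∀ {C f} → Dominated C f → Dominated (C ℝ.* r) (f ∘ suc)
    dominated-suc {C} dom k = ∥∥-mono (ℝ.≤-reflexive (ℝ.sym (ℝ.*-assoc C r _))) (dom (suc k))

    dominated-drop : ∀ {C f} m → Dominated C f → Dominated (C ℝ.* r ℝ.^ m) (λ k → f (m ℕ.+ k))
    dominated-drop {C} zero    dom k = ∥∥-mono (ℝ.≤-reflexive (ℝ.*-congʳ (ℝ.sym (ℝ.*-identityʳ C)))) (dom k)
    dominated-drop {C} (suc m) dom k = ∥∥-mono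
      (ℝ.≤-reflexive (ℝ.*-congʳ (ℝ.*-assoc C r _))) (dominated-drop m (dominated-suc dom) k)

    ∥∑∥ : ∀ n {C f} → Dominated C f → ∥ ∑ n f ∥≤ C ℝ.* K
    ∥∑∥ zero    dom = ∥∥-mono (ℝ.0≤* (dominated⇒0≤ dom) 0≤K) ∥0∥
    ∥∑∥ (suc n) {C} dom = ∥∥-mono (ℝ.≤-reflexive
      (ℝ.trans (ℝ.solve 3 (λ C r K → C ℝ.:* ℝ.:1 ℝ.:+ (C ℝ.:* r) ℝ.:* K ℝ.:= C ℝ.:* (ℝ.:1 ℝ.:+ r ℝ.:* K)) ℝ.refl C r K)
        (ℝ.*-congˡ 1+rK≈K)))
      (∥+∥ (dom 0) (∥∑∥ n (dominated-suc dom)))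

    tail-small : ∀ {C ε} → ℝ.0# ℝ.≤ C → ℝ.0# ℝ.< ε → ∃[ N ] (∀ m → N ℕ.≤ m → (C ℝ.* r ℝ.^ m) ℝ.* K ℝ.≤ ε)
    tail-small {C} 0≤C 0<ε =
      let δ , 0<δ , CKδ≤ε = shrink (ℝ.0≤* 0≤C 0≤K) 0<ε
          N , rᴺ≤δ = ℝ.^-null 0≤r r<1 0<δ
      in N , λ m N≤m → ℝ.≤-trans
        (ℝ.≤-resp (ℝ.solve 3 (λ C R K → (C ℝ.:* K) ℝ.:* R ℝ.:= (C ℝ.:* R) ℝ.:* K) ℝ.refl C (r ℝ.^ m) K) ℝ.refl
          (ℝ.*-monoˡ-≤ (ℝ.0≤* 0≤C 0≤K) (ℝ.≤-trans (ℝ.^-antimono 0≤r r≤1 N≤m) rᴺ≤δ)))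
        CKδ≤ε

    dominated⇒null : ∀ {C f} → Dominated C f → f ⟶ 0#
    dominated⇒null {C} {f} dom ε 0<ε =
      let δ , 0<δ , Cδ≤ε = shrink (dominated⇒0≤ dom) 0<ε
          N , rᴺ≤δ = ℝ.^-null 0≤r r<1 0<δ
      in N , λ n N≤n → ∥∥-resp (solve 1 (λ x → x := x :- :0) refl (f n))
        (ℝ.≤-trans (ℝ.*-monoˡ-≤ (dominated⇒0≤ dom) (ℝ.≤-trans (ℝ.^-antimono 0≤r r≤1 N≤n) rᴺ≤δ)) Cδ≤ε) (dom n)

    ∑-converges : ∀ {C f} → Dominated C f → ∃[ S ] (λ n → ∑ n f) ⟶ S
    ∑-converges {C} {f} dom = complete (λ n → ∑ n f) λ ε 0<ε →
      let N , small = tail-small (dominated⇒0≤ dom) 0<ε in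
      N , λ m n N≤m N≤n → [ (λ m≤n → ∥∥-cong (solve 2 (λ a b → :- (a :- b) := b :- a) refl _ _) (∥-∥ (forward small N≤m m≤n)))
                          , forward small N≤n ]′ (ℕ.≤-total m n)
      where
      forward : ∀ {N ε m n} → (∀ m → N ℕ.≤ m → (C ℝ.* r ℝ.^ m) ℝ.* K ℝ.≤ ε) → N ℕ.≤ m → m ℕ.≤ n →
        ∥ ∑ n f - ∑ m f ∥≤ ε
      forward {m = m} {n} small N≤m m≤n = ∥∥-resp
        (begin
          ∑ (n ℕ.∸ m) (λ k → f (m ℕ.+ k))
            ≈⟨ solve 2 (λ a b → b := (a :+ b) :- a) refl (∑ m f) _ ⟩
          (∑ m f + ∑ (n ℕ.∸ m) (λ k → f (m ℕ.+ k))) - ∑ m f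
            ≈⟨ +-congʳ (∑-split m (n ℕ.∸ m) f) ⟨
          ∑ (m ℕ.+ (n ℕ.∸ m)) f - ∑ m f
            ≡⟨ ≡.cong (λ k → ∑ k f - ∑ m f) (ℕ.m+[n∸m]≡n m≤n) ⟩
          ∑ n f - ∑ m f ∎)
        (small m N≤m) (∥∑∥ (n ℕ.∸ m) (dominated-drop m dom))

    -- Cut all sums at `n₀`. Moving the head to its limit costs ε/4, the head of the limit series is
    -- within ε/4 of S, and the tail is at most ε/2 by the geometric majorant, uniformly in N. The
    -- length `ν N` is free because the finite identities have slightly different numbers of terms.
    tannery : ∀ {C S} {f : ℕ → ℕ → Carrier} {g} (ν : ℕ → ℕ) → (∀ N → N ℕ.≤ ν N) → (∀ N → Dominated C (f N)) →
      (∀ k → (λ N → f N k) ⟶ g k) → (λ n → ∑ n g) ⟶ S → (λ N → ∑ (ν N) (f N)) ⟶ S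
    tannery {C} {S} {f} {g} ν N≤νN dom lim limS ε 0<ε =
      let δ , 0<δ , 2δ≈ε = ℝ.half 0<ε
          η , 0<η , 2η≈δ = ℝ.half 0<δ
          n₁ , tail = tail-small (dominated⇒0≤ (dom 0)) 0<δ
          n₂ , close = limS η 0<η
          n₀ = n₁ ℕ.⊔ n₂
          N₁ , h = lim-∑ n₀ lim η 0<η
      in n₀ ℕ.⊔ N₁ , λ N ≤N →
        let n₀≤νN = ℕ.≤-trans (ℕ.m⊔n≤o⇒m≤o n₀ N₁ ≤N) (N≤νN N) in
        ∥∥-resp
          (begin
            ((∑ n₀ (f N) - ∑ n₀ g) + (∑ n₀ g - S)) + ∑ (ν N ℕ.∸ n₀) (λ k → f N (n₀ ℕ.+ k))
              ≈⟨ solve 4 (λ a b c d → ((a :- b) :+ (b :- c)) :+ d := (a :+ d) :- c) refl _ _ _ _ ⟩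
            (∑ n₀ (f N) + ∑ (ν N ℕ.∸ n₀) (λ k → f N (n₀ ℕ.+ k))) - S
              ≈⟨ +-congʳ (∑-split n₀ (ν N ℕ.∸ n₀) (f N)) ⟨
            ∑ (n₀ ℕ.+ (ν N ℕ.∸ n₀)) (f N) - S
              ≡⟨ ≡.cong (λ k → ∑ k (f N) - S) (ℕ.m+[n∸m]≡n n₀≤νN) ⟩
            ∑ (ν N) (f N) - S ∎)
          (ℝ.≤-reflexive (ℝ.trans (ℝ.+-congʳ 2η≈δ) 2δ≈ε))
          (∥+∥ (∥+∥ (h N (ℕ.m⊔n≤o⇒n≤o n₀ N₁ ≤N)) (close n₀ (ℕ.m≤n⊔m n₁ n₂)))
               (∥∥-mono (tail n₀ (ℕ.m≤m⊔n n₁ n₂)) (∥∑∥ (ν N ℕ.∸ n₀) (dominated-drop n₀ (dom N)))))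

    private
      Bounded∏ : (ℕ → Carrier) → Set _
      Bounded∏ a = ∃[ B ] (∀ n → ∥ ∏ n (λ k → 1# + a k) ∥≤ B)

      -- The bound 1 + 2 C K is chosen to reproduce itself: because (1 - r) K = 1, one has (1 + C)(1
      -- + 2 C r K) ≤ 1 + 2 C K as soon as 2 C K ≤ 1.
      ∥∏∥-small : ∀ n {C a} → Dominated C a → (C ℝ.* K) ℝ.+ (C ℝ.* K) ℝ.≤ ℝ.1# →
        ∥ ∏ n (λ k → 1# + a k) ∥≤ ℝ.1# ℝ.+ ((C ℝ.* K) ℝ.+ (C ℝ.* K))
      ∥∏∥-small zero    {C} dom _ = ∥∥-mono
        (ℝ.≤-by (ℝ.solve 1 (λ x → (ℝ.:1 ℝ.:+ x) ℝ.:- ℝ.:1 ℝ.:= x) ℝ.refl _) (ℝ.0≤+ 0≤CK 0≤CK)) ∥1∥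
        where 0≤CK = ℝ.0≤* (dominated⇒0≤ dom) 0≤K
      ∥∏∥-small (suc n) {C} dom 2CK≤1 = ∥∥-mono
        (ℝ.≤-by (ℝ.trans
          (ℝ.solve 3 (λ C r K →
            (ℝ.:1 ℝ.:+ (C ℝ.:* K ℝ.:+ C ℝ.:* K)) ℝ.:- ((ℝ.:1 ℝ.:+ C ℝ.:* ℝ.:1) ℝ.:* (ℝ.:1 ℝ.:+ ((C ℝ.:* r) ℝ.:* K ℝ.:+ (C ℝ.:* r) ℝ.:* K)))
            ℝ.:= (C ℝ.:+ C) ℝ.:* ((ℝ.:1 ℝ.:- r) ℝ.:* K) ℝ.:- C ℝ.:* (ℝ.:1 ℝ.:+ r ℝ.:* (C ℝ.:* K ℝ.:+ C ℝ.:* K)))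
            ℝ.refl C r K)
          (ℝ.trans (ℝ.+-congʳ (ℝ.*-congˡ [1-r]K≈1))
            (ℝ.solve 3 (λ C r x → (C ℝ.:+ C) ℝ.:* ℝ.:1 ℝ.:- C ℝ.:* (ℝ.:1 ℝ.:+ r ℝ.:* x)
              ℝ.:= C ℝ.:* ((ℝ.:1 ℝ.:- r) ℝ.:+ r ℝ.:* (ℝ.:1 ℝ.:- x))) ℝ.refl C r _)))
          (ℝ.0≤* 0≤C (ℝ.0≤+ (ℝ.0≤y-x r≤1) (ℝ.0≤* 0≤r (ℝ.0≤y-x 2CK≤1)))))
        (∥*∥ (∥+∥ ∥1∥ (dom 0)) (∥∏∥-small n (dominated-suc dom)
          (ℝ.≤-trans (ℝ.+-mono-≤ CrK≤CK CrK≤CK) 2CK≤1)))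
        where
        0≤C = dominated⇒0≤ dom
        CrK≤CK : (C ℝ.* r) ℝ.* K ℝ.≤ C ℝ.* K
        CrK≤CK = ℝ.*-mono-≤ (ℝ.0≤* 0≤C 0≤r) 0≤K
          (ℝ.≤-resp ℝ.refl (ℝ.*-identityʳ C) (ℝ.*-monoˡ-≤ 0≤C r≤1)) ℝ.≤-refl

      bounded∏-suc : ∀ {a} → Bounded∏ (a ∘ suc) → Bounded∏ a
      bounded∏-suc {a} (B , h) = ℝ.1# ℝ.+ b ℝ.* B , bound
        where
        b = proj₁ (bounded (1# + a 0))
        ∥1+a∥≤b = proj₂ (bounded (1# + a 0))
        0≤b*B = ℝ.0≤* (∥∥⇒0≤ ∥1+a∥≤b) (∥∥⇒0≤ (h 0))
        bound : ∀ n → ∥ ∏ n (λ k → 1# + a k) ∥≤ ℝ.1# ℝ.+ b ℝ.* B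
        bound zero    = ∥∥-mono (ℝ.≤-by (ℝ.solve 1 (λ x → (ℝ.:1 ℝ.:+ x) ℝ.:- ℝ.:1 ℝ.:= x) ℝ.refl _) 0≤b*B) ∥1∥
        bound (suc n) = ∥∥-mono (ℝ.≤-by (ℝ.solve 1 (λ x → (ℝ.:1 ℝ.:+ x) ℝ.:- x ℝ.:= ℝ.:1) ℝ.refl _) ℝ.0≤1)
          (∥*∥ ∥1+a∥≤b (h n))

      -- Peeling off J factors shrinks the constant of the majorant to C rᴶ, and from there
      -- `∥∏∥-small` applies.
      bounded∏-after : ∀ J {C a} → Dominated C a → ((C ℝ.* r ℝ.^ J) ℝ.* K) ℝ.+ ((C ℝ.* r ℝ.^ J) ℝ.* K) ℝ.≤ ℝ.1# → Bounded∏ a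
      bounded∏-after zero    {C} dom h = _ , λ n → ∥∏∥-small n dom
        (ℝ.≤-resp (ℝ.+-cong C1K C1K) ℝ.refl h)
        where C1K = ℝ.*-congʳ (ℝ.*-identityʳ C)
      bounded∏-after (suc J) {C} dom h = bounded∏-suc (bounded∏-after J (dominated-suc dom)
        (ℝ.≤-resp (ℝ.+-cong assoc assoc) ℝ.refl h))
        where assoc = ℝ.*-congʳ (ℝ.sym (ℝ.*-assoc C r _))

    ∏-bounded : ∀ {C a} → Dominated C a → ∃[ B ] (∀ n → ∥ ∏ n (λ k → 1# + a k) ∥≤ B)
    ∏-bounded dom =
      let δ , 0<δ , 2δ≈1 = ℝ.half ℝ.0<1
          J , small = tail-small (dominated⇒0≤ dom) 0<δ
      in bounded∏-after J dom (ℝ.≤-resp ℝ.refl 2δ≈1 (ℝ.+-mono-≤ (small J ℕ.≤-refl) (small J ℕ.≤-refl)))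

    ∏-converges : ∀ {C a} → Dominated C a → ∃[ P ] (λ n → ∏ n (λ k → 1# + a k)) ⟶ P
    ∏-converges {C} {a} dom =
      let B , bound = ∏-bounded dom
          S , lim = ∑-converges {B ℝ.* C} λ k →
            ∥∥-mono (ℝ.≤-reflexive (ℝ.sym (ℝ.*-assoc B C _))) (∥*∥ (bound k) (dom k))
      in 1# + S , lim-cong (λ n → sym (∏-1+ n a)) refl (lim-+ (lim-const 1#) lim)

-- Bilateral series: translation, reflection, splitting by parity, interchange

module IntegerIdentities where
  open +-*-Solver

  suc-+ʳ : ∀ m i → ℤ.suc (m ℤ.+ i) ≡ m ℤ.+ ℤ.suc i
  suc-+ʳ = solve 2 (λ m i → con (+ 1) :+ (m :+ i) := m :+ (con (+ 1) :+ i)) ≡.refl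

  pred-+ʳ : ∀ m i → ℤ.pred (m ℤ.+ i) ≡ m ℤ.+ ℤ.pred i
  pred-+ʳ = solve 2 (λ m i → con ℤ.-1ℤ :+ (m :+ i) := m :+ (con ℤ.-1ℤ :+ i)) ≡.refl

open IntegerIdentities

module BilateralSums {c ℓ₁ ℓ₂} {𝓡 : RealField c ℓ₁ ℓ₂} (𝓝 : NormedRing 𝓡) where
  open NormedRing 𝓝
  open FiniteSums commutativeRing
  open Limits 𝓝
  open IntegerCoefficients commutativeRing
  open SetoidReasoning setoid
  private module ℝ = Real 𝓡

  lim-unshift : ∀ {s L} → (s ∘ suc) ⟶ L → s ⟶ L
  lim-unshift {s} {L} lim ε 0<ε = let N , h = lim ε 0<ε in suc N , λ { (suc n) (ℕ.s≤s N≤n) → h n N≤n }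

  -- The window is -n ≤ m < n, with k paired to -1 - k. Having even length, the window for 2 n
  -- splits exactly into even and odd indices over the window for n.
  ∑ℤ : ℕ → (ℤ → Carrier) → Carrier
  ∑ℤ n F = ∑ n (λ k → F (+ k) + F -[1+ k ])

  infix 4 ∑ℤ∞_⟶_
  record ∑ℤ∞_⟶_ (F : ℤ → Carrier) (S : Carrier) : Set (c ⊔ ℓ₂) where
    constructor bilateral
    field partialSums : (λ n → ∑ℤ n F) ⟶ S
  open ∑ℤ∞_⟶_ public

  -- Bilateral sums are limits over windows, so a translation of the index changes the partial sums
  -- by boundary terms; this is the condition that makes them disappear.
  record Vanishing (F : ℤ → Carrier) : Set (c ⊔ ℓ₂) where
    constructor vanishing
    field
      at+∞ : (λ n → F (+ n)) ⟶ 0#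
      at-∞ : (λ n → F -[1+ n ]) ⟶ 0#

  ∑ℤ-cong : ∀ n {F G} → (∀ m → F m ≈ G m) → ∑ℤ n F ≈ ∑ℤ n G
  ∑ℤ-cong n h = ∑-cong n λ k → +-cong (h (+ k)) (h -[1+ k ])

  ∑ℤ∞-cong : ∀ {F G S T} → (∀ m → F m ≈ G m) → S ≈ T → ∑ℤ∞ F ⟶ S → ∑ℤ∞ G ⟶ T
  ∑ℤ∞-cong h S≈T (bilateral lim) = bilateral (lim-cong (λ n → ∑ℤ-cong n h) S≈T lim)

  ∑ℤ-+ : ∀ n F G → ∑ℤ n (λ m → F m + G m) ≈ ∑ℤ n F + ∑ℤ n G
  ∑ℤ-+ n F G = trans
    (∑-cong n λ k → solve 4 (λ a b c d → (a :+ b) :+ (c :+ d) := (a :+ c) :+ (b :+ d)) refl _ _ _ _)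
    (∑-+ n _ _)

  ∑ℤ-*ˡ : ∀ n a F → ∑ℤ n (λ m → a * F m) ≈ a * ∑ℤ n F
  ∑ℤ-*ˡ n a F = trans (∑-cong n λ k → sym (distribˡ a _ _)) (∑-*ˡ n a _)

  ∑ℤ∞-+ : ∀ {F G S T} → ∑ℤ∞ F ⟶ S → ∑ℤ∞ G ⟶ T → ∑ℤ∞ (λ m → F m + G m) ⟶ S + T
  ∑ℤ∞-+ {F} {G} (bilateral lim) (bilateral lim′) =
    bilateral (lim-cong (λ n → sym (∑ℤ-+ n F G)) refl (lim-+ lim lim′))

  ∑ℤ∞-*ˡ : ∀ {F S} a → ∑ℤ∞ F ⟶ S → ∑ℤ∞ (λ m → a * F m) ⟶ a * S
  ∑ℤ∞-*ˡ {F} a (bilateral lim) = bilateral (lim-cong (λ n → sym (∑ℤ-*ˡ n a F)) refl (lim-*ˡ a lim))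

  vanishing-*ˡ : ∀ {B F} {b : ℤ → Carrier} → (∀ m → ∥ b m ∥≤ B) → Vanishing F → Vanishing (λ m → b m * F m)
  vanishing-*ˡ h (vanishing p q) = vanishing (null-* p (_ , 0 , λ n _ → h _)) (null-* q (_ , 0 , λ n _ → h _))

  vanishing-suc : ∀ {F} → Vanishing F → Vanishing (F ∘ ℤ.suc)
  vanishing-suc (vanishing p q) = vanishing (lim-subsequence suc ℕ.n≤1+n p) (lim-unshift q)

  vanishing-pred : ∀ {F} → Vanishing F → Vanishing (F ∘ ℤ.pred)
  vanishing-pred (vanishing p q) = vanishing (lim-unshift p) (lim-subsequence suc ℕ.n≤1+n q)

  ∑ℤ-suc : ∀ n F → ∑ℤ (suc n) (F ∘ ℤ.suc) ≈ ∑ℤ (suc n) F + (F (+ suc n) - F -[1+ n ])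
  ∑ℤ-suc zero    F = solve 3 (λ a b c → (b :+ a) :+ :0 := ((a :+ c) :+ :0) :+ (b :- c)) refl _ _ _
  ∑ℤ-suc (suc n) F = begin
    ∑ℤ (suc (suc n)) (F ∘ ℤ.suc)
      ≈⟨ ∑-last (suc n) (λ k → F (ℤ.suc (+ k)) + F (ℤ.suc -[1+ k ])) ⟩
    ∑ℤ (suc n) (F ∘ ℤ.suc) + (F (+ suc (suc n)) + F -[1+ n ])
      ≈⟨ +-congʳ (∑ℤ-suc n F) ⟩
    (∑ℤ (suc n) F + (F (+ suc n) - F -[1+ n ])) + (F (+ suc (suc n)) + F -[1+ n ])
      ≈⟨ solve 5 (λ s a b c d → (s :+ (a :- b)) :+ (c :+ b) := (s :+ (a :+ d)) :+ (c :- d)) refl _ _ _ _ _ ⟩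
    (∑ℤ (suc n) F + (F (+ suc n) + F -[1+ suc n ])) + (F (+ suc (suc n)) - F -[1+ suc n ])
      ≈⟨ +-congʳ (∑-last (suc n) (λ k → F (+ k) + F -[1+ k ])) ⟨
    ∑ℤ (suc (suc n)) F + (F (+ suc (suc n)) - F -[1+ suc n ]) ∎

  private
    boundary : ∀ {F} → Vanishing F → (λ n → F (+ suc n) - F -[1+ n ]) ⟶ 0#
    boundary (vanishing p q) = lim-cong (λ _ → refl) (solve 0 (:0 :- :0 := :0) refl)
      (lim-sub (lim-subsequence suc ℕ.n≤1+n p) q)

  ∑ℤ∞-suc : ∀ {F S} → Vanishing F → ∑ℤ∞ F ⟶ S → ∑ℤ∞ (F ∘ ℤ.suc) ⟶ S
  ∑ℤ∞-suc {F} {S} van (bilateral lim) = bilateral (lim-unshift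
    (lim-cong (λ n → sym (∑ℤ-suc n F)) (+-identityʳ S)
      (lim-+ (lim-subsequence suc ℕ.n≤1+n lim) (boundary van))))

  ∑ℤ∞-suc⁻¹ : ∀ {F S} → Vanishing F → ∑ℤ∞ (F ∘ ℤ.suc) ⟶ S → ∑ℤ∞ F ⟶ S
  ∑ℤ∞-suc⁻¹ {F} {S} van (bilateral lim) = bilateral (lim-unshift (lim-cong
    (λ n → trans (+-congʳ (∑ℤ-suc n F)) (solve 2 (λ s b → (s :+ b) :- b := s) refl _ _))
    (solve 1 (λ s → s :- :0 := s) refl S)
    (lim-sub (lim-subsequence suc ℕ.n≤1+n lim) (boundary van))))

  ∑ℤ∞-pred : ∀ {F S} → Vanishing F → ∑ℤ∞ F ⟶ S → ∑ℤ∞ (F ∘ ℤ.pred) ⟶ S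
  ∑ℤ∞-pred {F} van lim = ∑ℤ∞-suc⁻¹ (vanishing-pred van)
    (∑ℤ∞-cong (λ m → reflexive (≡.cong F (≡.sym (ℤ.pred-suc m)))) refl lim)

  ∑ℤ∞-translate : ∀ {F S} → Vanishing F → ∑ℤ∞ F ⟶ S → ∀ i → ∑ℤ∞ (λ m → F (m ℤ.+ i)) ⟶ S
  ∑ℤ∞-translate {F} van lim (+ zero) =
    ∑ℤ∞-cong (λ m → reflexive (≡.cong F (≡.sym (ℤ.+-identityʳ m)))) refl lim
  ∑ℤ∞-translate {F} van lim (+ suc n) =
    ∑ℤ∞-cong (λ m → reflexive (≡.cong F (suc-+ʳ m (+ n)))) refl
      (∑ℤ∞-translate (vanishing-suc van) (∑ℤ∞-suc van lim) (+ n))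
  ∑ℤ∞-translate {F} van lim -[1+ zero ] =
    ∑ℤ∞-cong (λ m → reflexive (≡.cong F (ℤ.+-comm ℤ.-1ℤ m))) refl (∑ℤ∞-pred van lim)
  ∑ℤ∞-translate {F} van lim -[1+ suc n ] =
    ∑ℤ∞-cong (λ m → reflexive (≡.cong F (pred-+ʳ m -[1+ n ]))) refl
      (∑ℤ∞-translate (vanishing-pred van) (∑ℤ∞-pred van lim) -[1+ n ])

  -- Reflection turns the window -n ≤ m < n into -n < m ≤ n, which is the same window shifted by
  -- one, so `∑ℤ∞-suc` applies.
  ∑ℤ∞-neg : ∀ {F S} → Vanishing F → ∑ℤ∞ F ⟶ S → ∑ℤ∞ (F ∘ ℤ.-_) ⟶ S
  ∑ℤ∞-neg {F} van lim = bilateral (lim-cong (λ n → ∑-cong n pair) refl (partialSums (∑ℤ∞-suc van lim)))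
    where
    pair : ∀ k → F (ℤ.suc (+ k)) + F (ℤ.suc -[1+ k ]) ≈ F (ℤ.- + k) + F (+ suc k)
    pair zero    = +-comm _ _
    pair (suc k) = +-comm _ _

  ∑ℤ-even-odd : ∀ n F → ∑ℤ (n ℕ.+ n) F ≈ ∑ℤ n (λ m → F (m ℤ.+ m) + F (ℤ.suc (m ℤ.+ m)))
  ∑ℤ-even-odd zero    F = refl
  ∑ℤ-even-odd (suc n) F = begin
    ∑ℤ (suc (n ℕ.+ suc n)) F
      ≡⟨ ≡.cong (λ k → ∑ℤ (suc k) F) (ℕ.+-suc n n) ⟩
    ∑ℤ (suc (suc (n ℕ.+ n))) F
      ≈⟨ trans (∑-last (suc (n ℕ.+ n)) Fᵖ) (+-congʳ (∑-last (n ℕ.+ n) Fᵖ)) ⟩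
    (∑ℤ (n ℕ.+ n) F + (F (+ (n ℕ.+ n)) + F -[1+ n ℕ.+ n ])) + (F (+ suc (n ℕ.+ n)) + F -[1+ suc (n ℕ.+ n) ])
      ≈⟨ solve 5 (λ s a b c d → (s :+ (a :+ b)) :+ (c :+ d) := s :+ ((a :+ c) :+ (d :+ b))) refl _ _ _ _ _ ⟩
    ∑ℤ (n ℕ.+ n) F + ((F (+ (n ℕ.+ n)) + F (+ suc (n ℕ.+ n))) + (F -[1+ suc (n ℕ.+ n) ] + F -[1+ n ℕ.+ n ]))
      ≈⟨ +-congʳ (∑ℤ-even-odd n F) ⟩
    ∑ℤ n F₂ + (F₂ (+ n) + F₂ -[1+ n ])
      ≈⟨ ∑-last n (λ k → F₂ (+ k) + F₂ -[1+ k ]) ⟨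
    ∑ℤ (suc n) F₂ ∎
    where
    Fᵖ : ℕ → Carrier
    Fᵖ k = F (+ k) + F -[1+ k ]
    F₂ : ℤ → Carrier
    F₂ m = F (m ℤ.+ m) + F (ℤ.suc (m ℤ.+ m))

  ∑ℤ∞-even-odd : ∀ {F S} → ∑ℤ∞ F ⟶ S → ∑ℤ∞ (λ m → F (m ℤ.+ m) + F (ℤ.suc (m ℤ.+ m))) ⟶ S
  ∑ℤ∞-even-odd {F} (bilateral lim) = bilateral (lim-cong (λ n → ∑ℤ-even-odd n F) refl
    (lim-subsequence (λ n → n ℕ.+ n) (λ n → ℕ.m≤m+n n n) lim))

  module Dominance {r : ℝ.Carrier} (0≤r : ℝ.0# ℝ.≤ r) (r<1 : r ℝ.< ℝ.1#) where
    open Geometric 0≤r r<1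

    private r≤1 = ℝ.<⇒≤ r<1

    Dominatedℤ : ℝ.Carrier → (ℤ → Carrier) → Set _
    Dominatedℤ C F = ∀ m → ∥ F m ∥≤ C ℝ.* r ℝ.^ ℤ.∣ m ∣

    private
      negative : ∀ {C F} → Dominatedℤ C F → Dominated C (λ n → F -[1+ n ])
      negative {C} dom n = ∥∥-mono (ℝ.*-monoˡ-≤ 0≤C (ℝ.^-antimono 0≤r r≤1 (ℕ.n≤1+n n))) (dom -[1+ n ])
        where 0≤C = dominated⇒0≤ {C} (λ k → dom (+ k))

    dominated-pair : ∀ {C F} → Dominatedℤ C F → Dominated (C ℝ.+ C) (λ n → F (+ n) + F -[1+ n ])
    dominated-pair {C} dom n = ∥∥-mono (ℝ.≤-reflexive (ℝ.sym (ℝ.distribʳ _ C C)))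
      (∥+∥ (dom (+ n)) (negative dom n))

    dominated⇒vanishing : ∀ {C F} → Dominatedℤ C F → Vanishing F
    dominated⇒vanishing {C} dom = vanishing (dominated⇒null {C} (λ k → dom (+ k))) (dominated⇒null (negative dom))

    ∑ℤ∞-converges : ∀ {C F} → Dominatedℤ C F → ∃[ S ] ∑ℤ∞ F ⟶ S
    ∑ℤ∞-converges dom = let S , lim = ∑-converges (dominated-pair dom) in S , bilateral lim

    tanneryℤ : ∀ {C S} {F : ℕ → ℤ → Carrier} {G} (ν : ℕ → ℕ) → (∀ N → N ℕ.≤ ν N) → (∀ N → Dominatedℤ C (F N)) →
      (∀ m → (λ N → F N m) ⟶ G m) → ∑ℤ∞ G ⟶ S → (λ N → ∑ℤ (ν N) (F N)) ⟶ S
    tanneryℤ ν N≤νN dom lim (bilateral limS) = tannery ν N≤νN (λ N → dominated-pair (dom N))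
      (λ k → lim-+ (lim (+ k)) (lim -[1+ k ])) limS

    ∑ℤ-comm : ∀ m n (H : ℤ → ℤ → Carrier) → ∑ℤ m (λ i → ∑ℤ n (H i)) ≈ ∑ℤ n (λ j → ∑ℤ m (λ i → H i j))
    ∑ℤ-comm m n H = begin
      ∑ m (λ k → ∑ℤ n (H (+ k)) + ∑ℤ n (H -[1+ k ]))
        ≈⟨ ∑-cong m (λ k → ∑-+ n _ _) ⟨
      ∑ m (λ k → ∑ n (λ l → (H (+ k) (+ l) + H (+ k) -[1+ l ]) + (H -[1+ k ] (+ l) + H -[1+ k ] -[1+ l ])))
        ≈⟨ ∑-comm m n _ ⟩
      ∑ n (λ l → ∑ m (λ k → (H (+ k) (+ l) + H (+ k) -[1+ l ]) + (H -[1+ k ] (+ l) + H -[1+ k ] -[1+ l ])))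
        ≈⟨ ∑-cong n (λ l → ∑-cong m λ k →
             solve 4 (λ a b c d → (a :+ b) :+ (c :+ d) := (a :+ c) :+ (b :+ d)) refl _ _ _ _) ⟩
      ∑ n (λ l → ∑ m (λ k → (H (+ k) (+ l) + H -[1+ k ] (+ l)) + (H (+ k) -[1+ l ] + H -[1+ k ] -[1+ l ])))
        ≈⟨ ∑-cong n (λ l → ∑-+ m _ _) ⟩
      ∑ n (λ l → ∑ℤ m (λ i → H i (+ l)) + ∑ℤ m (λ i → H i -[1+ l ])) ∎

    -- Both iterated sums are limits of the same square partial sums: `tanneryℤ` is applied once to
    -- the rows and once to the columns.
    fubini : ∀ {C S T} {H : ℤ → ℤ → Carrier} {R U} →
      (∀ i j → ∥ H i j ∥≤ (C ℝ.* r ℝ.^ ℤ.∣ i ∣) ℝ.* r ℝ.^ ℤ.∣ j ∣) →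
      (∀ i → ∑ℤ∞ H i ⟶ R i) → ∑ℤ∞ R ⟶ S →
      (∀ j → ∑ℤ∞ (λ i → H i j) ⟶ U j) → ∑ℤ∞ U ⟶ T → S ≈ T
    fubini {C} {H = H} dom rows limS columns limT = lim-unique
      (tanneryℤ (λ N → N) (λ _ → ℕ.≤-refl) (λ N i → ∥∥-mono
          (ℝ.≤-reflexive (ℝ.solve 3 (λ C R K → (C ℝ.:* R ℝ.:+ C ℝ.:* R) ℝ.:* K ℝ.:= ((C ℝ.:+ C) ℝ.:* K) ℝ.:* R) ℝ.refl C _ K))
          (∥∑∥ N (dominated-pair (dom i)))) (λ i → partialSums (rows i)) limS)
      (lim-cong (λ N → ∑ℤ-comm N N (λ j i → H i j)) refl
        (tanneryℤ (λ N → N) (λ _ → ℕ.≤-refl) (λ N j → ∥∥-mono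
          (ℝ.≤-reflexive (ℝ.solve 3 (λ C R K → (C ℝ.:* R ℝ.:+ C ℝ.:* R) ℝ.:* K ℝ.:= ((C ℝ.:+ C) ℝ.:* K) ℝ.:* R) ℝ.refl C _ K))
          (∥∑∥ N (dominated-pair λ i → ∥∥-mono
            (ℝ.≤-reflexive (ℝ.solve 3 (λ C R U → (C ℝ.:* R) ℝ.:* U ℝ.:= (C ℝ.:* U) ℝ.:* R) ℝ.refl C _ _)) (dom i j))))
          (λ j → partialSums (columns j)) limT))

-- Powers, finite Pochhammer symbols and units

module Powers {c ℓ} (R : CommutativeRing c ℓ) where
  open CommutativeRing R
  open IntegerCoefficients R
  open SemiringExp semiring public using (_^_; ^-congˡ; ^-congʳ; ^-homo-*; ^-assocʳ)
  open FiniteSums R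
  open SetoidReasoning setoid

  ^-distrib-* : ∀ x y n → (x * y) ^ n ≈ x ^ n * y ^ n
  ^-distrib-* x y zero    = sym (*-identityˡ 1#)
  ^-distrib-* x y (suc n) = trans (*-congˡ (^-distrib-* x y n))
    (solve 4 (λ x y X Y → (x :* y) :* (X :* Y) := (x :* X) :* (y :* Y)) refl x y _ _)

  poch : Carrier → Carrier → ℕ → Carrier
  poch x p n = ∏ n (λ j → 1# - x * p ^ j)

  poch-cong : ∀ {x y p s} → x ≈ y → p ≈ s → ∀ n → poch x p n ≈ poch y s n
  poch-cong x≈y p≈s n = ∏-cong n λ j → +-congˡ (-‿cong (*-cong x≈y (^-congˡ j p≈s)))

  poch-first : ∀ x p n → poch x p (suc n) ≈ (1# - x) * poch (x * p) p n
  poch-first x p n = *-cong (+-congˡ (-‿cong (*-identityʳ x)))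
    (∏-cong n λ j → +-congˡ (-‿cong (sym (*-assoc x p _))))

  poch-double : ∀ x p n → poch x p (n ℕ.+ n) ≈ poch x (p * p) n * poch (x * p) (p * p) n
  poch-double x p zero    = sym (*-identityˡ 1#)
  poch-double x p (suc n) = begin
    poch x p (suc (n ℕ.+ suc n))
      ≡⟨ ≡.cong (λ k → poch x p (suc k)) (ℕ.+-suc n n) ⟩
    poch x p (suc (suc (n ℕ.+ n)))
      ≈⟨ trans (∏-last (suc (n ℕ.+ n)) (λ j → 1# - x * p ^ j)) (*-congʳ (∏-last (n ℕ.+ n) (λ j → 1# - x * p ^ j))) ⟩
    (poch x p (n ℕ.+ n) * (1# - x * p ^ (n ℕ.+ n))) * (1# - x * (p * p ^ (n ℕ.+ n)))
      ≈⟨ *-cong (*-cong (poch-double x p n) (+-congˡ (-‿cong (*-congˡ p²ⁿ))))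
                (+-congˡ (-‿cong (*-congˡ (*-congˡ p²ⁿ)))) ⟩
    ((poch x (p * p) n * poch (x * p) (p * p) n) * (1# - x * (p * p) ^ n)) * (1# - x * (p * (p * p) ^ n))
      ≈⟨ solve 5 (λ A B x p P → ((A :* B) :* (:1 :- x :* P)) :* (:1 :- x :* (p :* P))
           := (A :* (:1 :- x :* P)) :* (B :* (:1 :- (x :* p) :* P))) refl _ _ x p _ ⟩
    (poch x (p * p) n * (1# - x * (p * p) ^ n)) * (poch (x * p) (p * p) n * (1# - (x * p) * (p * p) ^ n))
      ≈⟨ *-cong (∏-last n _) (∏-last n _) ⟨
    poch x (p * p) (suc n) * poch (x * p) (p * p) (suc n) ∎
    where
    p²ⁿ : p ^ (n ℕ.+ n) ≈ (p * p) ^ n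
    p²ⁿ = trans (^-homo-* p n n) (sym (^-distrib-* p p n))

  poch-± : ∀ x p n → poch x p n * poch (- x) p n ≈ poch (x * x) (p * p) n
  poch-± x p n = trans (sym (∏-* n _ _)) (∏-cong n λ j → trans
    (solve 2 (λ x P → (:1 :- x :* P) :* (:1 :- (:- x) :* P) := :1 :- (x :* x) :* (P :* P)) refl x (p ^ j))
    (+-congˡ (-‿cong (*-congˡ (sym (^-distrib-* p p j))))))

  -- The factors x q^k of (x ; q)_{mn}, grouped according to the residue of k modulo m.
  poch-dissect : ∀ x q m n → poch x q (n ℕ.* m) ≈ ∏ m (λ j → poch (x * q ^ j) (q ^ m) n)
  poch-dissect x q m zero    = sym (∏-1 m λ _ → refl)
  poch-dissect x q m (suc n) = begin
    poch x q (m ℕ.+ n ℕ.* m)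
      ≡⟨ ≡.cong (poch x q) (ℕ.+-comm m (n ℕ.* m)) ⟩
    poch x q (n ℕ.* m ℕ.+ m)
      ≈⟨ ∏-split (n ℕ.* m) m _ ⟩
    poch x q (n ℕ.* m) * ∏ m (λ j → 1# - x * q ^ (n ℕ.* m ℕ.+ j))
      ≈⟨ *-cong (poch-dissect x q m n) (∏-cong m λ j → +-congˡ (-‿cong (exponent j))) ⟩
    ∏ m (λ j → poch (x * q ^ j) (q ^ m) n) * ∏ m (λ j → 1# - (x * q ^ j) * (q ^ m) ^ n)
      ≈⟨ ∏-* m _ _ ⟨
    ∏ m (λ j → poch (x * q ^ j) (q ^ m) n * (1# - (x * q ^ j) * (q ^ m) ^ n))
      ≈⟨ ∏-cong m (λ j → ∏-last n (λ k → 1# - (x * q ^ j) * (q ^ m) ^ k)) ⟨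
    ∏ m (λ j → poch (x * q ^ j) (q ^ m) (suc n)) ∎
    where
    exponent : ∀ j → x * q ^ (n ℕ.* m ℕ.+ j) ≈ (x * q ^ j) * (q ^ m) ^ n
    exponent j = begin
      x * q ^ (n ℕ.* m ℕ.+ j)       ≈⟨ *-congˡ (^-homo-* q (n ℕ.* m) j) ⟩
      x * (q ^ (n ℕ.* m) * q ^ j)   ≡⟨ ≡.cong (λ k → x * (q ^ k * q ^ j)) (ℕ.*-comm n m) ⟩
      x * (q ^ (m ℕ.* n) * q ^ j)   ≈⟨ *-congˡ (*-congʳ (^-assocʳ q m n)) ⟨
      x * ((q ^ m) ^ n * q ^ j)     ≈⟨ solve 3 (λ x a b → x :* (a :* b) := (x :* b) :* a) refl _ _ _ ⟩
      (x * q ^ j) * (q ^ m) ^ n     ∎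

module Units {c ℓ} (R : CommutativeRing c ℓ) where
  open CommutativeRing R
  open IntegerCoefficients R
  open SetoidReasoning setoid

  Unit : Carrier → Set _
  Unit x = ∃[ w ] x * w ≈ 1#

  unit-* : ∀ {x y} → Unit x → Unit y → Unit (x * y)
  unit-* (v , xv≈1) (w , yw≈1) = v * w , trans
    (solve 4 (λ x y v w → (x :* y) :* (v :* w) := (x :* v) :* (y :* w)) refl _ _ v w)
    (trans (*-cong xv≈1 yw≈1) (*-identityˡ 1#))

  unit-cancel : ∀ {u x y} → Unit u → u * x ≈ u * y → x ≈ y
  unit-cancel {u} {x} {y} (w , uw≈1) eq = begin
    x             ≈⟨ trans (*-congʳ uw≈1) (*-identityˡ x) ⟨
    (u * w) * x   ≈⟨ solve 3 (λ u w x → (u :* w) :* x := w :* (u :* x)) refl u w x ⟩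
    w * (u * x)   ≈⟨ *-congˡ eq ⟩
    w * (u * y)   ≈⟨ solve 3 (λ u w x → (u :* w) :* x := w :* (u :* x)) refl u w y ⟨
    (u * w) * y   ≈⟨ trans (*-congʳ uw≈1) (*-identityˡ y) ⟩
    y             ∎

  inverse-unique : ∀ {x v w} → x * v ≈ 1# → x * w ≈ 1# → v ≈ w
  inverse-unique xv≈1 xw≈1 = unit-cancel (_ , xv≈1) (trans xv≈1 (sym xw≈1))

  x*y≈z⇒x≈z*y⁻¹ : ∀ {x y z w} → y * w ≈ 1# → x * y ≈ z → x ≈ z * w
  x*y≈z⇒x≈z*y⁻¹ {x} {y} {z} {w} yw≈1 xy≈z = begin
    x             ≈⟨ *-identityʳ x ⟨
    x * 1#        ≈⟨ *-congˡ yw≈1 ⟨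
    x * (y * w)   ≈⟨ *-assoc x y w ⟨
    (x * y) * w   ≈⟨ *-congʳ xy≈z ⟩
    z * w         ∎

-- Infinite Pochhammer symbols and their reciprocals

module PochhammerLimits {c ℓ₁ ℓ₂} {𝓡 : RealField c ℓ₁ ℓ₂} (𝓝 : NormedRing 𝓡)
  {r : RealField.Carrier 𝓡} (0≤r : RealOrder._≤_ 𝓡 (RealField.0# 𝓡) r) (r<1 : RealField._<_ 𝓡 r (RealField.1# 𝓡)) where
  open NormedRing 𝓝
  open FiniteSums commutativeRing
  open Powers commutativeRing
  open Limits 𝓝
  open Geometric 0≤r r<1
  open IntegerCoefficients commutativeRing
  open SetoidReasoning setoid
  private
    module ℝ = Real 𝓡
    r≤1 = ℝ.<⇒≤ r<1

  poch-converges : ∀ x {p} → ∥ p ∥≤ r → ∃[ L ] poch x p ⟶ L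
  poch-converges x {p} ∥p∥≤r = ∏-converges λ k → ∥-∥ (∥*∥ (proj₂ (bounded x)) (∥^∥ ∥p∥≤r k))

  ∥^suc∥ : ∀ {p} → ∥ p ∥≤ r → ∀ n → ∥ p ^ suc n ∥≤ r
  ∥^suc∥ ∥p∥≤r n = ∥∥-mono (ℝ.≤-resp ℝ.refl (ℝ.*-identityʳ r) (ℝ.*-monoˡ-≤ 0≤r (ℝ.^-mono-≤1 0≤r r≤1 n)))
    (∥^∥ ∥p∥≤r (suc n))

  module Reciprocal {x p} (∥x∥≤r : ∥ x ∥≤ r) (∥p∥≤r : ∥ p ∥≤ r) where
    private
      factor : ∀ k → ∃[ w ] ((1# - x * p ^ k) * w ≈ 1# × ∥ w ∥≤ K)
      factor k = geometric (∥∥-mono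
        (ℝ.≤-resp ℝ.refl (ℝ.*-identityʳ r) (ℝ.*-monoˡ-≤ 0≤r (ℝ.^-mono-≤1 0≤r r≤1 k)))
        (∥*∥ ∥x∥≤r (∥^∥ ∥p∥≤r k))) r<1 [1-r]K≈1

      w : ℕ → Carrier
      w k = proj₁ (factor k)

      -- Each inverse factor is 1 plus a geometrically small quantity, so the reciprocal product is
      -- again of the form ∏ (1 + aₖ) and converges by the same theorem.
      w-expand : ∀ k → 1# + (x * p ^ k) * w k ≈ w k
      w-expand k = trans (+-congʳ (sym (proj₁ (proj₂ (factor k)))))
        (solve 2 (λ y w → (:1 :- y) :* w :+ y :* w := w) refl _ _)

      dominated : Dominated (r ℝ.* K) (λ k → (x * p ^ k) * w k)
      dominated k = ∥∥-mono
        (ℝ.≤-reflexive (ℝ.solve 3 (λ r R K → (r ℝ.:* R) ℝ.:* K ℝ.:= (r ℝ.:* K) ℝ.:* R) ℝ.refl r _ K))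
        (∥*∥ (∥*∥ ∥x∥≤r (∥^∥ ∥p∥≤r k)) (proj₂ (proj₂ (factor k))))

    poch⁻¹ : ℕ → Carrier
    poch⁻¹ n = ∏ n w

    poch*poch⁻¹ : ∀ n → poch x p n * poch⁻¹ n ≈ 1#
    poch*poch⁻¹ n = trans (sym (∏-* n _ _)) (∏-1 n λ k → proj₁ (proj₂ (factor k)))

    poch⁻¹-step : ∀ n → (1# - x * p ^ n) * poch⁻¹ (suc n) ≈ poch⁻¹ n
    poch⁻¹-step n = begin
      (1# - x * p ^ n) * poch⁻¹ (suc n)       ≈⟨ *-congˡ (∏-last n w) ⟩
      (1# - x * p ^ n) * (poch⁻¹ n * w n)     ≈⟨ solve 3 (λ y i w → y :* (i :* w) := i :* (y :* w)) refl _ _ _ ⟩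
      poch⁻¹ n * ((1# - x * p ^ n) * w n)     ≈⟨ *-congˡ (proj₁ (proj₂ (factor n))) ⟩
      poch⁻¹ n * 1#                           ≈⟨ *-identityʳ _ ⟩
      poch⁻¹ n                                ∎

    poch⁻¹-bounded : ∃[ B ] (∀ n → ∥ poch⁻¹ n ∥≤ B)
    poch⁻¹-bounded = let B , h = ∏-bounded dominated in B , λ n → ∥∥-cong (∏-cong n w-expand) (h n)

    poch⁻¹-converges : ∃[ L ] poch⁻¹ ⟶ L
    poch⁻¹-converges = let L , h = ∏-converges dominated in L , lim-cong (λ n → ∏-cong n w-expand) refl h

    poch∞⁻¹ : Carrier
    poch∞⁻¹ = proj₁ poch⁻¹-converges

    poch∞*poch∞⁻¹ : ∀ {L} → poch x p ⟶ L → L * poch∞⁻¹ ≈ 1#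
    poch∞*poch∞⁻¹ lim = lim-unique (lim-* lim (proj₂ poch⁻¹-converges))
      (lim-cong (λ n → sym (poch*poch⁻¹ n)) refl (lim-const 1#))

  ∏-lim : ∀ m {f : ℕ → ℕ → Carrier} {g} → (∀ j → (λ n → f j n) ⟶ g j) → (λ n → ∏ m (λ j → f j n)) ⟶ ∏ m g
  ∏-lim zero    h = lim-const 1#
  ∏-lim (suc m) h = lim-* (h 0) (∏-lim m (h ∘ suc))

  poch∞-dissect : ∀ {x q L} m {g : ℕ → Carrier} → poch x q ⟶ L →
    (∀ j → poch (x * q ^ j) (q ^ suc m) ⟶ g j) → L ≈ ∏ (suc m) g
  poch∞-dissect {x} {q} m lim lims = lim-unique
    (lim-subsequence (ℕ._* suc m) (λ n → ℕ.m≤m*n n (suc m)) lim)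
    (lim-cong (λ n → sym (poch-dissect x q (suc m) n)) refl (∏-lim (suc m) lims))

  -- Euler's (-q ; q)_∞ (q ; q²)_∞ = 1: both (q ; q²)_n (q² ; q²)_n and its limit
  -- are computed from (q ; q)_{2n} and (q ; q)_n (-q ; q)_n.
  euler : ∀ {q A N B} → ∥ q ∥≤ r → poch q q ⟶ A → poch (- q) q ⟶ N → poch q (q * q) ⟶ B → N * B ≈ 1#
  euler {q} {A} {N} {B} ∥q∥≤r limA limN limB = begin
    N * B                        ≈⟨ solve 3 (λ N B e → N :* B := (B :* N) :* :1) refl N B 1# ⟩
    (B * N) * 1#                 ≈⟨ *-congˡ (poch∞*poch∞⁻¹ limA) ⟨
    (B * N) * (A * poch∞⁻¹)      ≈⟨ solve 4 (λ N B A a → (B :* N) :* (A :* a) := (B :* (A :* N)) :* a) refl N B A _ ⟩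
    (B * (A * N)) * poch∞⁻¹      ≈⟨ *-congʳ A≈BAN ⟨
    A * poch∞⁻¹                  ≈⟨ poch∞*poch∞⁻¹ limA ⟩
    1#                           ∎
    where
    open Reciprocal ∥q∥≤r ∥q∥≤r
    A≈BAN : A ≈ B * (A * N)
    A≈BAN = lim-unique (lim-subsequence (λ n → n ℕ.+ n) (λ n → ℕ.m≤m+n n n) limA)
      (lim-cong (λ n → sym (trans (poch-double q q n) (*-congˡ (sym (poch-± q q n))))) refl
        (lim-* limB (lim-* limA limN)))

-- Triangular exponents and the monomial form of Schröter's formula

module TriangularNumbers where
  open +-*-Solver

  tri : ℕ → ℕ
  tri zero    = 0
  tri (suc n) = suc n ℕ.+ tri n

  -- T m = m (m + 1) / 2
  T : ℤ → ℕ
  T (+ n)    = tri n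
  T -[1+ n ] = tri n

  private
    2tri : ∀ n → + tri n ℤ.+ + tri n ≡ + n ℤ.* + n ℤ.+ + n
    2tri zero    = ≡.refl
    2tri (suc n) = ≡.trans
      (solve 2 (λ n t → ((con (+ 1) :+ n) :+ t) :+ ((con (+ 1) :+ n) :+ t)
         := (con (+ 2) :+ (n :+ n)) :+ (t :+ t)) ≡.refl (+ n) (+ tri n))
      (≡.trans (≡.cong (ℤ._+_ (+ 2 ℤ.+ (+ n ℤ.+ + n))) (2tri n))
        (solve 1 (λ n → (con (+ 2) :+ (n :+ n)) :+ (n :* n :+ n)
           := (con (+ 1) :+ n) :* (con (+ 1) :+ n) :+ (con (+ 1) :+ n)) ≡.refl (+ n)))

  2T : ∀ m → + T m ℤ.+ + T m ≡ m ℤ.* m ℤ.+ m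
  2T (+ n)    = 2tri n
  2T -[1+ n ] = ≡.trans (2tri n) (solve 1 (λ n → n :* n :+ n
    := (:- (con (+ 1) :+ n)) :* (:- (con (+ 1) :+ n)) :+ (:- (con (+ 1) :+ n))) ≡.refl (+ n))

  sumT : List ℤ → ℕ
  sumT = foldr (λ k s → T k ℕ.+ s) 0

  infix 4 _≐_
  record _≐_ (ks ls : List ℤ) : Set where
    constructor sameSum
    field sumT-≡ : sumT ks ≡ sumT ls
  open _≐_ public

  private
    sum2T : List ℤ → ℤ
    sum2T = foldr (λ k s → (k ℤ.* k ℤ.+ k) ℤ.+ s) (+ 0)

    2sumT : ∀ ks → + sumT ks ℤ.+ + sumT ks ≡ sum2T ks
    2sumT []       = ≡.refl
    2sumT (k ∷ ks) = ≡.trans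
      (solve 2 (λ t s → (t :+ s) :+ (t :+ s) := (t :+ t) :+ (s :+ s)) ≡.refl (+ T k) (+ sumT ks))
      (≡.cong₂ ℤ._+_ (2T k) (2sumT ks))

    double-injective : ∀ {m n : ℕ} → + m ℤ.+ + m ≡ + n ℤ.+ + n → m ≡ n
    double-injective {m} {n} eq = ℕ.*-cancelˡ-≡ m n 2
      (≡.trans (≡.cong (m ℕ.+_) (ℕ.+-identityʳ m))
        (≡.trans (ℤ.+-injective eq) (≡.cong (n ℕ.+_) (≡.sym (ℕ.+-identityʳ n)))))

    -- Doubling replaces each T k by the polynomial k² + k, so that equalities between sums of
    -- triangular numbers come within reach of the ring solver over ℤ.
    from-2T : ∀ {ks ls} → sum2T ks ≡ sum2T ls → ks ≐ ls
    from-2T {ks} {ls} eq = sameSum (double-injective (≡.trans (2sumT ks) (≡.trans eq (≡.sym (2sumT ls)))))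

    P : ∀ {n} → Polynomial n → Polynomial n
    P k = k :* k :+ k

  module _ (α β : ℤ) where
    private
      -- Schröter's change of variables: n = n′ = β - α, with m + n = 2 β on the even lines and m′ +
      -- n′ = 2 β + 1 on the odd ones.
      m = α ℤ.+ β
      n = (β ℤ.+ β) ℤ.- m
      m′ = α ℤ.+ ℤ.suc β
      n′ = ℤ.suc (β ℤ.+ β) ℤ.- m′

    T-even₁ : m ∷ ℤ.- m ∷ n ∷ ℤ.- n ∷ [] ≐
      α ∷ α ∷ ℤ.- α ∷ ℤ.- α ∷ β ∷ β ∷ ℤ.- β ∷ ℤ.- β ∷ []
    T-even₁ = from-2T (solve 2 (λ α β → let m = α :+ β ; n = (β :+ β) :- m ; z = con (+ 0) in
      P m :+ (P (:- m) :+ (P n :+ (P (:- n) :+ z))) :=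
      P α :+ (P α :+ (P (:- α) :+ (P (:- α) :+ (P β :+ (P β :+ (P (:- β) :+ (P (:- β) :+ z)))))))) ≡.refl α β)

    T-even₂ : ℤ.- m ∷ ℤ.- n ∷ [] ≐ α ∷ ℤ.- α ∷ ℤ.- β ∷ ℤ.- β ∷ []
    T-even₂ = from-2T (solve 2 (λ α β → let m = α :+ β ; n = (β :+ β) :- m ; z = con (+ 0) in
      P (:- m) :+ (P (:- n) :+ z) :=
      P α :+ (P (:- α) :+ (P (:- β) :+ (P (:- β) :+ z)))) ≡.refl α β)

    T-even₃ : ℤ.- m ∷ n ∷ [] ≐ ℤ.- α ∷ ℤ.- α ∷ β ∷ ℤ.- β ∷ []
    T-even₃ = from-2T (solve 2 (λ α β → let m = α :+ β ; n = (β :+ β) :- m ; z = con (+ 0) in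
      P (:- m) :+ (P n :+ z) :=
      P (:- α) :+ (P (:- α) :+ (P β :+ (P (:- β) :+ z)))) ≡.refl α β)

    -- The entry 1 contributes T 1 = 1 and becomes the extra factor a in front of the odd part.
    T-odd₁ : m′ ∷ ℤ.- m′ ∷ n′ ∷ ℤ.- n′ ∷ [] ≐
      + 1 ∷ α ∷ α ∷ α ∷ α ∷ β ∷ β ∷ β ∷ β ∷ []
    T-odd₁ = from-2T (solve 2 (λ α β → let 1+_ = con (+ 1) :+_ ; m = α :+ (1+ β) ; n = (1+ (β :+ β)) :- m ; z = con (+ 0) in
      P m :+ (P (:- m) :+ (P n :+ (P (:- n) :+ z))) :=
      con (+ 2) :+ (P α :+ (P α :+ (P α :+ (P α :+ (P β :+ (P β :+ (P β :+ (P β :+ z))))))))) ≡.refl α β)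

    T-odd₂ : ℤ.- m′ ∷ ℤ.- n′ ∷ [] ≐ α ∷ α ∷ β ∷ ℤ.- β ∷ []
    T-odd₂ = from-2T (solve 2 (λ α β → let 1+_ = con (+ 1) :+_ ; m = α :+ (1+ β) ; n = (1+ (β :+ β)) :- m ; z = con (+ 0) in
      P (:- m) :+ (P (:- n) :+ z) :=
      P α :+ (P α :+ (P β :+ (P (:- β) :+ z)))) ≡.refl α β)

    T-odd₃ : ℤ.- m′ ∷ n′ ∷ [] ≐ α ∷ ℤ.- α ∷ β ∷ β ∷ []
    T-odd₃ = from-2T (solve 2 (λ α β → let 1+_ = con (+ 1) :+_ ; m = α :+ (1+ β) ; n = (1+ (β :+ β)) :- m ; z = con (+ 0) in
      P (:- m) :+ (P n :+ z) :=
      P α :+ (P (:- α) :+ (P β :+ (P β :+ z)))) ≡.refl α β)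

open TriangularNumbers

module Monomials {c ℓ} (R : CommutativeRing c ℓ) where
  open CommutativeRing R
  open IntegerCoefficients R
  open Powers R
  open SetoidReasoning setoid

  -- The general term of Ramanujan's theta function f(a, b).
  θ : Carrier → Carrier → ℤ → Carrier
  θ a b m = a ^ T m * b ^ T (ℤ.- m)

  θ-cong : ∀ {a b a′ b′} → a ≈ a′ → b ≈ b′ → ∀ m → θ a b m ≈ θ a′ b′ m
  θ-cong a≈a′ b≈b′ m = *-cong (^-congˡ (T m) a≈a′) (^-congˡ (T (ℤ.- m)) b≈b′)

  θ-neg : ∀ a b m → θ a b (ℤ.- m) ≈ θ b a m
  θ-neg a b m = trans (*-congˡ (^-congʳ b (≡.cong T (ℤ.neg-involutive m)))) (*-comm _ _)

  θ-suc : ∀ a b n → θ a b (+ suc n) ≈ θ a b (+ n) * (a * (a * b) ^ n)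
  θ-suc a b zero    = solve 2 (λ a b → (a :* :1) :* :1 := (:1 :* :1) :* (a :* :1)) refl a b
  θ-suc a b (suc n) = begin
    a ^ (suc (suc n) ℕ.+ tri (suc n)) * b ^ (suc n ℕ.+ tri n)
      ≈⟨ *-cong (^-homo-* a (suc (suc n)) _) (^-homo-* b (suc n) _) ⟩
    (a ^ suc (suc n) * a ^ tri (suc n)) * (b ^ suc n * b ^ tri n)
      ≈⟨ solve 5 (λ a x y u v → ((a :* x) :* y) :* (u :* v) := (y :* v) :* (a :* (x :* u))) refl a _ _ _ _ ⟩
    (a ^ tri (suc n) * b ^ tri n) * (a * (a ^ suc n * b ^ suc n))
      ≈⟨ *-congˡ (*-congˡ (^-distrib-* a b (suc n))) ⟨
    (a ^ tri (suc n) * b ^ tri n) * (a * (a * b) ^ suc n) ∎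

  module _ (a g e : Carrier) where
    -- For a b = c d, Schröter's formula reads f(a, b) f(c, d) = f(ad, bc) f(ac, bd) + a f(ac²d,
    -- b/d) f(acd², b/c) up to the order of factors and arguments. Setting c = a e, d = a g, b = a g
    -- e makes b/c = g and b/d = e, so every argument is a monomial with natural exponents and
    -- nothing is inverted.
    mon : ℕ → ℕ → ℕ → Carrier
    mon i j k = a ^ i * (g ^ j * e ^ k)

    mon-cong : ∀ {i i′ j j′ k k′} → i ≡ i′ → j ≡ j′ → k ≡ k′ → mon i j k ≈ mon i′ j′ k′
    mon-cong ≡.refl ≡.refl ≡.refl = refl

    mon-* : ∀ i j k i′ j′ k′ → mon i j k * mon i′ j′ k′ ≈ mon (i ℕ.+ i′) (j ℕ.+ j′) (k ℕ.+ k′)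
    mon-* i j k i′ j′ k′ = trans
      (solve 6 (λ x y z u v w → (x :* (y :* z)) :* (u :* (v :* w)) := (x :* u) :* ((y :* v) :* (z :* w))) refl _ _ _ _ _ _)
      (sym (*-cong (^-homo-* a i i′) (*-cong (^-homo-* g j j′) (^-homo-* e k k′))))

    mon-^ : ∀ i j k n → mon i j k ^ n ≈ mon (i ℕ.* n) (j ℕ.* n) (k ℕ.* n)
    mon-^ i j k n = begin
      (a ^ i * (g ^ j * e ^ k)) ^ n              ≈⟨ ^-distrib-* _ _ n ⟩
      (a ^ i) ^ n * (g ^ j * e ^ k) ^ n          ≈⟨ *-congˡ (^-distrib-* _ _ n) ⟩
      (a ^ i) ^ n * ((g ^ j) ^ n * (e ^ k) ^ n)  ≈⟨ *-cong (^-assocʳ a i n) (*-cong (^-assocʳ g j n) (^-assocʳ e k n)) ⟩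
      mon (i ℕ.* n) (j ℕ.* n) (k ℕ.* n)          ∎

    θ-mon : ∀ i j k i′ j′ k′ m → θ (mon i j k) (mon i′ j′ k′) m ≈
      mon (i ℕ.* T m ℕ.+ i′ ℕ.* T (ℤ.- m)) (j ℕ.* T m ℕ.+ j′ ℕ.* T (ℤ.- m)) (k ℕ.* T m ℕ.+ k′ ℕ.* T (ℤ.- m))
    θ-mon i j k i′ j′ k′ m = trans (*-cong (mon-^ i j k (T m)) (mon-^ i′ j′ k′ (T (ℤ.- m))))
      (mon-* (i ℕ.* T m) (j ℕ.* T m) (k ℕ.* T m) (i′ ℕ.* T (ℤ.- m)) (j′ ℕ.* T (ℤ.- m)) (k′ ℕ.* T (ℤ.- m)))

    θθ-mon : ∀ i j k i′ j′ k′ l h f l′ h′ f′ m n →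
      θ (mon i j k) (mon i′ j′ k′) m * θ (mon l h f) (mon l′ h′ f′) n ≈
      mon (i ℕ.* T m ℕ.+ i′ ℕ.* T (ℤ.- m) ℕ.+ (l ℕ.* T n ℕ.+ l′ ℕ.* T (ℤ.- n)))
          (j ℕ.* T m ℕ.+ j′ ℕ.* T (ℤ.- m) ℕ.+ (h ℕ.* T n ℕ.+ h′ ℕ.* T (ℤ.- n)))
          (k ℕ.* T m ℕ.+ k′ ℕ.* T (ℤ.- m) ℕ.+ (f ℕ.* T n ℕ.+ f′ ℕ.* T (ℤ.- n)))
    θθ-mon i j k i′ j′ k′ l h f l′ h′ f′ m n = trans (*-cong (θ-mon i j k i′ j′ k′ m) (θ-mon l h f l′ h′ f′ n))
      (mon-* (i ℕ.* T m ℕ.+ i′ ℕ.* T (ℤ.- m)) (j ℕ.* T m ℕ.+ j′ ℕ.* T (ℤ.- m)) (k ℕ.* T m ℕ.+ k′ ℕ.* T (ℤ.- m))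
             (l ℕ.* T n ℕ.+ l′ ℕ.* T (ℤ.- n)) (h ℕ.* T n ℕ.+ h′ ℕ.* T (ℤ.- n)) (f ℕ.* T n ℕ.+ f′ ℕ.* T (ℤ.- n)))

    module _ (α β : ℤ) where
      open ℕSolver using () renaming (con to κ; solve to solveℕ; _:+_ to _:+ₙ_; _:*_ to _:*ₙ_; _:=_ to _:=ₙ_)
      private
        m = α ℤ.+ β
        n = (β ℤ.+ β) ℤ.- m
        m′ = α ℤ.+ ℤ.suc β
        n′ = ℤ.suc (β ℤ.+ β) ℤ.- m′

        tm = T m ; tm⁻ = T (ℤ.- m) ; tn = T n ; tn⁻ = T (ℤ.- n)
        um = T m′ ; um⁻ = T (ℤ.- m′) ; un = T n′ ; un⁻ = T (ℤ.- n′)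
        a⁺ = T α ; a⁻ = T (ℤ.- α) ; b⁺ = T β ; b⁻ = T (ℤ.- β)

        sum₄ : ∀ x x′ y y′ → 1 ℕ.* x ℕ.+ 1 ℕ.* x′ ℕ.+ (1 ℕ.* y ℕ.+ 1 ℕ.* y′) ≡ x ℕ.+ (x′ ℕ.+ (y ℕ.+ (y′ ℕ.+ 0)))
        sum₄ = solveℕ 4 (λ x x′ y y′ → κ 1 :*ₙ x :+ₙ κ 1 :*ₙ x′ :+ₙ (κ 1 :*ₙ y :+ₙ κ 1 :*ₙ y′)
          :=ₙ x :+ₙ (x′ :+ₙ (y :+ₙ (y′ :+ₙ κ 0)))) ≡.refl

        sum₂₄ : ∀ x x′ y y′ → 0 ℕ.* x ℕ.+ 1 ℕ.* x′ ℕ.+ (0 ℕ.* y ℕ.+ 1 ℕ.* y′) ≡ x′ ℕ.+ (y′ ℕ.+ 0)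
        sum₂₄ = solveℕ 4 (λ x x′ y y′ → κ 0 :*ₙ x :+ₙ κ 1 :*ₙ x′ :+ₙ (κ 0 :*ₙ y :+ₙ κ 1 :*ₙ y′)
          :=ₙ x′ :+ₙ (y′ :+ₙ κ 0)) ≡.refl

        sum₂₃ : ∀ x x′ y y′ → 0 ℕ.* x ℕ.+ 1 ℕ.* x′ ℕ.+ (1 ℕ.* y ℕ.+ 0 ℕ.* y′) ≡ x′ ℕ.+ (y ℕ.+ 0)
        sum₂₃ = solveℕ 4 (λ x x′ y y′ → κ 0 :*ₙ x :+ₙ κ 1 :*ₙ x′ :+ₙ (κ 1 :*ₙ y :+ₙ κ 0 :*ₙ y′)
          :=ₙ x′ :+ₙ (y :+ₙ κ 0)) ≡.refl

      -- Both sides are monomials in a, g and e; the three exponents are compared one by one, by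
      -- `T-even₁`, `T-even₂` and `T-even₃` in this order.
      θ-even : θ (mon 1 0 0) (mon 1 1 1) m * θ (mon 1 0 1) (mon 1 1 0) n ≈
               θ (mon 2 1 0) (mon 2 1 2) α * θ (mon 2 0 1) (mon 2 2 1) β
      θ-even = trans (θθ-mon 1 0 0 1 1 1 1 0 1 1 1 0 m n) (trans (mon-cong
               (≡.trans (sum₄ tm tm⁻ tn tn⁻) (≡.trans (sumT-≡ (T-even₁ α β)) (solveℕ 4 (λ x x′ y y′ →
                 x :+ₙ (x :+ₙ (x′ :+ₙ (x′ :+ₙ (y :+ₙ (y :+ₙ (y′ :+ₙ (y′ :+ₙ κ 0))))))) :=ₙ
                 κ 2 :*ₙ x :+ₙ κ 2 :*ₙ x′ :+ₙ (κ 2 :*ₙ y :+ₙ κ 2 :*ₙ y′)) ≡.refl a⁺ a⁻ b⁺ b⁻)))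
               (≡.trans (sum₂₄ tm tm⁻ tn tn⁻) (≡.trans (sumT-≡ (T-even₂ α β)) (solveℕ 4 (λ x x′ y y′ →
                 x :+ₙ (x′ :+ₙ (y′ :+ₙ (y′ :+ₙ κ 0))) :=ₙ
                 κ 1 :*ₙ x :+ₙ κ 1 :*ₙ x′ :+ₙ (κ 0 :*ₙ y :+ₙ κ 2 :*ₙ y′)) ≡.refl a⁺ a⁻ b⁺ b⁻)))
               (≡.trans (sum₂₃ tm tm⁻ tn tn⁻) (≡.trans (sumT-≡ (T-even₃ α β)) (solveℕ 4 (λ x x′ y y′ →
                 x′ :+ₙ (x′ :+ₙ (y :+ₙ (y′ :+ₙ κ 0))) :=ₙ
                 κ 0 :*ₙ x :+ₙ κ 2 :*ₙ x′ :+ₙ (κ 1 :*ₙ y :+ₙ κ 1 :*ₙ y′)) ≡.refl a⁺ a⁻ b⁺ b⁻))))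
        (sym (θθ-mon 2 1 0 2 1 2 2 0 1 2 2 1 α β)))

      θ-odd : θ (mon 1 0 0) (mon 1 1 1) m′ * θ (mon 1 0 1) (mon 1 1 0) n′ ≈
              mon 1 0 0 * (θ (mon 4 2 1) (mon 0 0 1) α * θ (mon 4 1 2) (mon 0 1 0) β)
      θ-odd = trans (θθ-mon 1 0 0 1 1 1 1 0 1 1 1 0 m′ n′) (trans (mon-cong
               (≡.trans (sum₄ um um⁻ un un⁻) (≡.trans (sumT-≡ (T-odd₁ α β)) (solveℕ 4 (λ x x′ y y′ →
                 κ 1 :+ₙ (x :+ₙ (x :+ₙ (x :+ₙ (x :+ₙ (y :+ₙ (y :+ₙ (y :+ₙ (y :+ₙ κ 0)))))))) :=ₙ
                 κ 1 :+ₙ (κ 4 :*ₙ x :+ₙ κ 0 :*ₙ x′ :+ₙ (κ 4 :*ₙ y :+ₙ κ 0 :*ₙ y′))) ≡.refl a⁺ a⁻ b⁺ b⁻)))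
               (≡.trans (sum₂₄ um um⁻ un un⁻) (≡.trans (sumT-≡ (T-odd₂ α β)) (solveℕ 4 (λ x x′ y y′ →
                 x :+ₙ (x :+ₙ (y :+ₙ (y′ :+ₙ κ 0))) :=ₙ
                 κ 2 :*ₙ x :+ₙ κ 0 :*ₙ x′ :+ₙ (κ 1 :*ₙ y :+ₙ κ 1 :*ₙ y′)) ≡.refl a⁺ a⁻ b⁺ b⁻)))
               (≡.trans (sum₂₃ um um⁻ un un⁻) (≡.trans (sumT-≡ (T-odd₃ α β)) (solveℕ 4 (λ x x′ y y′ →
                 x :+ₙ (x′ :+ₙ (y :+ₙ (y :+ₙ κ 0))) :=ₙ
                 κ 1 :*ₙ x :+ₙ κ 1 :*ₙ x′ :+ₙ (κ 2 :*ₙ y :+ₙ κ 0 :*ₙ y′)) ≡.refl a⁺ a⁻ b⁺ b⁻))))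
        (sym (trans (*-congˡ (θθ-mon 4 2 1 0 0 1 4 1 2 0 1 0 α β)) (mon-* 1 0 0
          (4 ℕ.* a⁺ ℕ.+ 0 ℕ.* a⁻ ℕ.+ (4 ℕ.* b⁺ ℕ.+ 0 ℕ.* b⁻))
          (2 ℕ.* a⁺ ℕ.+ 0 ℕ.* a⁻ ℕ.+ (1 ℕ.* b⁺ ℕ.+ 1 ℕ.* b⁻))
          (1 ℕ.* a⁺ ℕ.+ 1 ℕ.* a⁻ ℕ.+ (2 ℕ.* b⁺ ℕ.+ 0 ℕ.* b⁻))))))

-- Decay of theta terms and the product of two theta series

module AbsoluteValueBounds where
  open +-*-Solver

  ∣i∣≤∣i+i∣ : ∀ i → ℤ.∣ i ∣ ℕ.≤ ℤ.∣ i ℤ.+ i ∣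
  ∣i∣≤∣i+i∣ (+ n)    = ℕ.m≤m+n n n
  ∣i∣≤∣i+i∣ -[1+ n ] = ℕ.s≤s (ℕ.m≤n⇒m≤1+n (ℕ.m≤m+n n n))

  ∣i∣≤∣1+i+i∣ : ∀ i → ℤ.∣ i ∣ ℕ.≤ ℤ.∣ ℤ.suc (i ℤ.+ i) ∣
  ∣i∣≤∣1+i+i∣ (+ n)    = ℕ.m≤n⇒m≤1+n (ℕ.m≤m+n n n)
  ∣i∣≤∣1+i+i∣ -[1+ n ] = ℕ.s≤s (ℕ.m≤m+n n n)

  ∣k∣≤∣i∣+∣k-i∣ : ∀ i k → ℤ.∣ k ∣ ℕ.≤ ℤ.∣ i ∣ ℕ.+ ℤ.∣ k ℤ.- i ∣
  ∣k∣≤∣i∣+∣k-i∣ i k = ≡.subst (λ l → ℤ.∣ l ∣ ℕ.≤ ℤ.∣ i ∣ ℕ.+ ℤ.∣ k ℤ.- i ∣)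
    (solve 2 (λ i k → i :+ (k :- i) := k) ≡.refl i k) (ℤ.∣i+j∣≤∣i∣+∣j∣ i (k ℤ.- i))

  -- Passing from the pair (i, j) to (i, i + j) costs a factor 2 in the decay exponent.
  ∣i∣+∣k∣≤2∣i∣+2∣k-i∣ : ∀ i k → ℤ.∣ i ∣ ℕ.+ ℤ.∣ k ∣ ℕ.≤ (ℤ.∣ i ∣ ℕ.+ ℤ.∣ i ∣) ℕ.+ (ℤ.∣ k ℤ.- i ∣ ℕ.+ ℤ.∣ k ℤ.- i ∣)
  ∣i∣+∣k∣≤2∣i∣+2∣k-i∣ i k = ℕ.≤-trans (ℕ.+-monoʳ-≤ ℤ.∣ i ∣ (∣k∣≤∣i∣+∣k-i∣ i k))
    (ℕ.≤-trans (ℕ.≤-reflexive (≡.sym (ℕ.+-assoc ℤ.∣ i ∣ ℤ.∣ i ∣ ℤ.∣ k ℤ.- i ∣)))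
      (ℕ.+-monoʳ-≤ (ℤ.∣ i ∣ ℕ.+ ℤ.∣ i ∣) (ℕ.m≤m+n _ _)))

  -- The slack 3 is attained, in 4 ≤ 1 + 3 and 6 ≤ 3 + 3; after that the right side grows by at
  -- least 2 at each step.
  2n≤tri[n-1]+3 : ∀ n → suc n ℕ.+ suc n ℕ.≤ tri n ℕ.+ 3
  2n≤tri[n-1]+3 0 = ℕ.s≤s (ℕ.s≤s ℕ.z≤n)
  2n≤tri[n-1]+3 1 = ℕ.≤-refl
  2n≤tri[n-1]+3 (suc (suc n)) = ≡.subst₂ ℕ._≤_
    (ℕSolver.solve 1 (λ n → κ 2 :+ₙ ((κ 2 :+ₙ n) :+ₙ (κ 2 :+ₙ n)) :=ₙ (κ 3 :+ₙ n) :+ₙ (κ 3 :+ₙ n)) ≡.refl n)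
    (≡.sym (ℕ.+-assoc (suc (suc n)) (tri (suc n)) 3))
    (ℕ.+-mono-≤ (ℕ.s≤s (ℕ.s≤s ℕ.z≤n)) (2n≤tri[n-1]+3 (suc n)))
    where open ℕSolver using () renaming (con to κ; _:+_ to _:+ₙ_; _:=_ to _:=ₙ_)

open AbsoluteValueBounds

module ThetaSeries {c ℓ₁ ℓ₂} {𝓡 : RealField c ℓ₁ ℓ₂} (𝓝 : NormedRing 𝓡)
  {r : RealField.Carrier 𝓡} (0<r : RealField._<_ 𝓡 (RealField.0# 𝓡) r) (r<1 : RealField._<_ 𝓡 r (RealField.1# 𝓡)) where
  private
    module ℝ = Real 𝓡
    0≤r = ℝ.<⇒≤ 0<r
    r≤1 = ℝ.<⇒≤ r<1
  open NormedRing 𝓝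
  open FiniteSums commutativeRing
  open Powers commutativeRing
  open Monomials commutativeRing
  open Limits 𝓝
  open Geometric 0≤r r<1
  open BilateralSums 𝓝
  open Dominance 0≤r r<1
  open PochhammerLimits 𝓝 0≤r r<1
  open IntegerCoefficients commutativeRing
  open SetoidReasoning setoid

  -- The rate r^(2∣m∣), rather than r^∣m∣, leaves room for summing a product of two such families
  -- along the lines i + j = k.
  Decaying : ℝ.Carrier → (ℤ → Carrier) → Set _
  Decaying C F = ∀ m → ∥ F m ∥≤ C ℝ.* (r ℝ.^ (ℤ.∣ m ∣ ℕ.+ ℤ.∣ m ∣))

  decaying⇒dominated : ∀ {C F} → Decaying C F → Dominatedℤ C F
  decaying⇒dominated {C} dec m = ∥∥-mono (ℝ.*-monoˡ-≤ 0≤C (ℝ.^-antimono 0≤r r≤1 (ℕ.m≤m+n ℤ.∣ m ∣ ℤ.∣ m ∣))) (dec m)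
    where
    0≤C : ℝ.0# ℝ.≤ C
    0≤C = ℝ.≤-resp ℝ.refl (ℝ.*-identityʳ C) (∥∥⇒0≤ (dec (+ 0)))

  -- The factor r⁻³ absorbs the difference between n (n - 1) / 2 and 2 n.
  private
    recip = ℝ.reciprocal (ℝ.0<^ 0<r 3)

  r⁻³ : ℝ.Carrier
  r⁻³ = proj₁ recip

  -- The term at n + 1 equals aⁿ⁺¹ (ab)^(tri n), so only the product ab has to be small. This admits
  -- a = 1, which occurs in f(1, q¹⁰).
  θ-decaying : ∀ {a b} → ∥ a ∥≤ ℝ.1# → ∥ b ∥≤ ℝ.1# → ∥ a * b ∥≤ r → Decaying r⁻³ (θ a b)
  θ-decaying ∥a∥≤1 ∥b∥≤1 ∥ab∥≤r = decay ∥a∥≤1 ∥b∥≤1 ∥ab∥≤r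
    where
    0<r⁻³ = proj₁ (proj₂ recip)
    r³r⁻³≈1 = proj₂ (proj₂ recip)

    step : ∀ n {a b} → ∥ a ∥≤ ℝ.1# → ∥ a * b ∥≤ r → ∥ θ a b (+ suc n) ∥≤ r ℝ.^ tri n
    step zero    {a} {b} ∥a∥≤1 ∥ab∥≤r = ∥∥-resp (solve 1 (λ a → a := (a :* :1) :* :1) refl a) ℝ.≤-refl ∥a∥≤1
    step (suc n) {a} {b} ∥a∥≤1 ∥ab∥≤r = ∥∥-resp (sym (θ-suc a b (suc n)))
      (ℝ.≤-reflexive (ℝ.trans
        (ℝ.solve 2 (λ x y → x ℝ.:* (ℝ.:1 ℝ.:* y) ℝ.:= y ℝ.:* x) ℝ.refl _ _)
        (ℝ.sym (ℝ.^-homo-* r (suc n) (tri n)))))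
      (∥*∥ (step n ∥a∥≤1 ∥ab∥≤r) (∥*∥ ∥a∥≤1 (∥^∥ ∥ab∥≤r (suc n))))

    weaken : ∀ {e n} → n ℕ.≤ e ℕ.+ 3 → r ℝ.^ e ℝ.≤ r⁻³ ℝ.* r ℝ.^ n
    weaken {e} {n} n≤e+3 = ℝ.≤-resp
      (ℝ.trans (ℝ.*-congˡ (ℝ.^-homo-* r e 3))
        (ℝ.trans (ℝ.solve 3 (λ k x y → k ℝ.:* (x ℝ.:* y) ℝ.:= (y ℝ.:* k) ℝ.:* x) ℝ.refl _ _ _)
          (ℝ.trans (ℝ.*-congʳ r³r⁻³≈1) (ℝ.*-identityˡ _))))
      ℝ.refl (ℝ.*-monoˡ-≤ (ℝ.<⇒≤ 0<r⁻³) (ℝ.^-antimono 0≤r r≤1 n≤e+3))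

    positive : ∀ n {a b} → ∥ a ∥≤ ℝ.1# → ∥ a * b ∥≤ r → ∥ θ a b (+ suc n) ∥≤ r⁻³ ℝ.* r ℝ.^ (suc n ℕ.+ suc n)
    positive n ∥a∥≤1 ∥ab∥≤r = ∥∥-mono (weaken (2n≤tri[n-1]+3 n)) (step n ∥a∥≤1 ∥ab∥≤r)

    decay : ∀ {a b} → ∥ a ∥≤ ℝ.1# → ∥ b ∥≤ ℝ.1# → ∥ a * b ∥≤ r → Decaying r⁻³ (θ a b)
    decay         ∥a∥≤1 ∥b∥≤1 ∥ab∥≤r (+ zero)   = ∥∥-resp (sym (*-identityˡ 1#)) (weaken {0} ℕ.z≤n) ∥1∥
    decay         ∥a∥≤1 ∥b∥≤1 ∥ab∥≤r (+ suc n)  = positive n ∥a∥≤1 ∥ab∥≤r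
    decay {a} {b} ∥a∥≤1 ∥b∥≤1 ∥ab∥≤r -[1+ n ]   =
      ∥∥-cong (θ-neg b a -[1+ n ]) (positive n ∥b∥≤1 (∥∥-cong (*-comm a b) ∥ab∥≤r))

  -- Sum F(i) G(j) along the lines i + j = k, then split by the parity of k.
  convolution : ∀ {C D F G S T h k h′ k′ A B A′ B′} e → Decaying C F → Decaying D G →
    ∑ℤ∞ F ⟶ S → ∑ℤ∞ G ⟶ T → ∑ℤ∞ h ⟶ A → ∑ℤ∞ k ⟶ B → ∑ℤ∞ h′ ⟶ A′ → ∑ℤ∞ k′ ⟶ B′ →
    (∀ α β → F (α ℤ.+ β) * G ((β ℤ.+ β) ℤ.- (α ℤ.+ β)) ≈ h α * k β) →
    (∀ α β → F (α ℤ.+ ℤ.suc β) * G (ℤ.suc (β ℤ.+ β) ℤ.- (α ℤ.+ ℤ.suc β)) ≈ e * (h′ α * k′ β)) →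
    S * T ≈ A * B + e * (A′ * B′)
  convolution {C} {D} {F} {G} {S} {T} {h} {k} {h′} {k′} {A} {B} {A′} {B′} e decF decG limS limT limA limB limA′ limB′ even odd =
    fubini {R = λ i → F i * T} {U = λ β → A * k β + e * (A′ * k′ β)} bound rows
      (∑ℤ∞-cong (λ i → *-comm T (F i)) (*-comm T S) (∑ℤ∞-*ˡ T limS)) columns
      (∑ℤ∞-+ (∑ℤ∞-*ˡ A limB) (∑ℤ∞-*ˡ e (∑ℤ∞-*ˡ A′ limB′)))
    where
    line : ℤ → ℤ → Carrier
    line k i = F i * G (k ℤ.- i)

    -- The lines k = 2 β and k = 2 β + 1 are paired. For fixed i, summing over β runs through every
    -- k and gives F i * T; for fixed β, summing over i gives the even and the odd part.
    H : ℤ → ℤ → Carrier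
    H i β = line (β ℤ.+ β) i + line (ℤ.suc (β ℤ.+ β)) i

    0≤C : ℝ.0# ℝ.≤ C
    0≤C = ℝ.≤-resp ℝ.refl (ℝ.*-identityʳ C) (∥∥⇒0≤ (decF (+ 0)))
    0≤D : ℝ.0# ℝ.≤ D
    0≤D = ℝ.≤-resp ℝ.refl (ℝ.*-identityʳ D) (∥∥⇒0≤ (decG (+ 0)))
    domF = decaying⇒dominated decF
    domG = decaying⇒dominated decG

    line-bound : ∀ k i → ∥ line k i ∥≤ (C ℝ.* D) ℝ.* (r ℝ.^ (ℤ.∣ i ∣ ℕ.+ ℤ.∣ k ∣))
    line-bound k i = ∥∥-mono (ℝ.≤-resp
      (ℝ.trans (ℝ.*-congˡ (ℝ.^-homo-* r (ℤ.∣ i ∣ ℕ.+ ℤ.∣ i ∣) (ℤ.∣ k ℤ.- i ∣ ℕ.+ ℤ.∣ k ℤ.- i ∣)))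
        (ℝ.solve 4 (λ C D x y → (C ℝ.:* D) ℝ.:* (x ℝ.:* y) ℝ.:= (C ℝ.:* x) ℝ.:* (D ℝ.:* y)) ℝ.refl C D _ _))
      ℝ.refl
      (ℝ.*-monoˡ-≤ (ℝ.0≤* 0≤C 0≤D) (ℝ.^-antimono 0≤r r≤1 (∣i∣+∣k∣≤2∣i∣+2∣k-i∣ i k))))
      (∥*∥ (decF i) (decG (k ℤ.- i)))

    line-bound′ : ∀ k i β → ℤ.∣ β ∣ ℕ.≤ ℤ.∣ k ∣ → ∥ line k i ∥≤ ((C ℝ.* D) ℝ.* r ℝ.^ ℤ.∣ i ∣) ℝ.* r ℝ.^ ℤ.∣ β ∣
    line-bound′ k i β ∣β∣≤∣k∣ = ∥∥-mono (ℝ.≤-resp ℝ.refl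
      (ℝ.trans (ℝ.*-congˡ (ℝ.^-homo-* r ℤ.∣ i ∣ ℤ.∣ β ∣)) (ℝ.sym (ℝ.*-assoc _ _ _)))
      (ℝ.*-monoˡ-≤ (ℝ.0≤* 0≤C 0≤D) (ℝ.^-antimono 0≤r r≤1 (ℕ.+-monoʳ-≤ ℤ.∣ i ∣ ∣β∣≤∣k∣)))) (line-bound k i)

    bound : ∀ i β → ∥ H i β ∥≤ (((C ℝ.* D) ℝ.+ (C ℝ.* D)) ℝ.* r ℝ.^ ℤ.∣ i ∣) ℝ.* r ℝ.^ ℤ.∣ β ∣
    bound i β = ∥∥-mono
      (ℝ.≤-reflexive (ℝ.solve 3 (λ X x y → (X ℝ.:* x) ℝ.:* y ℝ.:+ (X ℝ.:* x) ℝ.:* y ℝ.:= ((X ℝ.:+ X) ℝ.:* x) ℝ.:* y) ℝ.refl _ _ _))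
      (∥+∥ (line-bound′ (β ℤ.+ β) i β (∣i∣≤∣i+i∣ β)) (line-bound′ (ℤ.suc (β ℤ.+ β)) i β (∣i∣≤∣1+i+i∣ β)))

    rows : ∀ i → ∑ℤ∞ H i ⟶ F i * T
    rows i = ∑ℤ∞-even-odd {λ k → line k i}
      (∑ℤ∞-*ˡ (F i) (∑ℤ∞-translate (dominated⇒vanishing domG) limT (ℤ.- i)))

    line-dominated : ∀ k → Dominatedℤ (C ℝ.* D) (line k)
    line-dominated k i = ∥∥-mono (ℝ.*-monoˡ-≤ (ℝ.0≤* 0≤C 0≤D) (ℝ.^-antimono 0≤r r≤1 (ℕ.m≤m+n ℤ.∣ i ∣ ℤ.∣ k ∣))) (line-bound k i)

    -- The sum along a line exists by domination. Its value is known only in the coordinate α, with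
    -- i = α + β, and is carried back by translation invariance and uniqueness of limits.
    line-sum : ∀ k β {F′ X} → (∀ α → line k (α ℤ.+ β) ≈ F′ α) → ∑ℤ∞ F′ ⟶ X → ∑ℤ∞ line k ⟶ X
    line-sum k β {X = X} eq lim =
      let Y , limY = ∑ℤ∞-converges (line-dominated k)
          translated = ∑ℤ∞-translate (dominated⇒vanishing (line-dominated k)) limY β
      in ∑ℤ∞-cong (λ _ → refl) (lim-unique (partialSums (∑ℤ∞-cong eq refl translated)) (partialSums lim)) limY

    columns : ∀ β → ∑ℤ∞ (λ i → H i β) ⟶ (A * k β + e * (A′ * k′ β))
    columns β = ∑ℤ∞-+
      (line-sum (β ℤ.+ β) β (λ α → trans (even α β) (*-comm _ _)) (∑ℤ∞-cong (λ _ → refl) (*-comm _ A) (∑ℤ∞-*ˡ (k β) limA)))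
      (line-sum (ℤ.suc (β ℤ.+ β)) (ℤ.suc β) (λ α → trans (odd α β) (*-congˡ (*-comm _ _)))
        (∑ℤ∞-*ˡ e (∑ℤ∞-cong (λ _ → refl) (*-comm _ A′) (∑ℤ∞-*ˡ (k′ β) limA′))))

-- Jacobi's triple product as the limit of a finite identity

module TripleProductIdentities where
  open +-*-Solver

  sucM-m+M+m : ∀ M m → (ℤ.suc M ℤ.- m) ℤ.+ (M ℤ.+ m) ≡ ℤ.suc (M ℤ.+ M)
  sucM-m+M+m = solve 2 (λ M m → ((con (+ 1) :+ M) :- m) :+ (M :+ m) := con (+ 1) :+ (M :+ M)) ≡.refl

  sucM+m+sucM-m : ∀ M m → (ℤ.suc M ℤ.+ m) ℤ.+ (ℤ.suc M ℤ.- m) ≡ ℤ.suc (ℤ.suc (M ℤ.+ M))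
  sucM+m+sucM-m = solve 2 (λ M m → ((con (+ 1) :+ M) :+ m) :+ ((con (+ 1) :+ M) :- m)
    := con (+ 1) :+ (con (+ 1) :+ (M :+ M))) ≡.refl

  pred[sucM-m] : ∀ M m → ℤ.pred (ℤ.suc M ℤ.- m) ≡ M ℤ.- m
  pred[sucM-m] = solve 2 (λ M m → con ℤ.-1ℤ :+ ((con (+ 1) :+ M) :- m) := M :- m) ≡.refl

  pred[sucM+m] : ∀ M m → ℤ.pred (ℤ.suc M ℤ.+ m) ≡ M ℤ.+ m
  pred[sucM+m] = solve 2 (λ M m → con ℤ.-1ℤ :+ ((con (+ 1) :+ M) :+ m) := M :+ m) ≡.refl

  sucM-sucm : ∀ M m → ℤ.suc M ℤ.- ℤ.suc m ≡ M ℤ.- m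
  sucM-sucm = solve 2 (λ M m → (con (+ 1) :+ M) :- (con (+ 1) :+ m) := M :- m) ≡.refl

  pred[M+sucm] : ∀ M m → ℤ.pred (M ℤ.+ ℤ.suc m) ≡ M ℤ.+ m
  pred[M+sucm] = solve 2 (λ M m → con ℤ.-1ℤ :+ (M :+ (con (+ 1) :+ m)) := M :+ m) ≡.refl

  sucM+predm : ∀ M m → ℤ.suc M ℤ.+ ℤ.pred m ≡ M ℤ.+ m
  sucM+predm = solve 2 (λ M m → (con (+ 1) :+ M) :+ (con ℤ.-1ℤ :+ m) := M :+ m) ≡.refl

  pred[sucM-predm] : ∀ M m → ℤ.pred (ℤ.suc M ℤ.- ℤ.pred m) ≡ ℤ.suc M ℤ.- m
  pred[sucM-predm] = solve 2 (λ M m → con ℤ.-1ℤ :+ ((con (+ 1) :+ M) :- (con ℤ.-1ℤ :+ m))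
    := (con (+ 1) :+ M) :- m) ≡.refl

  -pred : ∀ m → ℤ.- ℤ.pred m ≡ ℤ.suc (ℤ.- m)
  -pred = solve 1 (λ m → :- (con ℤ.-1ℤ :+ m) := con (+ 1) :+ (:- m)) ≡.refl

  x≡M-m⇒x+m≡M : ∀ x M m → x ≡ M ℤ.- m → x ℤ.+ m ≡ M
  x≡M-m⇒x+m≡M x M m eq = ≡.trans (≡.cong (ℤ._+ m) eq)
    (solve 2 (λ M m → (M :- m) :+ m := M) ≡.refl M m)

  x≡M+m⇒x≡M-[-m] : ∀ x M m → x ≡ M ℤ.+ m → x ≡ M ℤ.- (ℤ.- m)
  x≡M+m⇒x≡M-[-m] x M m eq = ≡.trans eq (≡.cong (ℤ._+_ M) (≡.sym (ℤ.neg-involutive m)))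

  n⊖sucn+k : ∀ n k → n ℤ.⊖ suc (n ℕ.+ k) ≡ -[1+ k ]
  n⊖sucn+k zero    k = ≡.refl
  n⊖sucn+k (suc n) k = ≡.trans (ℤ.[1+m]⊖[1+n]≡m⊖n n (suc (n ℕ.+ k))) (n⊖sucn+k n k)

open TripleProductIdentities

module TripleProduct {c ℓ₁ ℓ₂} {𝓡 : RealField c ℓ₁ ℓ₂} (𝓝 : NormedRing 𝓡)
  {r : RealField.Carrier 𝓡} (0<r : RealField._<_ 𝓡 (RealField.0# 𝓡) r) (r<1 : RealField._<_ 𝓡 r (RealField.1# 𝓡)) where
  private
    module ℝ = Real 𝓡
    0≤r = ℝ.<⇒≤ 0<r
    r≤1 = ℝ.<⇒≤ r<1
  open NormedRing 𝓝
  open FiniteSums commutativeRing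
  open Powers commutativeRing
  open Monomials commutativeRing
  open Limits 𝓝
  open Geometric 0≤r r<1
  open BilateralSums 𝓝
  open Dominance 0≤r r<1
  open PochhammerLimits 𝓝 0≤r r<1
  open ThetaSeries 𝓝 0<r r<1
  open IntegerCoefficients commutativeRing
  open SetoidReasoning setoid

  module _ {p : Carrier} (∥p∥≤r : ∥ p ∥≤ r) where
    open Reciprocal ∥p∥≤r ∥p∥≤r

    -- 1 / (p ; p)_z, which is 0 for negative z.
    inv : ℤ → Carrier
    inv (+ n)    = poch⁻¹ n
    inv -[1+ n ] = 0#

    -- This is p^z / (p ; p)_z, the coefficient in the second term of the q-Pascal rule. For
    -- negative z it is 0, so p need not be inverted.
    weighted : ℤ → Carrier
    weighted (+ n)    = p ^ n * poch⁻¹ n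
    weighted -[1+ n ] = 0#

    private
      B : ℝ.Carrier
      B = proj₁ poch⁻¹-bounded

      0≤B : ℝ.0# ℝ.≤ B
      0≤B = ∥∥⇒0≤ (proj₂ poch⁻¹-bounded 0)

      ∥inv∥ : ∀ z → ∥ inv z ∥≤ B
      ∥inv∥ (+ n)    = proj₂ poch⁻¹-bounded n
      ∥inv∥ -[1+ n ] = ∥∥-mono 0≤B ∥0∥

      ∥weighted∥ : ∀ z → ∥ weighted z ∥≤ B
      ∥weighted∥ (+ n)    = ∥∥-mono (ℝ.≤-resp ℝ.refl (ℝ.*-identityˡ B)
        (ℝ.*-mono-≤ (ℝ.0≤^ 0≤r n) 0≤B (ℝ.^-mono-≤1 0≤r r≤1 n) ℝ.≤-refl))
        (∥*∥ (∥^∥ ∥p∥≤r n) (proj₂ poch⁻¹-bounded n))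
      ∥weighted∥ -[1+ n ] = ∥∥-mono 0≤B ∥0∥

      inv-pred : ∀ n → (1# - p ^ n) * poch⁻¹ n ≈ inv (ℤ.pred (+ n))
      inv-pred zero    = solve 1 (λ i → (:1 :- :1) :* i := :0) refl _
      inv-pred (suc n) = poch⁻¹-step n

      -- 1 - p^{x+y} = (1 - p^x) + p^x (1 - p^y)
      pascal : ∀ x y N → x ℤ.+ y ≡ + N →
        (1# - p ^ N) * (inv x * inv y) ≈ inv (ℤ.pred x) * inv y + weighted x * inv (ℤ.pred y)
      pascal -[1+ x ] y N _ = solve 3 (λ u y z → u :* (:0 :* y) := :0 :* y :+ :0 :* z) refl _ _ _
      pascal (+ x) -[1+ y ] N _ = solve 4 (λ u x z w → u :* (x :* :0) := z :* :0 :+ w :* :0) refl _ _ _ _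
      pascal (+ x) (+ y) .(x ℕ.+ y) ≡.refl = begin
        (1# - p ^ (x ℕ.+ y)) * (poch⁻¹ x * poch⁻¹ y)
          ≈⟨ *-congʳ (+-congˡ (-‿cong (^-homo-* p x y))) ⟩
        (1# - p ^ x * p ^ y) * (poch⁻¹ x * poch⁻¹ y)
          ≈⟨ solve 4 (λ X Y i j → (:1 :- X :* Y) :* (i :* j) := ((:1 :- X) :* i) :* j :+ (X :* i) :* ((:1 :- Y) :* j))
               refl _ _ _ _ ⟩
        ((1# - p ^ x) * poch⁻¹ x) * poch⁻¹ y + (p ^ x * poch⁻¹ x) * ((1# - p ^ y) * poch⁻¹ y)
          ≈⟨ +-cong (*-congʳ (inv-pred x)) (*-congˡ (inv-pred y)) ⟩
        inv (ℤ.pred (+ x)) * poch⁻¹ y + (p ^ x * poch⁻¹ x) * inv (ℤ.pred (+ y)) ∎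

    module _ {a b : Carrier} (ab≈p : a * b ≈ p) where

      θ-shift⁺ : ∀ n → θ a b (+ suc n) ≈ θ a b (+ n) * (a * p ^ n)
      θ-shift⁺ n = trans (θ-suc a b n) (*-congˡ (*-congˡ (^-congˡ n ab≈p)))

      θ-shift⁻ : ∀ n → θ a b -[1+ n ] ≈ θ a b (ℤ.- + n) * (b * p ^ n)
      θ-shift⁻ n = begin
        θ a b -[1+ n ]                     ≈⟨ θ-neg a b (+ suc n) ⟩
        θ b a (+ suc n)                    ≈⟨ θ-suc b a n ⟩
        θ b a (+ n) * (b * (b * a) ^ n)    ≈⟨ *-cong (sym (θ-neg a b (+ n))) (*-congˡ (^-congˡ n (trans (*-comm b a) ab≈p))) ⟩
        θ a b (ℤ.- + n) * (b * p ^ n)      ∎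

      -- p^{M-m} times the quotient of consecutive terms is a p^M; no negative power of p appears.
      p^x*θ-suc : ∀ x M m → + x ≡ + M ℤ.- m → p ^ x * θ a b (ℤ.suc m) ≈ (a * p ^ M) * θ a b m
      p^x*θ-suc x M (+ n) eq = begin
        p ^ x * θ a b (+ suc n)               ≈⟨ *-congˡ (θ-shift⁺ n) ⟩
        p ^ x * (θ a b (+ n) * (a * p ^ n))   ≈⟨ solve 4 (λ X t a Y → X :* (t :* (a :* Y)) := (a :* (X :* Y)) :* t) refl _ _ a _ ⟩
        (a * (p ^ x * p ^ n)) * θ a b (+ n)   ≈⟨ *-congʳ (*-congˡ (^-homo-* p x n)) ⟨
        (a * p ^ (x ℕ.+ n)) * θ a b (+ n)     ≡⟨ ≡.cong (λ k → (a * p ^ k) * θ a b (+ n)) (ℤ.+-injective (x≡M-m⇒x+m≡M (+ x) (+ M) (+ n) eq)) ⟩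
        (a * p ^ M) * θ a b (+ n)             ∎
      p^x*θ-suc x M -[1+ n ] eq = begin
        p ^ x * θ a b (ℤ.suc -[1+ n ])                 ≡⟨ ≡.cong₂ (λ k m → p ^ k * θ a b m) (ℤ.+-injective eq) (suc-neg n) ⟩
        p ^ (M ℕ.+ suc n) * θ a b (ℤ.- + n)            ≈⟨ *-congʳ (^-homo-* p M (suc n)) ⟩
        (p ^ M * (p * p ^ n)) * θ a b (ℤ.- + n)        ≈⟨ *-congʳ (*-congˡ (*-congʳ ab≈p)) ⟨
        (p ^ M * ((a * b) * p ^ n)) * θ a b (ℤ.- + n)  ≈⟨ solve 5 (λ X a b Y t → (X :* ((a :* b) :* Y)) :* t := (a :* X) :* (t :* (b :* Y))) refl _ a b _ _ ⟩
        (a * p ^ M) * (θ a b (ℤ.- + n) * (b * p ^ n))  ≈⟨ *-congˡ (θ-shift⁻ n) ⟨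
        (a * p ^ M) * θ a b -[1+ n ]                   ∎
        where
        suc-neg : ∀ n → ℤ.suc -[1+ n ] ≡ ℤ.- + n
        suc-neg zero    = ≡.refl
        suc-neg (suc n) = ≡.refl

    p^x*θ-pred : ∀ {a b} → a * b ≈ p → ∀ x M m → + x ≡ + M ℤ.+ m → p ^ x * θ a b (ℤ.pred m) ≈ (b * p ^ M) * θ a b m
    p^x*θ-pred {a} {b} ab≈p x M m eq = begin
      p ^ x * θ a b (ℤ.pred m)            ≈⟨ *-congˡ (θ-neg b a (ℤ.pred m)) ⟨
      p ^ x * θ b a (ℤ.- ℤ.pred m)        ≡⟨ ≡.cong (λ k → p ^ x * θ b a k) (-pred m) ⟩
      p ^ x * θ b a (ℤ.suc (ℤ.- m))       ≈⟨ p^x*θ-suc (trans (*-comm b a) ab≈p) x M (ℤ.- m) (x≡M+m⇒x≡M-[-m] (+ x) (+ M) m eq) ⟩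
      (b * p ^ M) * θ b a (ℤ.- m)         ≈⟨ *-congˡ (θ-neg b a m) ⟩
      (b * p ^ M) * θ a b m               ∎

    module _ {a b : Carrier} (ab≈p : a * b ≈ p) (∥a∥≤1 : ∥ a ∥≤ ℝ.1#) (∥b∥≤1 : ∥ b ∥≤ ℝ.1#) where

      private
        decaying : Decaying r⁻³ (θ a b)
        decaying = θ-decaying ∥a∥≤1 ∥b∥≤1 (∥∥-cong (sym ab≈p) ∥p∥≤r)

        vanish : Vanishing (θ a b)
        vanish = dominated⇒vanishing (decaying⇒dominated decaying)

        -- Multiplied by (p ; p)_{2M}, the coefficient in `E M` is the Gaussian binomial coefficient
        -- of 2 M over M - m. The q-Pascal rule raises the top index by one only, so `E′` is the
        -- intermediate level 2 M + 1; `X` and `Y` are the second terms of the two Pascal steps.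
        E E′ X Y : ℕ → ℤ → Carrier
        E  M m = (inv (+ M ℤ.- m) * inv (+ M ℤ.+ m)) * θ a b m
        E′ M m = (inv (+ suc M ℤ.- m) * inv (+ M ℤ.+ m)) * θ a b m
        X  M m = (weighted (+ suc M ℤ.- m) * inv (ℤ.pred (+ M ℤ.+ m))) * θ a b m
        Y  M m = (weighted (+ suc M ℤ.+ m) * inv (ℤ.pred (+ suc M ℤ.- m))) * θ a b m

        scale : ∀ {u x y z w} t → u * (x * y) ≈ z * y + w → u * ((x * y) * t) ≈ (z * y) * t + w * t
        scale {u} {x} {y} {z} {w} t eq = trans (sym (*-assoc u (x * y) t)) (trans (*-congʳ eq) (distribʳ t (z * y) w))

        E′-step : ∀ M m → (1# - p ^ suc (M ℕ.+ M)) * E′ M m ≈ E M m + X M m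
        E′-step M m = trans
          (scale (θ a b m) (pascal (+ suc M ℤ.- m) (+ M ℤ.+ m) (suc (M ℕ.+ M)) (sucM-m+M+m (+ M) m)))
          (+-congʳ (*-congʳ (*-congʳ (reflexive (≡.cong inv (pred[sucM-m] (+ M) m))))))

        E-step : ∀ M m → (1# - p ^ suc (suc (M ℕ.+ M))) * E (suc M) m ≈ E′ M m + Y M m
        E-step M m = trans (*-congˡ (*-congʳ (*-comm _ _))) (trans
          (scale (θ a b m) (pascal (+ suc M ℤ.+ m) (+ suc M ℤ.- m) (suc (suc (M ℕ.+ M))) (sucM+m+sucM-m (+ M) m)))
          (+-congʳ (*-congʳ (trans (*-congʳ (reflexive (≡.cong inv (pred[sucM+m] (+ M) m)))) (*-comm _ _)))))

        X-suc : ∀ M m → X M (ℤ.suc m) ≈ (a * p ^ M) * E M m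
        X-suc M m = trans (*-congʳ (*-cong
            (reflexive (≡.cong weighted (sucM-sucm (+ M) m)))
            (reflexive (≡.cong inv (pred[M+sucm] (+ M) m)))))
          (go (+ M ℤ.- m) ≡.refl)
          where
          -- With M - m generalised to z, a negative z makes both sides 0, and for z = n the weight
          -- pⁿ is what `p^x*θ-suc` needs to move the theta term by one index.
          go : ∀ z → z ≡ + M ℤ.- m → (weighted z * inv (+ M ℤ.+ m)) * θ a b (ℤ.suc m) ≈
            (a * p ^ M) * ((inv z * inv (+ M ℤ.+ m)) * θ a b m)
          go -[1+ n ] eq = solve 4 (λ i t u s → (:0 :* i) :* t := u :* ((:0 :* i) :* s)) refl _ _ _ _
          go (+ n)    eq = begin
            ((p ^ n * poch⁻¹ n) * inv (+ M ℤ.+ m)) * θ a b (ℤ.suc m)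
              ≈⟨ solve 4 (λ P i j t → ((P :* i) :* j) :* t := (P :* t) :* (i :* j)) refl _ _ _ _ ⟩
            (p ^ n * θ a b (ℤ.suc m)) * (poch⁻¹ n * inv (+ M ℤ.+ m))
              ≈⟨ *-congʳ (p^x*θ-suc ab≈p n M m eq) ⟩
            ((a * p ^ M) * θ a b m) * (poch⁻¹ n * inv (+ M ℤ.+ m))
              ≈⟨ solve 3 (λ u t k → (u :* t) :* k := u :* (k :* t)) refl _ _ _ ⟩
            (a * p ^ M) * ((poch⁻¹ n * inv (+ M ℤ.+ m)) * θ a b m) ∎

        Y-pred : ∀ M m → Y M (ℤ.pred m) ≈ (b * p ^ M) * E′ M m
        Y-pred M m = trans (*-congʳ (*-cong
            (reflexive (≡.cong weighted (sucM+predm (+ M) m)))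
            (reflexive (≡.cong inv (pred[sucM-predm] (+ M) m)))))
          (go (+ M ℤ.+ m) ≡.refl)
          where
          go : ∀ z → z ≡ + M ℤ.+ m → (weighted z * inv (+ suc M ℤ.- m)) * θ a b (ℤ.pred m) ≈
            (b * p ^ M) * ((inv (+ suc M ℤ.- m) * inv z) * θ a b m)
          go -[1+ n ] eq = solve 4 (λ i t u s → (:0 :* i) :* t := u :* ((i :* :0) :* s)) refl _ _ _ _
          go (+ n)    eq = begin
            ((p ^ n * poch⁻¹ n) * inv (+ suc M ℤ.- m)) * θ a b (ℤ.pred m)
              ≈⟨ solve 4 (λ P i j t → ((P :* i) :* j) :* t := (P :* t) :* (j :* i)) refl _ _ _ _ ⟩
            (p ^ n * θ a b (ℤ.pred m)) * (inv (+ suc M ℤ.- m) * poch⁻¹ n)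
              ≈⟨ *-congʳ (p^x*θ-pred ab≈p n M m eq) ⟩
            ((b * p ^ M) * θ a b m) * (inv (+ suc M ℤ.- m) * poch⁻¹ n)
              ≈⟨ solve 3 (λ u t k → (u :* t) :* k := u :* (k :* t)) refl _ _ _ ⟩
            (b * p ^ M) * ((inv (+ suc M ℤ.- m) * poch⁻¹ n) * θ a b m) ∎

        vanish-X : ∀ M → Vanishing (X M)
        vanish-X M = vanishing-*ˡ (λ m → ∥*∥ (∥weighted∥ (+ suc M ℤ.- m)) (∥inv∥ (ℤ.pred (+ M ℤ.+ m)))) vanish

        vanish-Y : ∀ M → Vanishing (Y M)
        vanish-Y M = vanishing-*ˡ (λ m → ∥*∥ (∥weighted∥ (+ suc M ℤ.+ m)) (∥inv∥ (ℤ.pred (+ suc M ℤ.- m)))) vanish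

        -- The product `poch p p n * poch⁻¹ (suc n)` is the inverse of 1 - pⁿ⁺¹.
        cancel : ∀ {F S} n → ∑ℤ∞ (λ m → (1# - p ^ suc n) * F m) ⟶ S → ∑ℤ∞ F ⟶ ((poch p p n * poch⁻¹ (suc n)) * S)
        cancel {F} {S} n lim = ∑ℤ∞-cong (λ m → begin
            w * ((1# - p ^ suc n) * F m)    ≈⟨ solve 4 (λ P i u F → (P :* i) :* (u :* F) := (P :* (u :* i)) :* F) refl _ _ _ _ ⟩
            (poch p p n * ((1# - p ^ suc n) * poch⁻¹ (suc n))) * F m ≈⟨ *-congʳ (trans (*-congˡ (poch⁻¹-step n)) (poch*poch⁻¹ n)) ⟩
            1# * F m                         ≈⟨ *-identityˡ _ ⟩
            F m                              ∎) refl (∑ℤ∞-*ˡ w lim)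
          where w = poch p p n * poch⁻¹ (suc n)

        collapse : ∀ n x y i → (poch p p n * i) * (((x * y) * poch⁻¹ n)) ≈ (x * y) * i
        collapse n x y i = begin
          (poch p p n * i) * ((x * y) * poch⁻¹ n) ≈⟨ solve 4 (λ P i z j → (P :* i) :* (z :* j) := (P :* j) :* (z :* i)) refl _ i (x * y) _ ⟩
          (poch p p n * poch⁻¹ n) * ((x * y) * i) ≈⟨ trans (*-congʳ (poch*poch⁻¹ n)) (*-identityˡ _) ⟩
          (x * y) * i                             ∎

        -- The two levels are summed by mutual induction. After translating the index by one, `X`
        -- and `Y` are multiples of `E` and `E′`, so each step contributes a factor 1 + a p^M or 1 +
        -- b p^M. Although the support is finite, the sums are taken over all of ℤ, where such
        -- translations leave them unchanged.
        E-sum : ∀ M → ∑ℤ∞ E M ⟶ ((poch (- a) p M * poch (- b) p M) * poch⁻¹ (M ℕ.+ M))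
        E′-sum : ∀ M → ∑ℤ∞ E′ M ⟶ ((poch (- a) p (suc M) * poch (- b) p M) * poch⁻¹ (suc (M ℕ.+ M)))

        E-sum zero = bilateral (lim-eventually 1 eventually (lim-const _))
          where
          only-0 : ∀ n → E 0 (+ suc n) + E 0 -[1+ suc n ] ≈ 0#
          only-0 n = solve 4 (λ i t j s → (:0 :* i) :* t :+ (j :* :0) :* s := :0) refl _ _ _ _
          eventually : ∀ n → 1 ℕ.≤ n → (1# * 1#) * 1# ≈ ∑ℤ n (E 0)
          eventually (suc n) _ = sym (trans (+-congˡ (∑-0 n λ k _ → only-0 k))
            (solve 2 (λ j s → ((:1 :* :1) :* (:1 :* :1) :+ (j :* :0) :* s) :+ :0 := (:1 :* :1) :* :1) refl _ _))
        E-sum (suc M) = ∑ℤ∞-cong (λ _ → refl) total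
          (cancel (suc (M ℕ.+ M)) (∑ℤ∞-cong (λ m → sym (E-step M m)) refl
            (∑ℤ∞-+ (E′-sum M) (∑ℤ∞-cong (λ m → reflexive (≡.cong (Y M) (ℤ.pred-suc m))) refl
              (∑ℤ∞-suc (vanishing-pred (vanish-Y M)) (∑ℤ∞-cong (λ m → sym (Y-pred M m)) refl
                (∑ℤ∞-*ˡ (b * p ^ M) (E′-sum M))))))))
          where
          x = poch (- a) p (suc M)
          y = poch (- b) p M
          n = suc (M ℕ.+ M)
          total : (poch p p n * poch⁻¹ (suc n)) * ((x * y) * poch⁻¹ n + (b * p ^ M) * ((x * y) * poch⁻¹ n)) ≈
            (x * poch (- b) p (suc M)) * poch⁻¹ (suc M ℕ.+ suc M)
          total = begin
            (poch p p n * poch⁻¹ (suc n)) * ((x * y) * poch⁻¹ n + (b * p ^ M) * ((x * y) * poch⁻¹ n))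
              ≈⟨ *-congˡ (solve 4 (λ b P z i → z :* i :+ (b :* P) :* (z :* i) := (z :* (:1 :- (:- b) :* P)) :* i) refl b _ (x * y) _) ⟩
            (poch p p n * poch⁻¹ (suc n)) * (((x * y) * (1# - (- b) * p ^ M)) * poch⁻¹ n)
              ≈⟨ collapse n (x * y) _ _ ⟩
            ((x * y) * (1# - (- b) * p ^ M)) * poch⁻¹ (suc n)
              ≈⟨ *-congʳ (trans (*-assoc x y _) (*-congˡ (sym (∏-last M _)))) ⟩
            (x * poch (- b) p (suc M)) * poch⁻¹ (suc (suc (M ℕ.+ M)))
              ≡⟨ ≡.cong (λ k → (x * poch (- b) p (suc M)) * poch⁻¹ (suc k)) (≡.sym (ℕ.+-suc M M)) ⟩
            (x * poch (- b) p (suc M)) * poch⁻¹ (suc M ℕ.+ suc M) ∎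

        E′-sum M = ∑ℤ∞-cong (λ _ → refl) total
          (cancel (M ℕ.+ M) (∑ℤ∞-cong (λ m → sym (E′-step M m)) refl
            (∑ℤ∞-+ (E-sum M) (∑ℤ∞-suc⁻¹ (vanish-X M)
              (∑ℤ∞-cong (λ m → sym (X-suc M m)) refl (∑ℤ∞-*ˡ (a * p ^ M) (E-sum M)))))))
          where
          x = poch (- a) p M
          y = poch (- b) p M
          n = M ℕ.+ M
          total : (poch p p n * poch⁻¹ (suc n)) * ((x * y) * poch⁻¹ n + (a * p ^ M) * ((x * y) * poch⁻¹ n)) ≈
            (poch (- a) p (suc M) * y) * poch⁻¹ (suc n)
          total = begin
            (poch p p n * poch⁻¹ (suc n)) * ((x * y) * poch⁻¹ n + (a * p ^ M) * ((x * y) * poch⁻¹ n))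
              ≈⟨ *-congˡ (solve 5 (λ a P x y i → (x :* y) :* i :+ (a :* P) :* ((x :* y) :* i)
                   := ((x :* (:1 :- (:- a) :* P)) :* y) :* i) refl a _ x y _) ⟩
            (poch p p n * poch⁻¹ (suc n)) * (((x * (1# - (- a) * p ^ M)) * y) * poch⁻¹ n)
              ≈⟨ collapse n _ y _ ⟩
            ((x * (1# - (- a) * p ^ M)) * y) * poch⁻¹ (suc n)
              ≈⟨ *-congʳ (*-congʳ (∏-last M _)) ⟨
            (poch (- a) p (suc M) * y) * poch⁻¹ (suc n) ∎

        E-support : ∀ M k → E M (+ suc (M ℕ.+ k)) + E M -[1+ suc (M ℕ.+ k) ] ≈ 0#
        E-support M k = trans (+-cong
            (*-congʳ (*-congʳ (reflexive (≡.cong inv (n⊖sucn+k M k)))))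
            (*-congʳ (*-congˡ (reflexive (≡.cong inv (≡.trans (≡.cong (λ l → M ℤ.⊖ suc l) (≡.sym (ℕ.+-suc M k))) (n⊖sucn+k M (suc k))))))))
          (solve 4 (λ i t j s → (:0 :* i) :* t :+ (j :* :0) :* s := :0) refl _ _ _ _)

        -- `E M` vanishes outside ∣m∣ ≤ M, and `suc M` pairs cover -M-1 ≤ m ≤ M.
        E-finite : ∀ M → ∑ℤ (suc M) (E M) ≈ (poch (- a) p M * poch (- b) p M) * poch⁻¹ (M ℕ.+ M)
        E-finite M = lim-unique (lim-eventually (suc M) eventually (lim-const _)) (partialSums (E-sum M))
          where
          eventually : ∀ n → suc M ℕ.≤ n → ∑ℤ (suc M) (E M) ≈ ∑ℤ n (E M)
          eventually n sM≤n = sym (begin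
            ∑ℤ n (E M)
              ≡⟨ ≡.cong (λ l → ∑ℤ l (E M)) (ℕ.m+[n∸m]≡n sM≤n) ⟨
            ∑ℤ (suc M ℕ.+ (n ℕ.∸ suc M)) (E M)
              ≈⟨ ∑-split (suc M) (n ℕ.∸ suc M) (λ k → E M (+ k) + E M -[1+ k ]) ⟩
            ∑ℤ (suc M) (E M) + ∑ (n ℕ.∸ suc M) (λ k → E M (+ suc (M ℕ.+ k)) + E M -[1+ suc (M ℕ.+ k) ])
              ≈⟨ +-congˡ (∑-0 (n ℕ.∸ suc M) λ k _ → E-support M k) ⟩
            ∑ℤ (suc M) (E M) + 0#
              ≈⟨ +-identityʳ _ ⟩
            ∑ℤ (suc M) (E M) ∎)

        inv-lim⁻ : ∀ k → (λ M → inv (M ℤ.⊖ k)) ⟶ poch∞⁻¹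
        inv-lim⁻ zero    = proj₂ poch⁻¹-converges
        inv-lim⁻ (suc k) = lim-unshift (lim-cong
          (λ M → reflexive (≡.cong inv (≡.sym (ℤ.[1+m]⊖[1+n]≡m⊖n M k)))) refl (inv-lim⁻ k))

        inv-lim : ∀ z → (λ M → inv (+ M ℤ.+ z)) ⟶ poch∞⁻¹
        inv-lim (+ k)    = lim-subsequence (ℕ._+ k) (λ M → ℕ.m≤m+n M k) (proj₂ poch⁻¹-converges)
        inv-lim -[1+ k ] = inv-lim⁻ (suc k)

      -- As M grows in `E-finite`, both reciprocals in `E` tend to I = 1 / (p ; p)_∞. Tannery's
      -- theorem gives I² S = L L′ I, and multiplication by P² leaves the product.
      jacobiTripleProduct : ∀ {L L′ P} → poch (- a) p ⟶ L → poch (- b) p ⟶ L′ → poch p p ⟶ P → ∑ℤ∞ θ a b ⟶ ((L * L′) * P)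
      jacobiTripleProduct {L} {L′} {P} limL limL′ limP =
        let S , limS = ∑ℤ∞-converges (decaying⇒dominated decaying)
            I²S≈LL′I : (I * I) * S ≈ (L * L′) * I
            I²S≈LL′I = lim-unique
              (tanneryℤ {F = E} suc ℕ.n≤1+n
                (λ M m → ∥∥-mono (ℝ.≤-reflexive (ℝ.sym (ℝ.*-assoc _ _ _)))
                  (∥*∥ (∥*∥ (∥inv∥ (+ M ℤ.- m)) (∥inv∥ (+ M ℤ.+ m))) (decaying⇒dominated decaying m)))
                (λ m → lim-* (lim-* (inv-lim (ℤ.- m)) (inv-lim m)) (lim-const _))
                (∑ℤ∞-*ˡ (I * I) limS))
              (lim-cong (λ M → sym (E-finite M)) refl
                (lim-* (lim-* limL limL′) (lim-subsequence (λ M → M ℕ.+ M) (λ M → ℕ.m≤m+n M M) (proj₂ poch⁻¹-converges))))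
        in ∑ℤ∞-cong (λ _ → refl) (S≈LL′P I²S≈LL′I) limS
        where
        I = poch∞⁻¹
        PI≈1 : P * I ≈ 1#
        PI≈1 = poch∞*poch∞⁻¹ limP
        S≈LL′P : ∀ {S} → (I * I) * S ≈ (L * L′) * I → S ≈ (L * L′) * P
        S≈LL′P {S} eq = begin
          S                          ≈⟨ solve 2 (λ e S → S := (:1 :* :1) :* S) refl 1# S ⟩
          (1# * 1#) * S              ≈⟨ *-congʳ (*-cong PI≈1 PI≈1) ⟨
          ((P * I) * (P * I)) * S    ≈⟨ solve 3 (λ P I S → ((P :* I) :* (P :* I)) :* S := (P :* P) :* ((I :* I) :* S)) refl P I S ⟩
          (P * P) * ((I * I) * S)    ≈⟨ *-congˡ eq ⟩
          (P * P) * ((L * L′) * I)   ≈⟨ solve 3 (λ P I Z → (P :* P) :* (Z :* I) := (P :* I) :* (Z :* P)) refl P I (L * L′) ⟩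
          (P * I) * ((L * L′) * P)   ≈⟨ trans (*-congʳ PI≈1) (*-identityˡ _) ⟩
          (L * L′) * P               ∎

-- Bailey's lemma at a finite level

double : ℕ → ℕ
double zero    = 0
double (suc n) = suc (suc (double n))

n≤double : ∀ n → n ℕ.≤ double n
n≤double zero    = ℕ.z≤n
n≤double (suc n) = ℕ.s≤s (ℕ.m≤n⇒m≤1+n (n≤double n))

-- The two cases for the reciprocal of (q ; q)_{n-r}: by convention it is 0 when n < r, otherwise k
-- = n - r is its genuine index.
data Difference (n r : ℕ) : Set where
  less  : n ℕ.< r → Difference n r
  atLeast : ∀ k → n ≡ r ℕ.+ k → Difference n r

difference : ∀ n r → Difference n r
difference n       zero    = atLeast n ≡.refl
difference zero    (suc r) = less (ℕ.s≤s ℕ.z≤n)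
difference (suc n) (suc r) with difference n r
... | less n<r          = less (ℕ.s≤s n<r)
... | atLeast k ≡.refl  = atLeast k ≡.refl

module Bailey {ℓ₁ ℓ₂} (R : CommutativeRing ℓ₁ ℓ₂) where
  open CommutativeRing R
  open Powers R
  open FiniteSums R
  open IntegerCoefficients R
  open SetoidReasoning setoid

  -- P n = (q ; q)_n and Q n = (q ; q²)_n, with reciprocals i n and j n.
  module Pair (q : Carrier) (i P j Q : ℕ → Carrier)
    (i-zero : i 0 ≈ 1#) (i-suc : ∀ n → (1# - q ^ suc n) * i (suc n) ≈ i n) (P*i : ∀ n → P n * i n ≈ 1#)
    (j-zero : j 0 ≈ 1#) (j-suc : ∀ n → (1# - q * (q * q) ^ n) * j (suc n) ≈ j n) (Q*j : ∀ n → Q n * j n ≈ 1#)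
    where

    -- ι n r = i (n - r), which is 0 when n < r.
    ι : ℕ → ℕ → Carrier
    ι n       zero    = i n
    ι zero    (suc r) = 0#
    ι (suc n) (suc r) = ι n r

    ι-< : ∀ {n r} → n ℕ.< r → ι n r ≈ 0#
    ι-< {zero}  {suc r} _             = refl
    ι-< {suc n} {suc r} (ℕ.s≤s n<r)   = ι-< n<r

    ι-+ : ∀ r n k → ι (r ℕ.+ n) (r ℕ.+ k) ≈ ι n k
    ι-+ zero    n k = refl
    ι-+ (suc r) n k = ι-+ r n k

    ι-+ˡ : ∀ r n → ι (r ℕ.+ n) r ≈ i n
    ι-+ˡ zero    n = refl
    ι-+ˡ (suc r) n = ι-+ˡ r n

    ι-1+ : ∀ r n → ι (r ℕ.+ n) (suc r) ≈ (1# - q ^ n) * i n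
    ι-1+ zero    zero    = solve 1 (λ i → :0 := (:1 :- :1) :* i) refl _
    ι-1+ zero    (suc n) = sym (i-suc n)
    ι-1+ (suc r) n       = ι-1+ r n

    -- The factor q clears the exponent n - 1: q (1 - qⁿ⁻¹) is written q - qⁿ, which also makes
    -- sense at n = 0.
    q*ι-2+ : ∀ r n → q * ι (r ℕ.+ n) (suc (suc r)) ≈ ((1# - q ^ n) * (q - q ^ n)) * i n
    q*ι-2+ zero    zero    = solve 2 (λ q i → q :* :0 := ((:1 :- :1) :* (q :- :1)) :* i) refl q _
    q*ι-2+ zero    (suc n) = begin
      q * ι n 1                                              ≈⟨ *-congˡ (ι-1+ 0 n) ⟩
      q * ((1# - q ^ n) * i n)                               ≈⟨ *-congˡ (*-congˡ (i-suc n)) ⟨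
      q * ((1# - q ^ n) * ((1# - q ^ suc n) * i (suc n)))    ≈⟨ solve 3 (λ q x i → q :* ((:1 :- x) :* ((:1 :- q :* x) :* i))
                                                                  := ((:1 :- q :* x) :* (q :- q :* x)) :* i) refl q _ _ ⟩
      ((1# - q ^ suc n) * (q - q ^ suc n)) * i (suc n)       ∎
    q*ι-2+ (suc r) n       = q*ι-2+ r n

    annihilate : ∀ {x y z} → y ≈ 0# → x * (y * z) ≈ 0#
    annihilate y≈0 = trans (*-congˡ (trans (*-congʳ y≈0) (zeroˡ _))) (zeroʳ _)

    ^-double : ∀ n → q ^ double n ≈ q ^ n * q ^ n
    ^-double zero    = sym (*-identityˡ 1#)
    ^-double (suc n) = trans (*-congˡ (*-congˡ (^-double n)))
      (solve 2 (λ q x → q :* (q :* (x :* x)) := (q :* x) :* (q :* x)) refl q _)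

    -- A Bailey pair relative to 1: β n = 1 / ((q ; q)_n (q ; q²)_n) and α (2 s) = weight s, α (2 s + 1) = 0,
    -- where weight s = (-1)^s q^{3s²-s} (1 + q^{2s}) for s > 0.
    w : ℕ → Carrier
    w zero    = 1#
    w (suc s) = - (w s * ((q ^ s) ^ 6 * q ^ 2))

    weight : ℕ → Carrier
    weight zero    = 1#
    weight (suc s) = w (suc s) * (1# + q ^ suc s * q ^ suc s)

    pairTerm : ℕ → ℕ → Carrier
    pairTerm n s = weight s * (ι n (double s) * i (double s ℕ.+ n))

    private
      -- The WZ certificate: its differences in s turn the recurrence of 1 / ((q ; q)_n (q ; q²)_n)
      -- into a telescoping sum.
      certificate : ℕ → ℕ → Carrier
      certificate n s = (w s * ((q ^ s) ^ 4 * q ^ n)) * (ι n (suc (suc (double s))) * i (double s ℕ.+ n))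

      -- The ratio β n / β (n + 1).
      u : ℕ → Carrier
      u n = (1# - q ^ suc n) * (1# - q * (q * q) ^ n)

      certificate-zero : ∀ n → u n * pairTerm (suc n) 0 - pairTerm n 0 ≈ certificate (suc n) 0
      certificate-zero n = begin
        u n * (1# * (I * I)) - 1# * (i n * i n)
          ≈⟨ +-cong (*-congʳ (*-congˡ (+-congˡ (-‿cong (*-congˡ (^-distrib-* q q n))))))
                    (-‿cong (*-congˡ (*-cong (sym (i-suc n)) (sym (i-suc n))))) ⟩
        ((1# - q * x) * (1# - q * (x * x))) * (1# * (I * I)) - 1# * (((1# - q * x) * I) * ((1# - q * x) * I))
          ≈⟨ solve 3 (λ q x I →
               ((:1 :- q :* x) :* (:1 :- q :* (x :* x))) :* (:1 :* (I :* I)) :- :1 :* (((:1 :- q :* x) :* I) :* ((:1 :- q :* x) :* I))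
               := (:1 :* (:1 :^ 4 :* (q :* x))) :* (((:1 :- x) :* ((:1 :- q :* x) :* I)) :* I)) refl q x I ⟩
        (1# * (1# ^ 4 * (q * x))) * (((1# - x) * ((1# - q * x) * I)) * I)
          ≈⟨ *-congˡ (*-congʳ (trans (*-congˡ (i-suc n)) (sym (ι-1+ 0 n)))) ⟩
        (1# * (1# ^ 4 * (q * x))) * (ι n 1 * I) ∎
        where
        x = q ^ n
        I = i (suc n)

      certificate-suc : ∀ n s → u n * pairTerm (suc n) (suc s) - pairTerm n (suc s) ≈ certificate (suc n) (suc s) - certificate (suc n) s
      certificate-suc n s with difference (suc n) (double (suc s))
      ... | less sn<2s = begin
        u n * pairTerm (suc n) (suc s) - pairTerm n (suc s)
          ≈⟨ +-cong (*-congˡ (annihilate (ι-< sn<2s))) (-‿cong (annihilate (ι-< (ℕ.<-trans (ℕ.n<1+n n) sn<2s)))) ⟩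
        u n * 0# - 0#
          ≈⟨ solve 1 (λ a → a :* :0 :- :0 := :0 :- :0) refl _ ⟩
        0# - 0#
          ≈⟨ +-cong (annihilate (ι-< (ℕ.<-trans sn<2s (ℕ.<-trans (ℕ.n<1+n _) (ℕ.n<1+n _))))) (-‿cong (annihilate (ι-< sn<2s))) ⟨
        certificate (suc n) (suc s) - certificate (suc n) s ∎
      -- Now n = 2 s + 1 + k. With x = q^s and y = q^k every power of q is a monomial, and all
      -- reciprocals are expressed through `d₀` and `e₀`, so the claim becomes a polynomial
      -- identity.
      ... | atLeast k ≡.refl = begin
        u n * (weight (suc s) * (ι (K ℕ.+ k) K * e₀)) - weight (suc s) * (ι (suc (K ℕ.+ k)) (suc (suc K)) * i (suc (suc K) ℕ.+ n))
          ≈⟨ +-cong (*-cong (*-cong (+-congˡ (-‿cong qⁿ⁺¹)) (+-congˡ (-‿cong (*-congˡ (trans (^-distrib-* q q n) (*-cong qⁿ qⁿ))))))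
                            (*-congˡ (*-congʳ (ι-+ˡ K k))))
                    (-‿cong (*-congˡ (*-cong (ι-1+ K k) e₁))) ⟩
        ((1# - q * (q * (x * x * y))) * (1# - q * ((q * (x * x * y)) * (q * (x * x * y))))) * (weight (suc s) * (d₀ * e₀))
          - weight (suc s) * (((1# - y) * d₀) * ((1# - (q * (q * (x * x))) * (q * (q * (x * x * y)))) * e₀))
          ≈⟨ solve 6 (λ q x y w d e → let W = (:- (w :* (x :^ 6 :* q :^ 2))) :* (:1 :+ (q :* x) :* (q :* x)) in
               ((:1 :- q :* (q :* (x :* x :* y))) :* (:1 :- q :* ((q :* (x :* x :* y)) :* (q :* (x :* x :* y))))) :* (W :* (d :* e))
               :- W :* (((:1 :- y) :* d) :* ((:1 :- (q :* (q :* (x :* x))) :* (q :* (q :* (x :* x :* y)))) :* e))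
               := ((:- (w :* (x :^ 6 :* q :^ 2))) :* ((q :* x) :^ 4 :* (q :* (x :* x :* y)))) :* ((((:1 :- y) :* (q :- y)) :* d) :* e)
               :- (w :* (x :^ 4 :* (q :* (q :* (x :* x :* y))))) :* (d :* ((:1 :- q :* ((x :* x) :* (q :* (q :* (x :* x :* y))))) :* ((:1 :- (q :* (q :* (x :* x))) :* (q :* (q :* (x :* x :* y)))) :* e))))
               refl q x y (w s) d₀ e₀ ⟩
        (w (suc s) * ((q ^ suc s) ^ 4 * (q * (x * x * y)))) * ((((1# - y) * (q - y)) * d₀) * e₀)
          - (w s * (x ^ 4 * (q * (q * (x * x * y))))) * (d₀ * ((1# - q * ((x * x) * (q * (q * (x * x * y))))) * ((1# - (q * (q * (x * x))) * (q * (q * (x * x * y)))) * e₀)))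
          ≈⟨ +-cong (trans
                      (solve 6 (λ W X N q d e → (W :* (X :* (q :* N))) :* (d :* e) := (W :* (X :* N)) :* ((q :* d) :* e)) refl _ _ _ q _ _)
                      (*-cong (*-congˡ (*-congˡ qⁿ)) (*-congʳ (q*ι-2+ K k))))
                    (-‿cong (*-cong (*-congˡ (*-congˡ qⁿ⁺¹)) (*-cong (ι-+ˡ K k) e₂))) ⟨
        (w (suc s) * ((q ^ suc s) ^ 4 * (q * q ^ n))) * (ι (K ℕ.+ k) (suc (suc K)) * e₀)
          - (w s * (x ^ 4 * (q * q ^ n))) * (ι (K ℕ.+ k) K * i (K ℕ.+ suc n)) ∎
        where
        K = double s
        x = q ^ s
        y = q ^ k
        d₀ = i k
        e₀ = i (suc (suc K) ℕ.+ suc n)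
        qⁿ : q ^ n ≈ q * (x * x * y)
        qⁿ = *-congˡ (trans (^-homo-* q K k) (*-congʳ (^-double s)))
        qⁿ⁺¹ : q ^ suc n ≈ q * (q * (x * x * y))
        qⁿ⁺¹ = *-congˡ qⁿ
        top : q ^ (suc (suc K) ℕ.+ suc n) ≈ (q * (q * (x * x))) * (q * (q * (x * x * y)))
        top = trans (^-homo-* q (suc (suc K)) (suc n)) (*-cong (*-congˡ (*-congˡ (^-double s))) qⁿ⁺¹)
        e₁ : i (suc (suc K) ℕ.+ n) ≈ (1# - (q * (q * (x * x))) * (q * (q * (x * x * y)))) * e₀
        e₁ = begin
          i (suc (suc K) ℕ.+ n)
            ≈⟨ i-suc (suc (suc K) ℕ.+ n) ⟨
          (1# - q ^ suc (suc (suc K) ℕ.+ n)) * i (suc (suc (suc K) ℕ.+ n))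
            ≡⟨ ≡.cong (λ l → (1# - q ^ l) * i l) (≡.sym (ℕ.+-suc (suc (suc K)) n)) ⟩
          (1# - q ^ (suc (suc K) ℕ.+ suc n)) * e₀
            ≈⟨ *-congʳ (+-congˡ (-‿cong top)) ⟩
          (1# - (q * (q * (x * x))) * (q * (q * (x * x * y)))) * e₀ ∎
        e₂ : i (K ℕ.+ suc n) ≈ (1# - q * ((x * x) * (q * (q * (x * x * y))))) * ((1# - (q * (q * (x * x))) * (q * (q * (x * x * y)))) * e₀)
        e₂ = begin
          i (K ℕ.+ suc n)
            ≈⟨ i-suc (K ℕ.+ suc n) ⟨
          (1# - q ^ suc (K ℕ.+ suc n)) * i (suc (K ℕ.+ suc n))
            ≈⟨ *-cong (+-congˡ (-‿cong (*-congˡ (trans (^-homo-* q K (suc n)) (*-cong (^-double s) qⁿ⁺¹)))))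
                      (sym (i-suc (suc (K ℕ.+ suc n)))) ⟩
          (1# - q * ((x * x) * (q * (q * (x * x * y))))) * ((1# - q ^ suc (suc (K ℕ.+ suc n))) * e₀)
            ≈⟨ *-congˡ (*-congʳ (+-congˡ (-‿cong top))) ⟩
          (1# - q * ((x * x) * (q * (q * (x * x * y))))) * ((1# - (q * (q * (x * x))) * (q * (q * (x * x * y)))) * e₀) ∎

      partialSum : ∀ n S → u n * ∑ (suc S) (pairTerm (suc n)) - ∑ (suc S) (pairTerm n) ≈ certificate (suc n) S
      partialSum n zero    = trans (solve 3 (λ u a b → u :* (a :+ :0) :- (b :+ :0) := u :* a :- b) refl _ _ _) (certificate-zero n)
      partialSum n (suc S) = begin
        u n * ∑ (suc (suc S)) (pairTerm (suc n)) - ∑ (suc (suc S)) (pairTerm n)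
          ≈⟨ +-cong (*-congˡ (∑-last (suc S) (pairTerm (suc n)))) (-‿cong (∑-last (suc S) (pairTerm n))) ⟩
        u n * (∑ (suc S) (pairTerm (suc n)) + pairTerm (suc n) (suc S)) - (∑ (suc S) (pairTerm n) + pairTerm n (suc S))
          ≈⟨ solve 5 (λ u a b c d → u :* (a :+ b) :- (c :+ d) := (u :* a :- c) :+ (u :* b :- d)) refl _ _ _ _ _ ⟩
        (u n * ∑ (suc S) (pairTerm (suc n)) - ∑ (suc S) (pairTerm n)) + (u n * pairTerm (suc n) (suc S) - pairTerm n (suc S))
          ≈⟨ +-cong (partialSum n S) (certificate-suc n S) ⟩
        certificate (suc n) S + (certificate (suc n) (suc S) - certificate (suc n) S)
          ≈⟨ solve 2 (λ a b → a :+ (b :- a) := b) refl _ _ ⟩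
        certificate (suc n) (suc S) ∎

    -- Both sides satisfy the recurrence with ratio `u`: for the sum, the certificate telescopes and
    -- its boundary value is 0 because 2 S + 2 > n + 1. The bound S stays free above n so that one
    -- range of summation serves all n when sums are interchanged.
    baileyPair : ∀ n S → n ℕ.≤ S → i n * j n ≈ ∑ (suc S) (pairTerm n)
    baileyPair zero S _ = begin
      i 0 * j 0                                     ≈⟨ trans (*-congˡ j-zero) (*-congˡ (sym i-zero)) ⟩
      i 0 * i 0                                     ≈⟨ solve 1 (λ x → x := :1 :* x :+ :0) refl _ ⟩
      1# * (i 0 * i 0) + 0#                         ≈⟨ +-congˡ (∑-0 S λ s _ → trans (*-congˡ (zeroˡ _)) (zeroʳ _)) ⟨
      ∑ (suc S) (pairTerm 0)                        ∎
    baileyPair (suc n) S sn≤S = begin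
      i (suc n) * j (suc n)
        ≈⟨ solve 2 (λ I J → I :* J := (I :* :1) :* (J :* :1)) refl _ _ ⟩
      (i (suc n) * 1#) * (j (suc n) * 1#)
        ≈⟨ *-cong (*-congˡ (P*i n)) (*-congˡ (Q*j n)) ⟨
      (i (suc n) * (P n * i n)) * (j (suc n) * (Q n * j n))
        ≈⟨ solve 6 (λ I P i J Q j → (I :* (P :* i)) :* (J :* (Q :* j)) := ((I :* P) :* (J :* Q)) :* (i :* j)) refl _ _ _ _ _ _ ⟩
      ((i (suc n) * P n) * (j (suc n) * Q n)) * (i n * j n)
        ≈⟨ *-congˡ (baileyPair n S (ℕ.<⇒≤ sn≤S)) ⟩
      ((i (suc n) * P n) * (j (suc n) * Q n)) * ∑ (suc S) (pairTerm n)
        ≈⟨ *-congˡ recurrence ⟨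
      ((i (suc n) * P n) * (j (suc n) * Q n)) * (u n * σ)
        ≈⟨ solve 7 (λ I P J Q a b σ → ((I :* P) :* (J :* Q)) :* ((a :* b) :* σ) := ((P :* (a :* I)) :* (Q :* (b :* J))) :* σ) refl _ _ _ _ _ _ _ ⟩
      ((P n * ((1# - q ^ suc n) * i (suc n))) * (Q n * ((1# - q * (q * q) ^ n) * j (suc n)))) * σ
        ≈⟨ *-congʳ (*-cong (trans (*-congˡ (i-suc n)) (P*i n)) (trans (*-congˡ (j-suc n)) (Q*j n))) ⟩
      (1# * 1#) * σ
        ≈⟨ solve 1 (λ σ → (:1 :* :1) :* σ := σ) refl σ ⟩
      σ ∎
      where
      σ = ∑ (suc S) (pairTerm (suc n))
      recurrence : u n * σ ≈ ∑ (suc S) (pairTerm n)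
      recurrence = begin
        u n * σ                                                       ≈⟨ solve 2 (λ a b → a := (a :- b) :+ b) refl _ _ ⟩
        (u n * σ - ∑ (suc S) (pairTerm n)) + ∑ (suc S) (pairTerm n)   ≈⟨ +-congʳ (partialSum n S) ⟩
        certificate (suc n) S + ∑ (suc S) (pairTerm n)
          ≈⟨ +-congʳ (annihilate (ι-< {suc n} {suc (suc (double S))}
               (ℕ.s≤s (ℕ.≤-trans sn≤S (ℕ.≤-trans (n≤double S) (ℕ.n≤1+n _)))))) ⟩
        0# + ∑ (suc S) (pairTerm n)                                   ≈⟨ +-identityˡ _ ⟩
        ∑ (suc S) (pairTerm n)                                        ∎

    -- `c n` is (-1 ; q)_n q^(n(n+1)/2), the weight of Bailey's lemma for ρ₁ = -1, ρ₂ → ∞.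
    c : ℕ → Carrier
    c zero    = 1#
    c (suc n) = c n * ((1# + q ^ n) * q ^ suc n)

    pn : ℕ → Carrier
    pn = poch (- q) q

    -- `κ n` is q^(n(n+1)/2).
    κ : ℕ → Carrier
    κ zero    = 1#
    κ (suc n) = κ n * q ^ suc n

    pn-suc : ∀ n → pn (suc n) ≈ pn n * (1# + q ^ suc n)
    pn-suc n = trans (∏-last n (λ j → 1# - (- q) * q ^ j)) (*-congˡ
      (solve 2 (λ q x → :1 :- (:- q) :* x := :1 :+ q :* x) refl q _))

    -- For n > 0, (-1)_n = 2 (-q)_{n-1}, and 1 + qⁿ completes the product to (-q)_n. In `weight`
    -- this factor comes along, so the quotient c_n / (-q)_n never has to be formed.
    c-pn-κ : ∀ n → (1# + q ^ suc n) * c (suc n) ≈ ((1# + 1#) * κ (suc n)) * pn (suc n)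
    c-pn-κ zero    = solve 1 (λ q → (:1 :+ q :* :1) :* (:1 :* ((:1 :+ :1) :* (q :* :1)))
      := ((:1 :+ :1) :* (:1 :* (q :* :1))) :* ((:1 :- (:- q) :* :1) :* :1)) refl q
    c-pn-κ (suc n) = begin
      (1# + y) * (c (suc n) * ((1# + x) * y))
        ≈⟨ solve 3 (λ x y c → (:1 :+ y) :* (c :* ((:1 :+ x) :* y)) := ((:1 :+ x) :* c) :* ((:1 :+ y) :* y)) refl x y _ ⟩
      ((1# + x) * c (suc n)) * ((1# + y) * y)
        ≈⟨ *-congʳ (c-pn-κ n) ⟩
      (((1# + 1#) * κ (suc n)) * pn (suc n)) * ((1# + y) * y)
        ≈⟨ solve 3 (λ y k p → (((:1 :+ :1) :* k) :* p) :* ((:1 :+ y) :* y) := ((:1 :+ :1) :* (k :* y)) :* (p :* (:1 :+ y))) refl y _ _ ⟩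
      ((1# + 1#) * (κ (suc n) * y)) * (pn (suc n) * (1# + y))
        ≈⟨ *-congˡ (pn-suc (suc n)) ⟨
      ((1# + 1#) * κ (suc (suc n))) * pn (suc (suc n)) ∎
      where
      x = q ^ suc n
      y = q ^ suc (suc n)

    module _ (r : ℕ) where
      rr : ℕ
      rr = r ℕ.+ r

      -- The inner summand of Bailey's lemma at level N = M + r, reindexed by n = k + r so that only
      -- nonzero terms remain.
      conjugateTerm : ℕ → ℕ → Carrier
      conjugateTerm M k = c (k ℕ.+ r) * (ι M k * (i k * i (k ℕ.+ rr)))

      private
        z : Carrier
        z = q ^ r

        -- The closed form (-q)_{M+r} / ((q)_M (q)_{M+2r}) grows by the factor `v′ M` / `v M` from M
        -- to M + 1; the inner sum is shown to do the same.
        v : ℕ → Carrier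
        v M = (1# - q ^ suc M) * (1# - q ^ suc (M ℕ.+ rr))

        v′ : ℕ → Carrier
        v′ M = 1# + q ^ suc (M ℕ.+ r)

        -- The Wilf-Zeilberger mate of `conjugateTerm`: its differences in k are the defect of the
        -- recurrence with `v` and `v′`, and it vanishes beyond the range of summation.
        certificate′ : ℕ → ℕ → Carrier
        certificate′ M k = ((q ^ M * z) * (1# + q ^ (k ℕ.+ r))) * (c (k ℕ.+ r) * (ι M (suc k) * (i k * i (k ℕ.+ rr))))

        q^rr : q ^ rr ≈ z * z
        q^rr = ^-homo-* q r r

        step-zero : ∀ M → v M * conjugateTerm (suc M) 0 - v′ M * conjugateTerm M 0 ≈ - certificate′ (suc M) 0
        step-zero M = begin
          v M * (c r * (I * (i 0 * i rr))) - v′ M * (c r * (i M * (i 0 * i rr)))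
            ≈⟨ +-cong (*-congʳ (*-congˡ (+-congˡ (-‿cong (*-congˡ (trans (^-homo-* q M rr) (*-congˡ q^rr)))))))
                      (-‿cong (*-cong (+-congˡ (*-congˡ (^-homo-* q M r))) (*-congˡ (*-congʳ (sym (i-suc M)))))) ⟩
          ((1# - q * y) * (1# - q * (y * (z * z)))) * (c r * (I * e)) - (1# + q * (y * z)) * (c r * (((1# - q * y) * I) * e))
            ≈⟨ solve 6 (λ q y z C I e →
                 ((:1 :- q :* y) :* (:1 :- q :* (y :* (z :* z)))) :* (C :* (I :* e)) :- (:1 :+ q :* (y :* z)) :* (C :* (((:1 :- q :* y) :* I) :* e))
                 := :- ((((q :* y) :* z) :* (:1 :+ z)) :* (C :* (((:1 :- q :* y) :* I) :* e)))) refl q y z (c r) I e ⟩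
          - ((((q * y) * z) * (1# + z)) * (c r * (((1# - q * y) * I) * e)))
            ≈⟨ -‿cong (*-congˡ (*-congˡ (*-congʳ (i-suc M)))) ⟩
          - certificate′ (suc M) 0 ∎
          where
          y = q ^ M
          I = i (suc M)
          e = i 0 * i rr

        step-suc : ∀ M k → v M * conjugateTerm (suc M) (suc k) - v′ M * conjugateTerm M (suc k) ≈
          certificate′ (suc M) k - certificate′ (suc M) (suc k)
        step-suc M l with difference M l
        ... | less M<l = begin
          v M * conjugateTerm (suc M) (suc l) - v′ M * conjugateTerm M (suc l)
            ≈⟨ +-cong (*-congˡ (annihilate (ι-< M<l))) (-‿cong (*-congˡ (annihilate (ι-< (ℕ.<-trans M<l (ℕ.n<1+n l)))))) ⟩
          v M * 0# - v′ M * 0#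
            ≈⟨ solve 4 (λ a b c d → a :* :0 :- b :* :0 := c :* :0 :- d :* :0) refl _ _ _ _ ⟩
          ((q ^ suc M * z) * (1# + q ^ (l ℕ.+ r))) * 0# - ((q ^ suc M * z) * (1# + q ^ (suc l ℕ.+ r))) * 0#
            ≈⟨ +-cong (*-congˡ (annihilate (ι-< M<l))) (-‿cong (*-congˡ (annihilate (ι-< (ℕ.<-trans M<l (ℕ.n<1+n l)))))) ⟨
          certificate′ (suc M) l - certificate′ (suc M) (suc l) ∎
        ... | atLeast k ≡.refl = begin
          v M * (c (suc l ℕ.+ r) * (ι (l ℕ.+ k) l * (I * J))) - v′ M * (c (suc l ℕ.+ r) * (ι (l ℕ.+ k) (suc l) * (I * J)))
            ≈⟨ +-cong
                 (*-cong (*-cong (+-congˡ (-‿cong (*-congˡ qᴹ))) (+-congˡ (-‿cong (*-congˡ (trans (^-homo-* q M rr) (*-cong qᴹ q^rr))))))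
                         (*-cong cˡ (*-congʳ (ι-+ˡ l k))))
                 (-‿cong (*-cong (+-congˡ (*-congˡ (trans (^-homo-* q M r) (*-congʳ qᴹ)))) (*-cong cˡ (*-congʳ (ι-1+ l k))))) ⟩
          ((1# - q * (x * y)) * (1# - q * ((x * y) * (z * z)))) * ((C * ((1# + x * z) * (q * (x * z)))) * (d * (I * J)))
            - (1# + q * ((x * y) * z)) * ((C * ((1# + x * z) * (q * (x * z)))) * (((1# - y) * d) * (I * J)))
            ≈⟨ solve 8 (λ q x y z C d I J →
                 ((:1 :- q :* (x :* y)) :* (:1 :- q :* ((x :* y) :* (z :* z)))) :* ((C :* ((:1 :+ x :* z) :* (q :* (x :* z)))) :* (d :* (I :* J)))
                 :- (:1 :+ q :* ((x :* y) :* z)) :* ((C :* ((:1 :+ x :* z) :* (q :* (x :* z)))) :* (((:1 :- y) :* d) :* (I :* J)))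
                 := (((q :* (x :* y)) :* z) :* (:1 :+ x :* z)) :* (C :* (d :* (((:1 :- q :* x) :* I) :* ((:1 :- q :* (x :* (z :* z))) :* J))))
                 :- (((q :* (x :* y)) :* z) :* (:1 :+ q :* (x :* z))) :* ((C :* ((:1 :+ x :* z) :* (q :* (x :* z)))) :* (((:1 :- y) :* d) :* (I :* J))))
                 refl q x y z C d I J ⟩
          (((q * (x * y)) * z) * (1# + x * z)) * (C * (d * (((1# - q * x) * I) * ((1# - q * (x * (z * z))) * J))))
            - (((q * (x * y)) * z) * (1# + q * (x * z))) * ((C * ((1# + x * z) * (q * (x * z)))) * (((1# - y) * d) * (I * J)))
            ≈⟨ +-cong
                 (*-cong (*-cong (*-congʳ (*-congˡ qᴹ)) (+-congˡ qˡʳ)) (*-congˡ (*-cong (ι-+ˡ l k)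
                   (*-cong (sym (i-suc l)) (trans (sym (i-suc (l ℕ.+ rr))) (*-congʳ (+-congˡ (-‿cong (*-congˡ (trans (^-homo-* q l rr) (*-congˡ q^rr)))))))))))
                 (-‿cong (*-cong (*-cong (*-congʳ (*-congˡ qᴹ)) (+-congˡ (*-congˡ qˡʳ))) (*-cong cˡ (*-congʳ (ι-1+ l k))))) ⟨
          certificate′ (suc M) l - certificate′ (suc M) (suc l) ∎
          where
          x = q ^ l
          y = q ^ k
          d = i k
          C = c (l ℕ.+ r)
          I = i (suc l)
          J = i (suc (l ℕ.+ rr))
          qᴹ : q ^ M ≈ x * y
          qᴹ = ^-homo-* q l k
          qˡʳ : q ^ (l ℕ.+ r) ≈ x * z
          qˡʳ = ^-homo-* q l r
          cˡ : c (suc l ℕ.+ r) ≈ C * ((1# + x * z) * (q * (x * z)))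
          cˡ = *-congˡ (*-cong (+-congˡ qˡʳ) (*-congˡ qˡʳ))

        partialSum′ : ∀ M n → v M * ∑ (suc n) (conjugateTerm (suc M)) - v′ M * ∑ (suc n) (conjugateTerm M) ≈ - certificate′ (suc M) n
        partialSum′ M zero    = trans (solve 4 (λ v a w b → v :* (a :+ :0) :- w :* (b :+ :0) := v :* a :- w :* b) refl _ _ _ _) (step-zero M)
        partialSum′ M (suc n) = begin
          v M * ∑ (suc (suc n)) (conjugateTerm (suc M)) - v′ M * ∑ (suc (suc n)) (conjugateTerm M)
            ≈⟨ +-cong (*-congˡ (∑-last (suc n) (conjugateTerm (suc M)))) (-‿cong (*-congˡ (∑-last (suc n) (conjugateTerm M)))) ⟩
          v M * (∑ (suc n) (conjugateTerm (suc M)) + conjugateTerm (suc M) (suc n)) - v′ M * (∑ (suc n) (conjugateTerm M) + conjugateTerm M (suc n))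
            ≈⟨ solve 6 (λ u a b v c d → u :* (a :+ b) :- v :* (c :+ d) := (u :* a :- v :* c) :+ (u :* b :- v :* d)) refl _ _ _ _ _ _ ⟩
          (v M * ∑ (suc n) (conjugateTerm (suc M)) - v′ M * ∑ (suc n) (conjugateTerm M)) + (v M * conjugateTerm (suc M) (suc n) - v′ M * conjugateTerm M (suc n))
            ≈⟨ +-cong (partialSum′ M n) (step-suc M n) ⟩
          - certificate′ (suc M) n + (certificate′ (suc M) n - certificate′ (suc M) (suc n))
            ≈⟨ solve 2 (λ a b → :- a :+ (a :- b) := :- b) refl _ _ ⟩
          - certificate′ (suc M) (suc n) ∎

      conjugateSum : ℕ → Carrier
      conjugateSum M = ∑ (suc M) (conjugateTerm M)

      private
        recurrence : ∀ M → v M * conjugateSum (suc M) ≈ v′ M * conjugateSum M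
        recurrence M = begin
          v M * conjugateSum (suc M)
            ≈⟨ solve 2 (λ a b → a := (a :- b) :+ b) refl _ _ ⟩
          (v M * conjugateSum (suc M) - v′ M * ∑ (suc (suc M)) (conjugateTerm M)) + v′ M * ∑ (suc (suc M)) (conjugateTerm M)
            ≈⟨ +-cong (trans (partialSum′ M (suc M)) (-‿cong (trans (*-congˡ (annihilate (ι-< (ℕ.n<1+n (suc M))))) (zeroʳ _))))
                      (*-congˡ (trans (∑-last (suc M) (conjugateTerm M)) (+-congˡ (annihilate (ι-< (ℕ.n<1+n M)))))) ⟩
          - 0# + v′ M * (conjugateSum M + 0#)
            ≈⟨ solve 2 (λ v s → :- :0 :+ v :* (s :+ :0) := v :* s) refl _ _ ⟩
          v′ M * conjugateSum M ∎

      -- The q-Chu-Vandermonde sum behind Bailey's lemma with ρ₁ = -1 and ρ₂ → ∞.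
      conjugate : ∀ {a b} → a * c r ≈ b * pn r → ∀ M → a * conjugateSum M ≈ b * (pn (M ℕ.+ r) * (i M * i (M ℕ.+ rr)))
      conjugate {a} {b} ac≈bp zero = begin
        a * (c r * (i 0 * (i 0 * i rr)) + 0#)     ≈⟨ solve 4 (λ a c i j → a :* (c :* (i :* (i :* j)) :+ :0) := ((a :* c) :* (i :* j)) :* i) refl _ _ _ _ ⟩
        ((a * c r) * (i 0 * i rr)) * i 0          ≈⟨ *-cong (*-congʳ ac≈bp) i-zero ⟩
        ((b * pn r) * (i 0 * i rr)) * 1#          ≈⟨ solve 3 (λ b p i → ((b :* p) :* i) :* :1 := b :* (p :* i)) refl _ _ _ ⟩
        b * (pn r * (i 0 * i rr))                 ∎
      conjugate {a} {b} ac≈bp (suc M) = begin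
        a * S
          ≈⟨ solve 2 (λ a S → a :* S := a :* ((:1 :* :1) :* S)) refl _ _ ⟩
        a * ((1# * 1#) * S)
          ≈⟨ *-congˡ (*-congʳ (*-cong (trans (*-congˡ (i-suc M)) (P*i M)) (trans (*-congˡ (i-suc (M ℕ.+ rr))) (P*i (M ℕ.+ rr))))) ⟨
        a * (((P M * ((1# - q ^ suc M) * I)) * (P (M ℕ.+ rr) * ((1# - q ^ suc (M ℕ.+ rr)) * J))) * S)
          ≈⟨ solve 8 (λ a P x I P′ y J S → a :* (((P :* (x :* I)) :* (P′ :* (y :* J))) :* S) := ((P :* I) :* (P′ :* J)) :* (a :* ((x :* y) :* S)))
               refl _ _ _ _ _ _ _ _ ⟩
        ((P M * I) * (P (M ℕ.+ rr) * J)) * (a * (v M * S))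
          ≈⟨ *-congˡ (*-congˡ (recurrence M)) ⟩
        ((P M * I) * (P (M ℕ.+ rr) * J)) * (a * (v′ M * conjugateSum M))
          ≈⟨ *-congˡ (trans (solve 3 (λ a v s → a :* (v :* s) := v :* (a :* s)) refl _ _ _) (*-congˡ (conjugate ac≈bp M))) ⟩
        ((P M * I) * (P (M ℕ.+ rr) * J)) * (v′ M * (b * (pn (M ℕ.+ r) * (i M * i (M ℕ.+ rr)))))
          ≈⟨ solve 9 (λ P I P′ J v b p i j → ((P :* I) :* (P′ :* J)) :* (v :* (b :* (p :* (i :* j))))
               := ((P :* i) :* (P′ :* j)) :* (b :* ((p :* v) :* (I :* J)))) refl _ _ _ _ _ _ _ _ _ ⟩
        ((P M * i M) * (P (M ℕ.+ rr) * i (M ℕ.+ rr))) * (b * ((pn (M ℕ.+ r) * v′ M) * (I * J)))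
          ≈⟨ *-cong (*-cong (P*i M) (P*i (M ℕ.+ rr))) (*-congˡ (*-congʳ (sym (pn-suc (M ℕ.+ r))))) ⟩
        (1# * 1#) * (b * (pn (suc M ℕ.+ r) * (I * J)))
          ≈⟨ solve 1 (λ x → (:1 :* :1) :* x := x) refl _ ⟩
        b * (pn (suc M ℕ.+ r) * (I * J)) ∎
        where
        S = conjugateSum (suc M)
        I = i (suc M)
        J = i (suc (M ℕ.+ rr))

    baileyTerm : ℕ → ℕ → ℕ → Carrier
    baileyTerm N r n = c n * (ι N n * (ι n r * i (r ℕ.+ n)))

    baileySum : ∀ r M → ∑ (suc (r ℕ.+ M)) (baileyTerm (r ℕ.+ M) r) ≈ conjugateSum r M
    baileySum r M = begin
      ∑ (suc (r ℕ.+ M)) (baileyTerm (r ℕ.+ M) r)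
        ≡⟨ ≡.cong (λ l → ∑ l (baileyTerm (r ℕ.+ M) r)) (≡.sym (ℕ.+-suc r M)) ⟩
      ∑ (r ℕ.+ suc M) (baileyTerm (r ℕ.+ M) r)
        ≈⟨ ∑-split r (suc M) _ ⟩
      ∑ r (baileyTerm (r ℕ.+ M) r) + ∑ (suc M) (λ k → baileyTerm (r ℕ.+ M) r (r ℕ.+ k))
        ≈⟨ +-cong (∑-0 r λ n n<r → trans (*-congˡ (annihilate (ι-< n<r))) (zeroʳ _)) (∑-cong (suc M) shifted) ⟩
      0# + conjugateSum r M
        ≈⟨ +-identityˡ _ ⟩
      conjugateSum r M ∎
      where
      shifted : ∀ k → baileyTerm (r ℕ.+ M) r (r ℕ.+ k) ≈ conjugateTerm r M k
      shifted k = *-cong (reflexive (≡.cong c (ℕ.+-comm r k))) (*-cong (ι-+ r M k) (*-cong (ι-+ˡ r k)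
        (reflexive (≡.cong i (≡.trans (≡.sym (ℕ.+-assoc r r k)) (ℕ.+-comm (r ℕ.+ r) k))))))

    baileySum-< : ∀ {N r} → N ℕ.< r → ∑ (suc N) (baileyTerm N r) ≈ 0#
    baileySum-< {N} {r} N<r = ∑-0 (suc N) λ n n<sN →
      trans (*-congˡ {c n} (annihilate {ι N n} {z = i (r ℕ.+ n)} (ι-< (ℕ.≤-trans n<sN N<r)))) (zeroʳ _)

    -- `V s` is (-1)^s q^(5s²), the general term of φ(-q⁵).
    V : ℕ → Carrier
    V zero    = 1#
    V (suc s) = V s * (- (q ^ 5 * (q ^ s) ^ 10))

    -- The multiplicity of ±s when a bilateral sum with even terms is folded onto s ≥ 0.
    h : ℕ → Carrier
    h zero    = 1#
    h (suc s) = 1# + 1#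

    -- Here q⁵ arises: (3 s² - s) + 2 s (2 s + 1) / 2 = 5 s².
    w*κ : ∀ s → w s * κ (double s) ≈ V s
    w*κ zero    = *-identityˡ 1#
    w*κ (suc s) = begin
      (- (w s * (x ^ 6 * q ^ 2))) * ((κ (double s) * (q * q ^ double s)) * (q * (q * q ^ double s)))
        ≈⟨ *-congˡ (*-cong (*-congˡ (*-congˡ (^-double s))) (*-congˡ (*-congˡ (^-double s)))) ⟩
      (- (w s * (x ^ 6 * q ^ 2))) * ((κ (double s) * (q * (x * x))) * (q * (q * (x * x))))
        ≈⟨ solve 4 (λ q x w k → (:- (w :* (x :^ 6 :* q :^ 2))) :* ((k :* (q :* (x :* x))) :* (q :* (q :* (x :* x))))
             := (w :* k) :* (:- (q :^ 5 :* x :^ 10))) refl q x _ _ ⟩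
      (w s * κ (double s)) * (- (q ^ 5 * x ^ 10))
        ≈⟨ *-congʳ (w*κ s) ⟩
      V s * (- (q ^ 5 * x ^ 10)) ∎
      where x = q ^ s

    -- For s > 0 the factor 1 + q^(2s) of `weight` lets `c-pn-κ` enter `conjugate` and produces the
    -- 2 of `h`; at s = 0 that factor is absent and the multiplicity is 1.
    weighted-baileySum : ∀ N s → weight s * ∑ (suc N) (baileyTerm N (double s)) ≈
      pn N * ((h s * V s) * (ι N (double s) * i (double s ℕ.+ N)))
    weighted-baileySum N s with difference N (double s)
    ... | less N<2s = trans (trans (*-congˡ (baileySum-< N<2s)) (zeroʳ _))
      (sym (trans (*-congˡ (annihilate (ι-< N<2s))) (zeroʳ _)))
    weighted-baileySum .M zero | atLeast M ≡.refl = begin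
      1# * ∑ (suc M) (baileyTerm M 0)        ≈⟨ *-congˡ (baileySum 0 M) ⟩
      1# * conjugateSum 0 M                  ≈⟨ conjugate 0 {1#} {1#} refl M ⟩
      1# * (pn (M ℕ.+ 0) * (i M * i (M ℕ.+ 0))) ≡⟨ ≡.cong (λ l → 1# * (pn l * (i M * i l))) (ℕ.+-identityʳ M) ⟩
      1# * (pn M * (i M * i M))              ≈⟨ solve 2 (λ p e → :1 :* (p :* e) := p :* ((:1 :* :1) :* e)) refl _ _ ⟩
      pn M * ((1# * 1#) * (i M * i M))       ∎
    weighted-baileySum .(double (suc s) ℕ.+ M) (suc s) | atLeast M ≡.refl = begin
      (w (suc s) * (1# + q ^ suc s * q ^ suc s)) * ∑ (suc (r ℕ.+ M)) (baileyTerm (r ℕ.+ M) r)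
        ≈⟨ *-cong (*-congˡ (+-congˡ (sym (^-double (suc s))))) (baileySum r M) ⟩
      (w (suc s) * (1# + q ^ r)) * conjugateSum r M
        ≈⟨ *-assoc _ _ _ ⟩
      w (suc s) * ((1# + q ^ r) * conjugateSum r M)
        ≈⟨ *-congˡ (conjugate r (c-pn-κ (suc (double s))) M) ⟩
      w (suc s) * (((1# + 1#) * κ r) * (pn (M ℕ.+ r) * (i M * i (M ℕ.+ (r ℕ.+ r)))))
        ≈⟨ solve 5 (λ w k p i j → w :* (((:1 :+ :1) :* k) :* (p :* (i :* j))) := p :* (((:1 :+ :1) :* (w :* k)) :* (i :* j))) refl _ _ _ _ _ ⟩
      pn (M ℕ.+ r) * (((1# + 1#) * (w (suc s) * κ r)) * (i M * i (M ℕ.+ (r ℕ.+ r))))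
        ≈⟨ *-cong (reflexive (≡.cong pn (ℕ.+-comm M r))) (*-cong (*-congˡ (w*κ (suc s)))
             (*-cong (sym (ι-+ˡ r M)) (reflexive (≡.cong i (≡.trans (ℕ.+-comm M (r ℕ.+ r)) (ℕ.+-assoc r r M)))))) ⟩
      pn (r ℕ.+ M) * (((1# + 1#) * V (suc s)) * (ι (r ℕ.+ M) r * i (r ℕ.+ (r ℕ.+ M)))) ∎
      where r = double (suc s)

    -- Insert the Bailey pair for β, interchange the two finite sums, and evaluate the inner sum
    -- over n.
    baileyIdentity : ∀ N → ∑ (suc N) (λ n → c n * (ι N n * (i n * j n))) ≈
      pn N * ∑ (suc N) (λ s → (h s * V s) * (ι N (double s) * i (double s ℕ.+ N)))
    baileyIdentity N = begin
      ∑ (suc N) (λ n → c n * (ι N n * (i n * j n)))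
        ≈⟨ ∑-cong< (suc N) (λ n n<sN → *-congˡ {c n} (*-congˡ {ι N n} (baileyPair n N (ℕ.≤-pred n<sN)))) ⟩
      ∑ (suc N) (λ n → c n * (ι N n * ∑ (suc N) (pairTerm n)))
        ≈⟨ ∑-cong (suc N) (λ n → trans (sym (*-assoc (c n) (ι N n) _)) (sym (∑-*ˡ (suc N) (c n * ι N n) (pairTerm n)))) ⟩
      ∑ (suc N) (λ n → ∑ (suc N) (λ s → (c n * ι N n) * pairTerm n s))
        ≈⟨ ∑-comm (suc N) (suc N) (λ n s → (c n * ι N n) * pairTerm n s) ⟩
      ∑ (suc N) (λ s → ∑ (suc N) (λ n → (c n * ι N n) * pairTerm n s))
        ≈⟨ ∑-cong (suc N) (λ s → trans (∑-cong (suc N) λ n →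
             solve 4 (λ c x g e → (c :* x) :* (g :* e) := g :* (c :* (x :* e))) refl (c n) (ι N n) (weight s) (ι n (double s) * i (double s ℕ.+ n))) (∑-*ˡ (suc N) (weight s) (baileyTerm N (double s)))) ⟩
      ∑ (suc N) (λ s → weight s * ∑ (suc N) (baileyTerm N (double s)))
        ≈⟨ ∑-cong (suc N) (weighted-baileySum N) ⟩
      ∑ (suc N) (λ s → pn N * ((h s * V s) * (ι N (double s) * i (double s ℕ.+ N))))
        ≈⟨ ∑-*ˡ (suc N) (pn N) (λ s → (h s * V s) * (ι N (double s) * i (double s ℕ.+ N))) ⟩
      pn N * ∑ (suc N) (λ s → (h s * V s) * (ι N (double s) * i (double s ℕ.+ N))) ∎

-- Evaluation of the sum: theta limit, three-term relation, cancellation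

record Summation {ℓ₀ ℓ₁ ℓ₂} {𝓡 : RealField ℓ₀ ℓ₁ ℓ₂} {𝓝 : NormedRing 𝓡} (q : NormedRing.Carrier 𝓝) : Set (ℓ₀ ⊔ ℓ₁ ⊔ ℓ₂) where
  open NormedRing 𝓝
  open FiniteSums commutativeRing
  open Powers commutativeRing
  open Units commutativeRing
  open Limits 𝓝
  field
    {P A B C₃ C₄ C₆ C₇ S} : Carrier
    limP  : poch (q ^ 10) (q ^ 10) ⟶ P
    limA  : poch q q ⟶ A
    limB  : poch q (q * q) ⟶ B
    limC₃ : poch (- (q ^ 3)) (q ^ 10) ⟶ C₃
    limC₄ : poch (- (q ^ 4)) (q ^ 10) ⟶ C₄
    limC₆ : poch (- (q ^ 6)) (q ^ 10) ⟶ C₆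
    limC₇ : poch (- (q ^ 7)) (q ^ 10) ⟶ C₇
    reciprocal : ℕ → Carrier
    denominator*reciprocal : ∀ n → (poch q (q * q) (suc n) * poch q q (suc n)) * reciprocal n ≈ 1#
    limS  : (λ N → ∑ N (λ n → (q ^ (n ℕ.+ tri n) * poch (- q) q n) * reciprocal n)) ⟶ S
    denominator-unit : Unit (A * B * (C₃ * C₄ * C₆ * C₇))
    identity : S * (A * B * (C₃ * C₄ * C₆ * C₇)) ≈ P

module Identity {ℓ₀ ℓ₁ ℓ₂} {𝓡 : RealField ℓ₀ ℓ₁ ℓ₂} (𝓝 : NormedRing 𝓡)
  {r : RealField.Carrier 𝓡} (0<r : RealField._<_ 𝓡 (RealField.0# 𝓡) r) (r<1 : RealField._<_ 𝓡 r (RealField.1# 𝓡)) where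
  private
    module ℝ = Real 𝓡
    0≤r = ℝ.<⇒≤ 0<r
    r≤1 = ℝ.<⇒≤ r<1
  open NormedRing 𝓝
  open FiniteSums commutativeRing
  open Powers commutativeRing
  open Units commutativeRing
  open Monomials commutativeRing
  open Limits 𝓝
  open Geometric 0≤r r<1
  open BilateralSums 𝓝
  open Dominance 0≤r r<1
  open PochhammerLimits 𝓝 0≤r r<1
  open ThetaSeries 𝓝 0<r r<1
  open TripleProduct 𝓝 0<r r<1
  open Bailey commutativeRing
  open IntegerCoefficients commutativeRing
  open SetoidReasoning setoid
  open RingProperties ring using (-‿distribˡ-*)

  ∥^∥≤1 : ∀ {x} → ∥ x ∥≤ ℝ.1# → ∀ n → ∥ x ^ n ∥≤ ℝ.1#
  ∥^∥≤1 ∥x∥≤1 n = ∥∥-mono (ℝ.^-mono-≤1 ℝ.0≤1 ℝ.≤-refl n) (∥^∥ ∥x∥≤1 n)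

  ∥*∥≤1 : ∀ {x y} → ∥ x ∥≤ ℝ.1# → ∥ y ∥≤ ℝ.1# → ∥ x * y ∥≤ ℝ.1#
  ∥*∥≤1 ∥x∥≤1 ∥y∥≤1 = ∥∥-mono (ℝ.≤-reflexive (ℝ.*-identityˡ ℝ.1#)) (∥*∥ ∥x∥≤1 ∥y∥≤1)

  ∥*∥≤r : ∀ {x y} → ∥ x ∥≤ r → ∥ y ∥≤ ℝ.1# → ∥ x * y ∥≤ r
  ∥*∥≤r ∥x∥≤r ∥y∥≤1 = ∥∥-mono (ℝ.≤-reflexive (ℝ.*-identityʳ r)) (∥*∥ ∥x∥≤r ∥y∥≤1)

  schröter : ∀ a g e {S T A B A′ B′} → ∥ a ∥≤ ℝ.1# → ∥ g ∥≤ ℝ.1# → ∥ e ∥≤ ℝ.1# → ∥ mon a g e 2 1 1 ∥≤ r →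
    ∑ℤ∞ θ (mon a g e 1 0 0) (mon a g e 1 1 1) ⟶ S → ∑ℤ∞ θ (mon a g e 1 0 1) (mon a g e 1 1 0) ⟶ T →
    ∑ℤ∞ θ (mon a g e 2 1 0) (mon a g e 2 1 2) ⟶ A → ∑ℤ∞ θ (mon a g e 2 0 1) (mon a g e 2 2 1) ⟶ B →
    ∑ℤ∞ θ (mon a g e 4 2 1) (mon a g e 0 0 1) ⟶ A′ → ∑ℤ∞ θ (mon a g e 4 1 2) (mon a g e 0 1 0) ⟶ B′ →
    S * T ≈ A * B + mon a g e 1 0 0 * (A′ * B′)
  schröter a g e ∥a∥ ∥g∥ ∥e∥ ∥p∥ limS limT limA limB limA′ limB′ = convolution (mon a g e 1 0 0)
    (θ-decaying (∥mon∥ 1 0 0) (∥mon∥ 1 1 1) (∥∥-cong (sym (mon-* a g e 1 0 0 1 1 1)) ∥p∥))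
    (θ-decaying (∥mon∥ 1 0 1) (∥mon∥ 1 1 0) (∥∥-cong (sym (mon-* a g e 1 0 1 1 1 0)) ∥p∥))
    limS limT limA limB limA′ limB′ (θ-even a g e) (θ-odd a g e)
    where
    ∥mon∥ : ∀ i j k → ∥ mon a g e i j k ∥≤ ℝ.1#
    ∥mon∥ i j k = ∥*∥≤1 (∥^∥≤1 ∥a∥ i) (∥*∥≤1 (∥^∥≤1 ∥g∥ j) (∥^∥≤1 ∥e∥ k))

  θ-sum-cong : ∀ {x y x′ y′ S} → x ≈ x′ → y ≈ y′ → ∑ℤ∞ θ x y ⟶ S → ∑ℤ∞ θ x′ y′ ⟶ S
  θ-sum-cong x≈x′ y≈y′ = ∑ℤ∞-cong (θ-cong x≈x′ y≈y′) refl

  poch∞-unique : ∀ {x y p L M} → x ≈ y → poch x p ⟶ L → poch y p ⟶ M → L ≈ M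
  poch∞-unique x≈y limL limM = lim-unique limL (lim-cong (poch-cong (sym x≈y) refl) refl limM)

  poch∞-0 : ∀ {x p L} → x ≈ 0# → poch x p ⟶ L → L ≈ 1#
  poch∞-0 x≈0 lim = lim-unique lim (lim-cong (λ n → sym (∏-1 n λ j →
    trans (+-congˡ (-‿cong (trans (*-congʳ x≈0) (zeroˡ _)))) (solve 0 (:1 :- :0 := :1) refl))) refl (lim-const 1#))

  module Nome {q : Carrier} (∥q∥≤r : ∥ q ∥≤ r) where

    ∥q∥≤1 : ∥ q ∥≤ ℝ.1#
    ∥q∥≤1 = ∥∥-mono r≤1 ∥q∥≤r

    ∥q²∥≤r : ∥ q * q ∥≤ r
    ∥q²∥≤r = ∥*∥≤r ∥q∥≤r ∥q∥≤1

    ∥-q^∥≤r : ∀ n → ∥ - (q ^ suc n) ∥≤ r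
    ∥-q^∥≤r n = ∥-∥ (∥^suc∥ ∥q∥≤r n)

    ∥q^∥≤1 : ∀ n → ∥ q ^ n ∥≤ ℝ.1#
    ∥q^∥≤1 = ∥^∥≤1 ∥q∥≤1

    ∥-q^∥≤1 : ∀ n → ∥ - (q ^ n) ∥≤ ℝ.1#
    ∥-q^∥≤1 n = ∥-∥ (∥q^∥≤1 n)

    ∥q¹⁰∥≤r : ∥ q ^ 10 ∥≤ r
    ∥q¹⁰∥≤r = ∥^suc∥ ∥q∥≤r 9

    module I = Reciprocal ∥q∥≤r ∥q∥≤r
    module J = Reciprocal ∥q∥≤r ∥q²∥≤r
    open Pair q I.poch⁻¹ (poch q q) J.poch⁻¹ (poch q (q * q))
      refl I.poch⁻¹-step I.poch*poch⁻¹ refl J.poch⁻¹-step J.poch*poch⁻¹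

    reciprocal : ℕ → Carrier
    reciprocal n = J.poch⁻¹ (suc n) * I.poch⁻¹ (suc n)

    denominator*reciprocal : ∀ n → (poch q (q * q) (suc n) * poch q q (suc n)) * reciprocal n ≈ 1#
    denominator*reciprocal n = proj₂ (unit-* (_ , J.poch*poch⁻¹ (suc n)) (_ , I.poch*poch⁻¹ (suc n)))

    -- n + tri n = (n² + 3 n) / 2
    term : ℕ → Carrier
    term n = (q ^ (n ℕ.+ tri n) * poch (- q) q n) * reciprocal n

    private
      Bᵢ = proj₁ I.poch⁻¹-bounded
      Bⱼ = proj₁ J.poch⁻¹-bounded

      pn-bounded : ∃[ B ] (∀ n → ∥ poch (- q) q n ∥≤ B)
      pn-bounded = ∏-bounded λ k → ∥-∥ (∥*∥ (∥-∥ ∥q∥≤r) (∥^∥ ∥q∥≤r k))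
      Bₚ = proj₁ pn-bounded

      0≤Bᵢ : ℝ.0# ℝ.≤ Bᵢ
      0≤Bᵢ = ∥∥⇒0≤ (proj₂ I.poch⁻¹-bounded 0)

      C : ℝ.Carrier
      C = Bₚ ℝ.* (Bⱼ ℝ.* Bᵢ)

    term-dominated : Dominated C term
    term-dominated n = ∥∥-mono
      (ℝ.≤-resp (ℝ.sym (ℝ.*-assoc _ _ _)) (ℝ.*-comm _ _)
        (ℝ.*-mono-≤ (ℝ.0≤^ 0≤r (n ℕ.+ tri n)) 0≤C (ℝ.^-antimono 0≤r r≤1 (ℕ.m≤m+n n (tri n))) ℝ.≤-refl))
      (∥*∥ (∥*∥ (∥^∥ ∥q∥≤r (n ℕ.+ tri n)) (proj₂ pn-bounded n))
        (∥*∥ (proj₂ J.poch⁻¹-bounded (suc n)) (proj₂ I.poch⁻¹-bounded (suc n))))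
      where
      0≤C : ℝ.0# ℝ.≤ C
      0≤C = ℝ.0≤* (∥∥⇒0≤ (proj₂ pn-bounded 0)) (ℝ.0≤* (∥∥⇒0≤ (proj₂ J.poch⁻¹-bounded 0)) 0≤Bᵢ)

    -- This is the index shift that produces 2 q: (-1)_{n+1} = 2 (-q)_n, and (n + 1)(n + 2)/2 = 1 +
    -- (n² + 3 n)/2.
    c-suc : ∀ n → c (suc n) ≈ (1# + 1#) * (q * (q ^ (n ℕ.+ tri n) * poch (- q) q n))
    c-suc zero    = solve 1 (λ q → :1 :* ((:1 :+ :1) :* (q :* :1)) := (:1 :+ :1) :* (q :* (:1 :* :1))) refl q
    c-suc (suc n) = begin
      c (suc n) * ((1# + q ^ suc n) * q ^ suc (suc n))
        ≈⟨ *-congʳ (c-suc n) ⟩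
      ((1# + 1#) * (q * (q ^ (n ℕ.+ tri n) * pn n))) * ((1# + q ^ suc n) * (q * q ^ suc n))
        ≈⟨ solve 4 (λ q x p y → ((:1 :+ :1) :* (q :* (x :* p))) :* ((:1 :+ y) :* (q :* y))
             := (:1 :+ :1) :* (q :* ((y :* (q :* x)) :* (p :* (:1 :+ y))))) refl q _ _ _ ⟩
      (1# + 1#) * (q * ((q ^ suc n * q ^ suc (n ℕ.+ tri n)) * (pn n * (1# + q ^ suc n))))
        ≈⟨ *-congˡ (*-congˡ (*-cong (^-homo-* q (suc n) (suc (n ℕ.+ tri n))) (pn-suc n))) ⟨
      (1# + 1#) * (q * (q ^ (suc n ℕ.+ tri (suc n)) * pn (suc n))) ∎

    private
      ι-bounded : ∀ N s → ∥ ι N s ∥≤ Bᵢ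
      ι-bounded N       zero    = proj₂ I.poch⁻¹-bounded N
      ι-bounded zero    (suc s) = ∥∥-mono 0≤Bᵢ ∥0∥
      ι-bounded (suc N) (suc s) = ι-bounded N s

      ι-lim : ∀ s → (λ N → ι N s) ⟶ I.poch∞⁻¹
      ι-lim zero    = proj₂ I.poch⁻¹-converges
      ι-lim (suc s) = lim-unshift (ι-lim s)

    a : Carrier
    a = - (q ^ 5)

    private
      ∥a∥≤1 : ∥ a ∥≤ ℝ.1#
      ∥a∥≤1 = ∥-q^∥≤1 5

      ∥a²∥≤r : ∥ a * a ∥≤ r
      ∥a²∥≤r = ∥*∥≤r (∥-q^∥≤r 4) ∥a∥≤1

      V≈θ : ∀ s → V s ≈ θ a a (+ s)
      V≈θ zero    = sym (*-identityˡ 1#)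
      V≈θ (suc s) = begin
        V s * (- (q ^ 5 * (q ^ s) ^ 10))        ≈⟨ *-cong (V≈θ s) a-power ⟩
        θ a a (+ s) * (a * (a * a) ^ s)         ≈⟨ θ-suc a a s ⟨
        θ a a (+ suc s)                         ∎
        where
        a-power : - (q ^ 5 * (q ^ s) ^ 10) ≈ a * (a * a) ^ s
        a-power = begin
          - (q ^ 5 * (q ^ s) ^ 10)      ≈⟨ -‿distribˡ-* (q ^ 5) ((q ^ s) ^ 10) ⟩
          a * (q ^ s) ^ 10              ≈⟨ *-congˡ (trans (^-assocʳ q s 10) (^-congʳ q (ℕ.*-comm s 10))) ⟩
          a * q ^ (10 ℕ.* s)            ≈⟨ *-congˡ (^-assocʳ q 10 s) ⟨
          a * (q ^ 10) ^ s              ≈⟨ *-congˡ (^-congˡ s (solve 1 (λ q → q :^ 10 := (:- (q :^ 5)) :* (:- (q :^ 5))) refl q)) ⟩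
          a * (a * a) ^ s               ∎

      -- The window -n ≤ m < n contains -n but not n, hence the extra `V n`, which tends to 0.
      hV-sum : ∀ n → ∑ (suc n) (λ s → h s * V s) ≈ ∑ℤ n (θ a a) + V n
      hV-sum zero    = solve 0 (:1 :* :1 :+ :0 := :0 :+ :1) refl
      hV-sum (suc n) = begin
        ∑ (suc (suc n)) (λ s → h s * V s)
          ≈⟨ ∑-last (suc n) (λ s → h s * V s) ⟩
        ∑ (suc n) (λ s → h s * V s) + (1# + 1#) * V (suc n)
          ≈⟨ +-congʳ (hV-sum n) ⟩
        (∑ℤ n (θ a a) + V n) + (1# + 1#) * V (suc n)
          ≈⟨ solve 3 (λ s x y → (s :+ x) :+ (:1 :+ :1) :* y := (s :+ (x :+ y)) :+ y) refl _ _ _ ⟩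
        (∑ℤ n (θ a a) + (V n + V (suc n))) + V (suc n)
          ≈⟨ +-congʳ (+-congˡ (+-cong (V≈θ n) (trans (V≈θ (suc n)) (sym (θ-neg a a (+ suc n)))))) ⟩
        (∑ℤ n (θ a a) + (θ a a (+ n) + θ a a -[1+ n ])) + V (suc n)
          ≈⟨ +-congʳ (∑-last n (λ k → θ a a (+ k) + θ a a -[1+ k ])) ⟨
        ∑ℤ (suc n) (θ a a) + V (suc n) ∎

      V-dominated : Dominated r⁻³ V
      V-dominated s = ∥∥-cong (sym (V≈θ s)) (decaying⇒dominated (θ-decaying ∥a∥≤1 ∥a∥≤1 ∥a²∥≤r) (+ s))

      hV-dominated : Dominated ((ℝ.1# ℝ.+ ℝ.1#) ℝ.* r⁻³) (λ s → h s * V s)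
      hV-dominated s = ∥∥-mono (ℝ.≤-reflexive (ℝ.sym (ℝ.*-assoc _ _ _))) (∥*∥ (∥h∥ s) (V-dominated s))
        where
        ∥h∥ : ∀ s → ∥ h s ∥≤ ℝ.1# ℝ.+ ℝ.1#
        ∥h∥ zero    = ∥∥-mono (ℝ.≤-by (ℝ.solve 0 ((ℝ.:1 ℝ.:+ ℝ.:1) ℝ.:- ℝ.:1 ℝ.:= ℝ.:1) ℝ.refl) ℝ.0≤1) ∥1∥
        ∥h∥ (suc s) = ∥+∥ ∥1∥ ∥1∥

    -- The limit N → ∞ of Bailey's identity.
    sum-as-theta : ∀ {S N φ} → (λ n → ∑ n term) ⟶ S → poch (- q) q ⟶ N → ∑ℤ∞ θ a a ⟶ φ →
      I.poch∞⁻¹ + (1# + 1#) * (q * (I.poch∞⁻¹ * S)) ≈ N * (φ * (I.poch∞⁻¹ * I.poch∞⁻¹))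
    sum-as-theta {S} {N} {φ} limS limN limφ = lim-unique left right
      where
      i∞ = I.poch∞⁻¹

      scaled : (λ n → ∑ n (λ k → ι n (suc k) * term k)) ⟶ i∞ * S
      scaled = tannery (λ n → n) (λ _ → ℕ.≤-refl)
        (λ n k → ∥∥-mono (ℝ.≤-reflexive (ℝ.sym (ℝ.*-assoc Bᵢ C _))) (∥*∥ (ι-bounded n (suc k)) (term-dominated k)))
        (λ k → lim-* (ι-lim (suc k)) (lim-const (term k)))
        (lim-cong (λ n → sym (∑-*ˡ n i∞ term)) refl (lim-*ˡ i∞ limS))

      regroup : ∀ n → ι n 0 + (1# + 1#) * (q * ∑ n (λ k → ι n (suc k) * term k)) ≈
        ∑ (suc n) (λ k → c k * (ι n k * (I.poch⁻¹ k * J.poch⁻¹ k)))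
      regroup n = +-cong (solve 1 (λ i → i := :1 :* (i :* (:1 :* :1))) refl _) (begin
        (1# + 1#) * (q * ∑ n (λ k → ι n (suc k) * term k))
          ≈⟨ *-assoc _ _ _ ⟨
        ((1# + 1#) * q) * ∑ n (λ k → ι n (suc k) * term k)
          ≈⟨ ∑-*ˡ n ((1# + 1#) * q) (λ k → ι n (suc k) * term k) ⟨
        ∑ n (λ k → ((1# + 1#) * q) * (ι n (suc k) * term k))
          ≈⟨ ∑-cong n (λ k → trans
               (solve 5 (λ q x z j i → ((:1 :+ :1) :* q) :* (x :* (z :* (j :* i))) := ((:1 :+ :1) :* (q :* z)) :* (x :* (i :* j)))
                 refl q (ι n (suc k)) (q ^ (k ℕ.+ tri k) * poch (- q) q k) (J.poch⁻¹ (suc k)) (I.poch⁻¹ (suc k)))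
               (*-congʳ (sym (c-suc k)))) ⟩
        ∑ n (λ k → c (suc k) * (ι n (suc k) * (I.poch⁻¹ (suc k) * J.poch⁻¹ (suc k)))) ∎)

      left : (λ n → ∑ (suc n) (λ k → c k * (ι n k * (I.poch⁻¹ k * J.poch⁻¹ k)))) ⟶ i∞ + (1# + 1#) * (q * (i∞ * S))
      left = lim-cong regroup refl (lim-+ (ι-lim 0) (lim-*ˡ (1# + 1#) (lim-*ˡ q scaled)))

      hV-lim : (λ n → ∑ n (λ s → h s * V s)) ⟶ φ
      hV-lim = lim-unshift (lim-cong (λ n → sym (hV-sum n)) (+-identityʳ φ)
        (lim-+ (partialSums limφ) (dominated⇒null V-dominated)))

      g : ℕ → ℕ → Carrier
      g n s = (h s * V s) * (ι n (double s) * I.poch⁻¹ (double s ℕ.+ n))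

      g-dominated : ∀ n → Dominated (((ℝ.1# ℝ.+ ℝ.1#) ℝ.* r⁻³) ℝ.* (Bᵢ ℝ.* Bᵢ)) (g n)
      g-dominated n s = ∥∥-mono
        (ℝ.≤-reflexive (ℝ.solve 3 (λ x y b → (x ℝ.:* y) ℝ.:* b ℝ.:= (x ℝ.:* b) ℝ.:* y) ℝ.refl
          ((ℝ.1# ℝ.+ ℝ.1#) ℝ.* r⁻³) (r ℝ.^ s) (Bᵢ ℝ.* Bᵢ)))
        (∥*∥ (hV-dominated s) (∥*∥ (ι-bounded n (double s)) (proj₂ I.poch⁻¹-bounded (double s ℕ.+ n))))

      g-lim : ∀ s → (λ n → g n s) ⟶ (h s * V s) * (i∞ * i∞)
      g-lim s = lim-*ˡ (h s * V s) (lim-* (ι-lim (double s))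
        (lim-subsequence (double s ℕ.+_) (λ n → ℕ.m≤n+m n (double s)) (proj₂ I.poch⁻¹-converges)))

      g-limit-sum : (λ n → ∑ n (λ s → (h s * V s) * (i∞ * i∞))) ⟶ φ * (i∞ * i∞)
      g-limit-sum = lim-cong
        (λ n → trans (sym (∑-*ˡ n (i∞ * i∞) (λ s → h s * V s))) (∑-cong n λ s → *-comm (i∞ * i∞) (h s * V s)))
        (*-comm (i∞ * i∞) φ) (lim-*ˡ (i∞ * i∞) hV-lim)

      right : (λ n → ∑ (suc n) (λ k → c k * (ι n k * (I.poch⁻¹ k * J.poch⁻¹ k)))) ⟶ N * (φ * (i∞ * i∞))
      right = lim-cong (λ n → sym (baileyIdentity n)) refl
        (lim-* limN (tannery {f = g} suc ℕ.n≤1+n g-dominated g-lim g-limit-sum))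

    private
      p : Carrier
      p = q ^ 10

    -- x∞ is (x ; q¹⁰)_∞, and p∞ k = (q^k ; q¹⁰)_∞, n∞ k = (-q^k ; q¹⁰)_∞.
    infix 9 _∞
    abstract
      _∞ : Carrier → Carrier
      x ∞ = proj₁ (poch-converges x ∥q¹⁰∥≤r)

      ∞-lim : ∀ x → poch x (q ^ 10) ⟶ x ∞
      ∞-lim x = proj₂ (poch-converges x ∥q¹⁰∥≤r)

    ∞-cong : ∀ {x y} → x ≈ y → x ∞ ≈ y ∞
    ∞-cong {x} {y} x≈y = poch∞-unique x≈y (∞-lim x) (∞-lim y)

    p∞ n∞ : ℕ → Carrier
    p∞ k = (q ^ k) ∞
    n∞ k = (- (q ^ k)) ∞

    n∞-unit : ∀ k → ∃[ w ] n∞ (suc k) * w ≈ 1#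
    n∞-unit k = Reciprocal.poch∞⁻¹ (∥-q^∥≤r k) ∥q¹⁰∥≤r , Reciprocal.poch∞*poch∞⁻¹ (∥-q^∥≤r k) ∥q¹⁰∥≤r (∞-lim (- (q ^ suc k)))

    p∞-unit : ∀ k → ∃[ w ] p∞ (suc k) * w ≈ 1#
    p∞-unit k = Reciprocal.poch∞⁻¹ (∥^suc∥ ∥q∥≤r k) ∥q¹⁰∥≤r , Reciprocal.poch∞*poch∞⁻¹ (∥^suc∥ ∥q∥≤r k) ∥q¹⁰∥≤r (∞-lim (q ^ suc k))

    private
      P = p∞ 10

      -1∞ : (- 1#) ∞ ≈ (1# + 1#) * n∞ 10
      -1∞ = lim-unique (lim-subsequence suc ℕ.n≤1+n (∞-lim (- 1#)))
        (lim-cong (λ n → sym (trans (poch-first (- 1#) p n) (*-cong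
            (solve 0 (:1 :- (:- :1) := :1 :+ :1) refl)
            (poch-cong (solve 1 (λ x → (:- :1) :* x := :- x) refl p) refl n)))) refl
          (lim-*ˡ (1# + 1#) (∞-lim (- p))))

      triple : ∀ {x y} → x * y ≈ p → ∥ x ∥≤ ℝ.1# → ∥ y ∥≤ ℝ.1# → ∑ℤ∞ θ x y ⟶ (((- x) ∞ * (- y) ∞) * P)
      triple {x} {y} xy≈p ∥x∥≤1 ∥y∥≤1 =
        jacobiTripleProduct ∥q¹⁰∥≤r xy≈p ∥x∥≤1 ∥y∥≤1 (∞-lim (- x)) (∞-lim (- y)) (∞-lim p)

      triple⁺ : ∀ k l → k ℕ.+ l ≡ 10 → ∑ℤ∞ θ (q ^ k) (q ^ l) ⟶ ((n∞ k * n∞ l) * P)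
      triple⁺ k l k+l≡10 = triple (trans (sym (^-homo-* q k l)) (^-congʳ q k+l≡10)) (∥q^∥≤1 k) (∥q^∥≤1 l)

      triple⁻ : ∀ k l → k ℕ.+ l ≡ 10 → ∑ℤ∞ θ (- (q ^ k)) (- (q ^ l)) ⟶ ((p∞ k * p∞ l) * P)
      triple⁻ k l k+l≡10 = ∑ℤ∞-cong (λ _ → refl) (*-congʳ (*-cong (∞-cong (neg-neg (q ^ k))) (∞-cong (neg-neg (q ^ l)))))
        (triple (trans (solve 2 (λ x y → (:- x) :* (:- y) := x :* y) refl _ _) (trans (sym (^-homo-* q k l)) (^-congʳ q k+l≡10)))
          (∥-q^∥≤1 k) (∥-q^∥≤1 l))
        where
        neg-neg : ∀ x → - - x ≈ x
        neg-neg = solve 1 (λ x → :- :- x := x) refl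

      triple₀ : ∑ℤ∞ θ 1# p ⟶ ((((1# + 1#) * n∞ 10) * n∞ 10) * P)
      triple₀ = ∑ℤ∞-cong (λ _ → refl) (*-congʳ (*-congʳ -1∞)) (triple (*-identityˡ p) ∥1∥ (∥q^∥≤1 10))

      -- f k l is Ramanujan's f(q^{k+1}, q^l): the first exponent must be positive for convergence.
      f-converges : ∀ k l → ∃[ S ] ∑ℤ∞ θ (q ^ suc k) (q ^ l) ⟶ S
      f-converges k l = ∑ℤ∞-converges (decaying⇒dominated (θ-decaying (∥q^∥≤1 (suc k)) (∥q^∥≤1 l)
        (∥*∥≤r (∥^suc∥ ∥q∥≤r k) (∥q^∥≤1 l))))

      abstract
        f : ℕ → ℕ → Carrier
        f k l = proj₁ (f-converges k l)

        f-lim : ∀ k l → ∑ℤ∞ θ (q ^ suc k) (q ^ l) ⟶ f k l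
        f-lim k l = proj₂ (f-converges k l)

      f-sum : ∀ k l {x y} → q ^ suc k ≈ x → q ^ l ≈ y → ∑ℤ∞ θ x y ⟶ f k l
      f-sum k l x≈ y≈ = θ-sum-cong x≈ y≈ (f-lim k l)

      f-sum˘ : ∀ k l {x y} → q ^ suc k ≈ y → q ^ l ≈ x → ∑ℤ∞ θ x y ⟶ f k l
      f-sum˘ k l x≈ y≈ = θ-sum-cong y≈ x≈ (∑ℤ∞-cong (λ m → θ-neg (q ^ suc k) (q ^ l) m) refl
        (∑ℤ∞-neg (dominated⇒vanishing (decaying⇒dominated (θ-decaying (∥q^∥≤1 (suc k)) (∥q^∥≤1 l)
          (∥*∥≤r (∥^suc∥ ∥q∥≤r k) (∥q^∥≤1 l))))) (f-lim k l)))

      -- `A₀` is f(q⁵, q¹⁵) and `Hₖ` is f(q^k, q^(20-k)). These five values are all that occurs in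
      -- the six Schröter expansions below.
      A₀ = f 4 15
      H₁ = f 0 19
      H₃ = f 2 17
      H₇ = f 6 13
      H₉ = f 8 11

      module _ (x y z : ℕ) where
        -- The exponent of q in `mon` at a = q^x, g = q^y, e = q^z. The parameters used below all
        -- satisfy 2 x + y + z = 10, so that both theta functions on the left have base q¹⁰.
        e : ℕ → ℕ → ℕ → ℕ
        e i j k = x ℕ.* i ℕ.+ (y ℕ.* j ℕ.+ z ℕ.* k)

        mon⁺ : ∀ i j k → mon (q ^ x) (q ^ y) (q ^ z) i j k ≈ q ^ e i j k
        mon⁺ i j k = begin
          (q ^ x) ^ i * ((q ^ y) ^ j * (q ^ z) ^ k)            ≈⟨ *-cong (^-assocʳ q x i) (*-cong (^-assocʳ q y j) (^-assocʳ q z k)) ⟩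
          q ^ (x ℕ.* i) * (q ^ (y ℕ.* j) * q ^ (z ℕ.* k))      ≈⟨ *-congˡ (^-homo-* q (y ℕ.* j) (z ℕ.* k)) ⟨
          q ^ (x ℕ.* i) * q ^ (y ℕ.* j ℕ.+ z ℕ.* k)            ≈⟨ ^-homo-* q (x ℕ.* i) (y ℕ.* j ℕ.+ z ℕ.* k) ⟨
          q ^ e i j k                                          ∎

        mon⁻₀ : ∀ j k → mon (- (q ^ x)) (q ^ y) (q ^ z) 0 j k ≈ q ^ e 0 j k
        mon⁻₀ j k = mon⁺ 0 j k

        mon⁻₁ : ∀ j k → mon (- (q ^ x)) (q ^ y) (q ^ z) 1 j k ≈ - (q ^ e 1 j k)
        mon⁻₁ j k = trans (solve 2 (λ a m → ((:- a) :* :1) :* m := :- ((a :* :1) :* m)) refl (q ^ x) _) (-‿cong (mon⁺ 1 j k))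

        mon⁻₂ : ∀ j k → mon (- (q ^ x)) (q ^ y) (q ^ z) 2 j k ≈ q ^ e 2 j k
        mon⁻₂ j k = trans (*-congʳ (solve 1 (λ a → (:- a) :^ 2 := a :^ 2) refl (q ^ x))) (mon⁺ 2 j k)

        mon⁻₄ : ∀ j k → mon (- (q ^ x)) (q ^ y) (q ^ z) 4 j k ≈ q ^ e 4 j k
        mon⁻₄ j k = trans (*-congʳ (solve 1 (λ a → (:- a) :^ 4 := a :^ 4) refl (q ^ x))) (mon⁺ 4 j k)

        module _ (∥p∥≤r : ∥ q ^ e 2 1 1 ∥≤ r) {A B A′ B′ : Carrier}
          (limA  : ∑ℤ∞ θ (q ^ e 2 1 0) (q ^ e 2 1 2) ⟶ A)  (limB  : ∑ℤ∞ θ (q ^ e 2 0 1) (q ^ e 2 2 1) ⟶ B)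
          (limA′ : ∑ℤ∞ θ (q ^ e 4 2 1) (q ^ e 0 0 1) ⟶ A′) (limB′ : ∑ℤ∞ θ (q ^ e 4 1 2) (q ^ e 0 1 0) ⟶ B′) where

          schröter⁺ : ∀ {S T} → ∑ℤ∞ θ (q ^ e 1 0 0) (q ^ e 1 1 1) ⟶ S → ∑ℤ∞ θ (q ^ e 1 0 1) (q ^ e 1 1 0) ⟶ T →
            S * T ≈ A * B + q ^ e 1 0 0 * (A′ * B′)
          schröter⁺ limS limT = trans
            (schröter (q ^ x) (q ^ y) (q ^ z) (∥q^∥≤1 x) (∥q^∥≤1 y) (∥q^∥≤1 z) (∥∥-cong (sym (mon⁺ 2 1 1)) ∥p∥≤r)
              (θ-sum-cong (sym (mon⁺ 1 0 0)) (sym (mon⁺ 1 1 1)) limS) (θ-sum-cong (sym (mon⁺ 1 0 1)) (sym (mon⁺ 1 1 0)) limT)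
              (θ-sum-cong (sym (mon⁺ 2 1 0)) (sym (mon⁺ 2 1 2)) limA) (θ-sum-cong (sym (mon⁺ 2 0 1)) (sym (mon⁺ 2 2 1)) limB)
              (θ-sum-cong (sym (mon⁺ 4 2 1)) (sym (mon⁺ 0 0 1)) limA′) (θ-sum-cong (sym (mon⁺ 4 1 2)) (sym (mon⁺ 0 1 0)) limB′))
            (+-congˡ (*-congʳ (mon⁺ 1 0 0)))

          -- Negating a negates all four arguments on the left, but the arguments on the right
          -- contain only even powers of a; the sole effect there is the sign in front of the odd
          -- part.
          schröter⁻ : ∀ {S T} → ∑ℤ∞ θ (- (q ^ e 1 0 0)) (- (q ^ e 1 1 1)) ⟶ S → ∑ℤ∞ θ (- (q ^ e 1 0 1)) (- (q ^ e 1 1 0)) ⟶ T →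
            S * T ≈ A * B + - (q ^ e 1 0 0) * (A′ * B′)
          schröter⁻ limS limT = trans
            (schröter (- (q ^ x)) (q ^ y) (q ^ z) (∥-q^∥≤1 x) (∥q^∥≤1 y) (∥q^∥≤1 z) (∥∥-cong (sym (mon⁻₂ 1 1)) ∥p∥≤r)
              (θ-sum-cong (sym (mon⁻₁ 0 0)) (sym (mon⁻₁ 1 1)) limS) (θ-sum-cong (sym (mon⁻₁ 0 1)) (sym (mon⁻₁ 1 0)) limT)
              (θ-sum-cong (sym (mon⁻₂ 1 0)) (sym (mon⁻₂ 1 2)) limA) (θ-sum-cong (sym (mon⁻₂ 0 1)) (sym (mon⁻₂ 2 1)) limB)
              (θ-sum-cong (sym (mon⁻₄ 2 1)) (sym (mon⁻₀ 0 1)) limA′) (θ-sum-cong (sym (mon⁻₄ 1 2)) (sym (mon⁻₀ 1 0)) limB′))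
            (+-congˡ (*-congʳ (mon⁻₁ 0 0)))

      5-15  = f-sum 4 15 refl refl
      15-5  = f-sum˘ 4 15 refl refl

      -- The parameters 1, 3, 5 give a = q, a g e = q⁹, a e = q⁶, a g = q⁴, which by the triple
      -- product are the thetas belonging to q and q⁴. The labels of the other expansions are read
      -- in the same way.
      [1,4]⁺ : ((n∞ 1 * n∞ 9) * P) * ((n∞ 6 * n∞ 4) * P) ≈ A₀ * H₇ + q ^ 1 * (A₀ * H₃)
      [1,4]⁺ = schröter⁺ 1 3 5 ∥q¹⁰∥≤r 5-15 (f-sum 6 13 refl refl) 15-5 (f-sum˘ 2 17 refl refl)
        (triple⁺ 1 9 ≡.refl) (triple⁺ 6 4 ≡.refl)

      [1,4]⁻ : ((p∞ 1 * p∞ 9) * P) * ((p∞ 6 * p∞ 4) * P) ≈ A₀ * H₇ + - (q ^ 1) * (A₀ * H₃)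
      [1,4]⁻ = schröter⁻ 1 3 5 ∥q¹⁰∥≤r 5-15 (f-sum 6 13 refl refl) 15-5 (f-sum˘ 2 17 refl refl)
        (triple⁻ 1 9 ≡.refl) (triple⁻ 6 4 ≡.refl)

      [2,3]⁺ : ((n∞ 2 * n∞ 8) * P) * ((n∞ 7 * n∞ 3) * P) ≈ A₀ * H₉ + q ^ 2 * (A₀ * H₁)
      [2,3]⁺ = schröter⁺ 2 1 5 ∥q¹⁰∥≤r 5-15 (f-sum 8 11 refl refl) 15-5 (f-sum˘ 0 19 refl refl)
        (triple⁺ 2 8 ≡.refl) (triple⁺ 7 3 ≡.refl)

      [2,3]⁻ : ((p∞ 2 * p∞ 8) * P) * ((p∞ 7 * p∞ 3) * P) ≈ A₀ * H₉ + - (q ^ 2) * (A₀ * H₁)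
      [2,3]⁻ = schröter⁻ 2 1 5 ∥q¹⁰∥≤r 5-15 (f-sum 8 11 refl refl) 15-5 (f-sum˘ 0 19 refl refl)
        (triple⁻ 2 8 ≡.refl) (triple⁻ 7 3 ≡.refl)

      [1,2] : ((n∞ 1 * n∞ 9) * P) * ((n∞ 8 * n∞ 2) * P) ≈ H₃ * H₉ + q ^ 1 * (H₇ * H₁)
      [1,2] = schröter⁺ 1 1 7 ∥q¹⁰∥≤r (f-sum 2 17 refl refl) (f-sum 8 11 refl refl) (f-sum˘ 6 13 refl refl) (f-sum˘ 0 19 refl refl)
        (triple⁺ 1 9 ≡.refl) (triple⁺ 8 2 ≡.refl)

      [0,5] : ((((1# + 1#) * n∞ 10) * n∞ 10) * P) * ((n∞ 5 * n∞ 5) * P) ≈ A₀ * A₀ + q ^ 0 * (A₀ * A₀)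
      [0,5] = schröter⁺ 0 5 5 ∥q¹⁰∥≤r 5-15 5-15 15-5 15-5 triple₀ (triple⁺ 5 5 ≡.refl)

    -- Weierstrass' three-term relation: with [x] = (x, q¹⁰/x ; q¹⁰)_∞,
    -- [-q][-q²][-q³][-q⁴] - [q][q²][q³][q⁴] = q [-1][-q][-q²][-q⁵], every factor [x] carrying (q¹⁰ ; q¹⁰)_∞.
    three-term :
      (((n∞ 1 * n∞ 9) * p∞ 10) * ((n∞ 6 * n∞ 4) * p∞ 10)) * (((n∞ 2 * n∞ 8) * p∞ 10) * ((n∞ 7 * n∞ 3) * p∞ 10))
      - (((p∞ 1 * p∞ 9) * p∞ 10) * ((p∞ 6 * p∞ 4) * p∞ 10)) * (((p∞ 2 * p∞ 8) * p∞ 10) * ((p∞ 7 * p∞ 3) * p∞ 10))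
      ≈ q * ((((((1# + 1#) * n∞ 10) * n∞ 10) * p∞ 10) * ((n∞ 5 * n∞ 5) * p∞ 10)) * (((n∞ 1 * n∞ 9) * p∞ 10) * ((n∞ 8 * n∞ 2) * p∞ 10)))
    three-term = begin
      _ ≈⟨ +-cong (*-cong [1,4]⁺ [2,3]⁺) (-‿cong (*-cong [1,4]⁻ [2,3]⁻)) ⟩
      (A₀ * H₇ + q ^ 1 * (A₀ * H₃)) * (A₀ * H₉ + q ^ 2 * (A₀ * H₁)) - (A₀ * H₇ + - (q ^ 1) * (A₀ * H₃)) * (A₀ * H₉ + - (q ^ 2) * (A₀ * H₁))
        -- The difference keeps only the mixed products of even and odd parts, 2 q A₀² (H₃ H₉ + q H₇
        -- H₁). Its factors 2 A₀² and H₃ H₉ + q H₇ H₁ are again Schröter expansions, now read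
        -- backwards.
        ≈⟨ solve 6 (λ q A a b c d →
             (A :* c :+ (q :^ 1) :* (A :* b)) :* (A :* d :+ (q :^ 2) :* (A :* a)) :- (A :* c :+ (:- (q :^ 1)) :* (A :* b)) :* (A :* d :+ (:- (q :^ 2)) :* (A :* a))
             := q :* ((A :* A :+ :1 :* (A :* A)) :* (b :* d :+ (q :^ 1) :* (c :* a)))) refl q A₀ H₁ H₃ H₇ H₉ ⟩
      q * ((A₀ * A₀ + q ^ 0 * (A₀ * A₀)) * (H₃ * H₉ + q ^ 1 * (H₇ * H₁)))
        ≈⟨ *-congˡ (*-cong [0,5] [1,2]) ⟨
      _ ∎

    private
      C∞ : Carrier
      C∞ = n∞ 3 * n∞ 4 * n∞ 6 * n∞ 7

      -- The residues ±1, ±2 modulo 10, absent from `C∞`; together they give all factors of (-q ;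
      -- q)_∞ except those at multiples of 5.
      D∞ : Carrier
      D∞ = (n∞ 1 * n∞ 9) * (n∞ 8 * n∞ 2)

      -- The part of (q ; q)_∞ at exponents not divisible by 5, grouped as in `three-term`.
      p′ : Carrier
      p′ = ((p∞ 1 * p∞ 9) * (p∞ 6 * p∞ 4)) * ((p∞ 2 * p∞ 8) * (p∞ 7 * p∞ 3))

      three-term′ : (D∞ * C∞) * P ^ 4 - p′ * P ^ 4 ≈ ((1# + 1#) * q) * ((((n∞ 5 * n∞ 10) * (n∞ 5 * n∞ 10)) * D∞) * P ^ 4)
      three-term′ = begin
        (D∞ * C∞) * P ^ 4 - p′ * P ^ 4
          ≈⟨ +-cong
               (solve 9 (λ a b c d e f g h P → (((a :* h) :* (g :* b)) :* (c :* d :* e :* f)) :* P :^ 4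
                 := (((a :* h) :* P) :* ((e :* d) :* P)) :* (((b :* g) :* P) :* ((f :* c) :* P))) refl
                 (n∞ 1) (n∞ 2) (n∞ 3) (n∞ 4) (n∞ 6) (n∞ 7) (n∞ 8) (n∞ 9) P)
               (-‿cong (solve 5 (λ a b c d P → ((a :* b) :* (c :* d)) :* P :^ 4 := ((a :* P) :* (b :* P)) :* ((c :* P) :* (d :* P))) refl
                 (p∞ 1 * p∞ 9) (p∞ 6 * p∞ 4) (p∞ 2 * p∞ 8) (p∞ 7 * p∞ 3) P)) ⟩
        _ ≈⟨ three-term ⟩
        _ ≈⟨ solve 6 (λ q a b c d P →
               q :* ((((((:1 :+ :1) :* a) :* a) :* P) :* ((b :* b) :* P)) :* ((c :* P) :* (d :* P)))
               := ((:1 :+ :1) :* q) :* ((((b :* a) :* (b :* a)) :* (c :* d)) :* P :^ 4)) refl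
               q (n∞ 10) (n∞ 5) (n∞ 1 * n∞ 9) (n∞ 8 * n∞ 2) P ⟩
        ((1# + 1#) * q) * ((((n∞ 5 * n∞ 10) * (n∞ 5 * n∞ 10)) * D∞) * P ^ 4) ∎

      -- Euler's identity at base q⁵, with (-q⁵ ; q⁵)_∞ dissected modulo 2 into `n∞ 5` and `n∞ 10`.
      euler₅ : (n∞ 5 * n∞ 10) * p∞ 5 ≈ 1#
      euler₅ =
        let x = q ^ 5
            ∥x∥≤r = ∥^suc∥ ∥q∥≤r 4
            x²≈p = sym (^-homo-* q 5 5)
            A₅ , limA₅ = poch-converges x ∥x∥≤r
            N₅ , limN₅ = poch-converges (- x) ∥x∥≤r
            N₅≈ = poch∞-dissect 1 {g = λ j → (- x * x ^ j) ∞} limN₅ λ j →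
              lim-cong (poch-cong refl (sym (^-assocʳ q 5 2))) refl (∞-lim (- x * x ^ j))
        in trans (*-congʳ (sym (trans N₅≈ (trans
              (*-cong (∞-cong (*-identityʳ (- x))) (*-congʳ (∞-cong
                (trans (solve 1 (λ x → (:- x) :* (x :* :1) := :- (x :* x)) refl x) (-‿cong x²≈p)))))
              (*-congˡ (*-identityʳ (n∞ 10)))))))
            (euler ∥x∥≤r limA₅ limN₅ (lim-cong (poch-cong refl (sym x²≈p)) refl (∞-lim x)))

    module _ {A B S : Carrier} (limA : poch q q ⟶ A) (limB : poch q (q * q) ⟶ B) (limS : (λ n → ∑ n term) ⟶ S) where

      private
        N : Carrier
        N = proj₁ (poch-converges (- q) ∥q∥≤r)

        limN : poch (- q) q ⟶ N
        limN = proj₂ (poch-converges (- q) ∥q∥≤r)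

        NB≈1 : N * B ≈ 1#
        NB≈1 = euler ∥q∥≤r limA limN limB

        A≈ : A ≈ (p′ * p∞ 5) * P
        A≈ = trans (poch∞-dissect 9 {g = λ j → p∞ (suc j)} limA (λ j → ∞-lim (q ^ suc j)))
          (solve 10 (λ a b c d e f g h i P → a :* (b :* (c :* (d :* (e :* (f :* (g :* (h :* (i :* (P :* :1)))))))))
            := ((((a :* i) :* (f :* d)) :* ((b :* h) :* (g :* c))) :* e) :* P) refl
            (p∞ 1) (p∞ 2) (p∞ 3) (p∞ 4) (p∞ 5) (p∞ 6) (p∞ 7) (p∞ 8) (p∞ 9) P)

        N≈ : N ≈ (D∞ * C∞) * (n∞ 5 * n∞ 10)
        N≈ = trans (poch∞-dissect 9 {g = λ j → n∞ (suc j)} limN (λ j →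
            lim-cong (poch-cong (-‿distribˡ-* q (q ^ j)) refl) refl (∞-lim (- (q ^ suc j)))))
          (solve 10 (λ a b c d e f g h i j → a :* (b :* (c :* (d :* (e :* (f :* (g :* (h :* (i :* (j :* :1)))))))))
            := (((a :* i) :* (h :* b)) :* (c :* d :* f :* g)) :* (e :* j)) refl
            (n∞ 1) (n∞ 2) (n∞ 3) (n∞ 4) (n∞ 5) (n∞ 6) (n∞ 7) (n∞ 8) (n∞ 9) (n∞ 10))

        φ : Carrier
        φ = (p∞ 5 * p∞ 5) * P

        i∞ : Carrier
        i∞ = I.poch∞⁻¹

        Ai≈1 : A * i∞ ≈ 1#
        Ai≈1 = I.poch∞*poch∞⁻¹ limA

        -- By Euler's N B = 1, the product A B is (q)_∞ / (-q)_∞ = φ(-q), so the right side is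
        -- (φ(-q⁵) - φ(-q)) C∞.
        theta-form : ((1# + 1#) * q) * (S * (A * B * C∞)) ≈ φ * C∞ - A * B * C∞
        theta-form = begin
          ((1# + 1#) * q) * (S * (A * B * C∞))
            ≈⟨ solve 6 (λ q S A B C e → ((:1 :+ :1) :* q) :* (S :* (A :* B :* C))
                 := (:1 :* (:1 :+ (:1 :+ :1) :* (q :* S))) :* (A :* B :* C) :- A :* B :* C) refl q S A B C∞ 1# ⟩
          (1# * (1# + (1# + 1#) * (q * S))) * (A * B * C∞) - A * B * C∞
            ≈⟨ +-congʳ (*-congʳ (*-congʳ Ai≈1)) ⟨
          ((A * i∞) * (1# + (1# + 1#) * (q * S))) * (A * B * C∞) - A * B * C∞
            ≈⟨ +-congʳ (solve 6 (λ q S A B C i → ((A :* i) :* (:1 :+ (:1 :+ :1) :* (q :* S))) :* (A :* B :* C)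
                 := (i :+ (:1 :+ :1) :* (q :* (i :* S))) :* (A :* (A :* B :* C))) refl q S A B C∞ i∞) ⟩
          (i∞ + (1# + 1#) * (q * (i∞ * S))) * (A * (A * B * C∞)) - A * B * C∞
            ≈⟨ +-congʳ (*-congʳ (sum-as-theta limS limN (triple⁻ 5 5 ≡.refl))) ⟩
          (N * (φ * (i∞ * i∞))) * (A * (A * B * C∞)) - A * B * C∞
            ≈⟨ +-congʳ (solve 6 (λ N φ A B C i → (N :* (φ :* (i :* i))) :* (A :* (A :* B :* C))
                 := ((N :* B) :* ((A :* i) :* (A :* i))) :* (φ :* C)) refl N φ A B C∞ i∞) ⟩
          ((N * B) * ((A * i∞) * (A * i∞))) * (φ * C∞) - A * B * C∞
            ≈⟨ +-congʳ (*-congʳ (*-cong NB≈1 (*-cong Ai≈1 Ai≈1))) ⟩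
          (1# * (1# * 1#)) * (φ * C∞) - A * B * C∞
            ≈⟨ +-congʳ (solve 1 (λ x → (:1 :* (:1 :* :1)) :* x := x) refl _) ⟩
          φ * C∞ - A * B * C∞ ∎

        -- `euler₅` supplies the factors `n∞ 5 * n∞ 10` that complete D∞ C∞ to N, and then N B = 1.
        DABC≈Ap₅ : D∞ * (A * B * C∞) ≈ A * p∞ 5
        DABC≈Ap₅ = begin
          D∞ * (A * B * C∞)
            ≈⟨ solve 4 (λ D A B C → D :* (A :* B :* C) := (A :* B :* (D :* C)) :* :1) refl D∞ A B C∞ ⟩
          (A * B * (D∞ * C∞)) * 1#
            ≈⟨ *-congˡ euler₅ ⟨
          (A * B * (D∞ * C∞)) * ((n∞ 5 * n∞ 10) * p∞ 5)
            ≈⟨ solve 5 (λ A B E F p → (A :* B :* E) :* (F :* p) := A :* (((E :* F) :* B) :* p)) refl A B (D∞ * C∞) (n∞ 5 * n∞ 10) (p∞ 5) ⟩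
          A * ((((D∞ * C∞) * (n∞ 5 * n∞ 10)) * B) * p∞ 5)
            ≈⟨ *-congˡ (*-congʳ (trans (*-congʳ (sym N≈)) NB≈1)) ⟩
          A * (1# * p∞ 5)
            ≈⟨ *-congˡ (*-identityˡ (p∞ 5)) ⟩
          A * p∞ 5 ∎

        -- After multiplication by D∞ both terms contain φ, since A (q⁵ ; q¹⁰)_∞ = p′ φ. The power
        -- P⁴ is there because each side of the three-term relation has four theta functions, each
        -- with a factor P.
        scaled-identity : (D∞ * P ^ 4) * (φ * C∞ - A * B * C∞) ≈ (D∞ * P ^ 4) * (((1# + 1#) * q) * P)
        scaled-identity = begin
          (D∞ * P ^ 4) * (φ * C∞ - A * B * C∞)
            ≈⟨ solve 5 (λ D Z φ C X → (D :* Z) :* (φ :* C :- X) := (φ :* ((D :* C) :* Z)) :- Z :* (D :* X)) refl D∞ (P ^ 4) φ C∞ (A * B * C∞) ⟩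
          φ * ((D∞ * C∞) * P ^ 4) - P ^ 4 * (D∞ * (A * B * C∞))
            ≈⟨ +-congˡ (-‿cong (*-congˡ (trans DABC≈Ap₅ (*-congʳ A≈)))) ⟩
          φ * ((D∞ * C∞) * P ^ 4) - P ^ 4 * (((p′ * p∞ 5) * P) * p∞ 5)
            ≈⟨ solve 5 (λ p P E Z m → ((p :* p) :* P) :* (E :* Z) :- Z :* (((m :* p) :* P) :* p) := ((p :* p) :* P) :* (E :* Z :- m :* Z))
                 refl (p∞ 5) P (D∞ * C∞) (P ^ 4) p′ ⟩
          φ * ((D∞ * C∞) * P ^ 4 - p′ * P ^ 4)
            ≈⟨ *-congˡ three-term′ ⟩
          φ * (((1# + 1#) * q) * ((((n∞ 5 * n∞ 10) * (n∞ 5 * n∞ 10)) * D∞) * P ^ 4))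
            ≈⟨ solve 6 (λ p P t F D Z → ((p :* p) :* P) :* (t :* (((F :* F) :* D) :* Z)) := ((F :* p) :* (F :* p)) :* ((D :* Z) :* (t :* P)))
                 refl (p∞ 5) P ((1# + 1#) * q) (n∞ 5 * n∞ 10) D∞ (P ^ 4) ⟩
          (((n∞ 5 * n∞ 10) * p∞ 5) * ((n∞ 5 * n∞ 10) * p∞ 5)) * ((D∞ * P ^ 4) * (((1# + 1#) * q) * P))
            ≈⟨ *-congʳ (*-cong euler₅ euler₅) ⟩
          (1# * 1#) * ((D∞ * P ^ 4) * (((1# + 1#) * q) * P))
            ≈⟨ solve 1 (λ x → (:1 :* :1) :* x := x) refl _ ⟩
          (D∞ * P ^ 4) * (((1# + 1#) * q) * P) ∎

        DP⁴-unit : Unit (D∞ * P ^ 4)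
        DP⁴-unit = unit-* (unit-* (unit-* (n∞-unit 0) (n∞-unit 8)) (unit-* (n∞-unit 7) (n∞-unit 1)))
          (unit-* (p∞-unit 9) (unit-* (p∞-unit 9) (unit-* (p∞-unit 9) (unit-* (p∞-unit 9) (1# , *-identityˡ 1#)))))

        2qX≈2qP : ((1# + 1#) * q) * (S * (A * B * C∞)) ≈ ((1# + 1#) * q) * P
        2qX≈2qP = trans theta-form (unit-cancel DP⁴-unit scaled-identity)

        reciprocal≈1 : q ≈ 0# → ∀ {x y z} → x ≈ q → (1# - x * y) * z ≈ 1# → z ≈ 1#
        reciprocal≈1 q≈0 {x} {y} {z} x≈q eq = begin
          z                  ≈⟨ solve 2 (λ y z → z := (:1 :- :0 :* y) :* z) refl y z ⟩
          (1# - 0# * y) * z  ≈⟨ *-congʳ (+-congˡ (-‿cong (*-congʳ (trans x≈q q≈0)))) ⟨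
          (1# - x * y) * z   ≈⟨ eq ⟩
          1#                 ∎

        -- All products have value 1 at q = 0, and the sum reduces to its term n = 0.
        identity-0 : q ≈ 0# → S * (A * B * C∞) ≈ P
        identity-0 q≈0 = begin
          S * (A * B * C∞)
            ≈⟨ *-cong S≈1 (*-cong (*-cong (poch∞-0 q≈0 limA) (poch∞-0 q≈0 limB)) (*-cong (*-cong (*-cong (n∞≈1 2) (n∞≈1 3)) (n∞≈1 5)) (n∞≈1 6))) ⟩
          1# * (1# * 1# * (1# * 1# * 1# * 1#))
            ≈⟨ solve 0 (:1 :* (:1 :* :1 :* (:1 :* :1 :* :1 :* :1)) := :1) refl ⟩
          1#
            ≈⟨ poch∞-0 (qⁿ≈0 9) (∞-lim (q ^ 10)) ⟨
          P ∎
          where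
          qⁿ≈0 : ∀ n → q ^ suc n ≈ 0#
          qⁿ≈0 n = trans (*-congʳ q≈0) (zeroˡ _)
          n∞≈1 : ∀ n → n∞ (suc n) ≈ 1#
          n∞≈1 n = poch∞-0 (trans (-‿cong (qⁿ≈0 n)) (solve 0 (:- :0 := :0) refl)) (∞-lim (- (q ^ suc n)))
          term-0 : term 0 ≈ 1#
          term-0 = trans (*-congˡ (*-cong (reciprocal≈1 q≈0 refl (J.poch⁻¹-step 0)) (reciprocal≈1 q≈0 refl (I.poch⁻¹-step 0))))
            (solve 0 ((:1 :* :1) :* (:1 :* :1) := :1) refl)
          term-suc : ∀ n → term (suc n) ≈ 0#
          term-suc n = trans (*-congʳ (trans (*-congʳ (qⁿ≈0 (n ℕ.+ tri (suc n)))) (zeroˡ _))) (zeroˡ _)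
          S≈1 : S ≈ 1#
          S≈1 = lim-unique limS (lim-eventually 1 (λ { (suc n) _ →
            sym (trans (+-cong term-0 (∑-0 n λ k _ → term-suc k)) (+-identityʳ 1#)) }) (lim-const 1#))

      -- The common factor 2q can only be cancelled when q is invertible; equality being
      -- stable under double negation, the case q ≈ 0 may be treated separately.
      identity : S * (A * B * (n∞ 3 * n∞ 4 * n∞ 6 * n∞ 7)) ≈ p∞ 10
      identity = ≈-stable λ X≉P → ≈0⊎unit q λ
        { (inj₁ q≈0)    → X≉P (identity-0 q≈0)
        ; (inj₂ q-unit) → X≉P (unit-cancel (unit-* 2-unit q-unit) 2qX≈2qP) }

      denominator-unit : Unit (A * B * (n∞ 3 * n∞ 4 * n∞ 6 * n∞ 7))
      denominator-unit = unit-* (unit-* (i∞ , Ai≈1) (J.poch∞⁻¹ , J.poch∞*poch∞⁻¹ limB))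
        (unit-* (unit-* (unit-* (n∞-unit 2) (n∞-unit 3)) (n∞-unit 5)) (n∞-unit 6))

    summation : Summation {𝓝 = 𝓝} q
    summation = record
      { P = p∞ 10 ; C₃ = n∞ 3 ; C₄ = n∞ 4 ; C₆ = n∞ 6 ; C₇ = n∞ 7
      ; limP = ∞-lim (q ^ 10) ; limA = limA ; limB = limB
      ; limC₃ = ∞-lim (- (q ^ 3)) ; limC₄ = ∞-lim (- (q ^ 4))
      ; limC₆ = ∞-lim (- (q ^ 6)) ; limC₇ = ∞-lim (- (q ^ 7))
      ; limS = limS
      ; reciprocal = reciprocal
      ; denominator*reciprocal = denominator*reciprocal
      ; denominator-unit = denominator-unit limA limB limS
      ; identity = identity limA limB limS
      }
      where
      limA = proj₂ (poch-converges q ∥q∥≤r)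
      limB = proj₂ (poch-converges q ∥q²∥≤r)
      limS = proj₂ (∑-converges term-dominated)

-- Transfer of the result to complex numbers

exponent : ∀ n → (n ℕ.^ 2 ℕ.+ 3 ℕ.* n) ℕ./ 2 ≡ n ℕ.+ tri n
exponent n = ≡.trans (≡.cong (ℕ._/ 2) (≡.sym doubled)) (ℕ.m*n/n≡m (n ℕ.+ tri n) 2)
  where
  open ℕSolver
  2tri : ∀ n → tri n ℕ.* 2 ≡ n ℕ.* n ℕ.+ n
  2tri zero    = ≡.refl
  2tri (suc n) = ≡.trans (solve 2 (λ n t → (con 1 :+ n :+ t) :* con 2 := (con 2 :+ n :+ n) :+ t :* con 2) ≡.refl n (tri n))
    (≡.trans (≡.cong (2 ℕ.+ n ℕ.+ n ℕ.+_) (2tri n))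
      (solve 1 (λ n → (con 2 :+ n :+ n) :+ (n :* n :+ n) := (con 1 :+ n) :* (con 1 :+ n) :+ (con 1 :+ n)) ≡.refl n))
  -- It shows that n² + 3 n is even, so the truncating division by 2 is exact.
  doubled : (n ℕ.+ tri n) ℕ.* 2 ≡ n ℕ.^ 2 ℕ.+ 3 ℕ.* n
  doubled = ≡.trans (ℕ.*-distribʳ-+ 2 n (tri n)) (≡.trans (≡.cong (n ℕ.* 2 ℕ.+_) (2tri n))
    (solve 1 (λ n → n :* con 2 :+ (n :* n :+ n) := n :^ 2 :+ con 3 :* n) ≡.refl n))

module Transfer {c ℓ₁ ℓ₂} (𝓡 : RealField c ℓ₁ ℓ₂) where
  open Complex 𝓡
  open ComplexNormed 𝓡
  open FiniteSums ℂ-commutativeRing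
  open Powers ℂ-commutativeRing using (poch; poch-cong)
  open IntegerCoefficients ℂ-commutativeRing
  private
    module ℝ = Real 𝓡
    module ℂ′ = CommutativeRing ℂ-commutativeRing
    module Lim = Limits complexNormedRing
    module ℂᴺ = Powers (NormedRing.commutativeRing complexNormedRing)

  -- A weak bound by ε/2 yields the strict bound by ε; on squares this is (ε/2)² < ε².
  toStrict : ∀ {s L} → s Lim.⟶ L → s ⟶ L
  toStrict lim ε 0<ε =
    let δ , 0<δ , 2δ≈ε = ℝ.half 0<ε
        N , h = lim δ 0<δ
        δ<ε = ℝ.<-by (ℝ.trans (ℝ.+-congʳ (ℝ.sym 2δ≈ε)) (ℝ.solve 1 (λ δ → (δ ℝ.:+ δ) ℝ.:- δ ℝ.:= δ) ℝ.refl δ)) 0<δ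
    in N , λ n N≤n → 0<ε , ℝ.≤-<-trans (proj₂ (h n N≤n))
      (ℝ.<-trans (ℝ.*-monoˡ-< 0<δ δ<ε) (ℝ.<-resp (ℝ.*-comm ε δ) ℝ.refl (ℝ.*-monoˡ-< 0<ε δ<ε)))

  sum≈∑ : ∀ n f → sum {n} (λ k → f (toℕ k)) ≈ᶜ ∑ n f
  sum≈∑ zero    f = ℂ′.refl
  sum≈∑ (suc n) f = ℂ′.+-congˡ (sum≈∑ n (f ∘ suc))

  product≈∏ : ∀ n f → product {n} (λ k → f (toℕ k)) ≈ᶜ ∏ n f
  product≈∏ zero    f = ℂ′.refl
  product≈∏ (suc n) f = ℂ′.*-congˡ {f 0} (product≈∏ n (f ∘ suc))

  ⟨⟩≈poch : ∀ x q n → ⟨ x ﹔ q ⟩ n ≈ᶜ poch x q n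
  ⟨⟩≈poch x q n = product≈∏ n (λ j → 1# - x * q ^ j)

  fromPoch : ∀ {x q L} → poch x q Lim.⟶ L → ⟨ x ﹔ q ⟩∞⟶ L
  fromPoch {x} {q} {L} lim = toStrict (Lim.lim-cong (λ n → ℂ′.sym (⟨⟩≈poch x q n)) ℂ′.refl lim)

  -- Stated for variable exponents: at a literal such as 10 the comparison of the two
  -- presentations of ^ would expand the components of the complex powers.
  fromPoch^ : ∀ q m n {L} → ℂᴺ.poch (q ℂᴺ.^ m) (q ℂᴺ.^ n) Lim.⟶ L → ⟨ q ^ m ﹔ q ^ n ⟩∞⟶ L
  fromPoch^ q m n = fromPoch {q ^ m} {q ^ n}

  fromPoch-^ : ∀ q m n {L} → ℂᴺ.poch (- (q ℂᴺ.^ m)) (q ℂᴺ.^ n) Lim.⟶ L → ⟨ - (q ^ m) ﹔ q ^ n ⟩∞⟶ L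
  fromPoch-^ q m n = fromPoch { - (q ^ m)} {q ^ n}

  -- The squared modulus is multiplicative, so ∣ w ∣² inverts ∣ z ∣², and invertible reals are apart
  -- from 0.
  unit⇒nonZero : ∀ {z w} → z * w ≈ᶜ 1# → NonZero z
  unit⇒nonZero {z} {w} zw≈1 = ℝ.invertible⇒# (∣ w ∣² ,
    ℝ.trans (ℝ.*-comm _ _) inverseʳ , inverseʳ)
    where
    inverseʳ : (∣ z ∣² ℝ.- ℝ.0#) ℝ.* ∣ w ∣² ℝ.≈ ℝ.1#
    inverseʳ = ℝ.trans (ℝ.solve 2 (λ x y → (x ℝ.:- ℝ.:0) ℝ.:* y ℝ.:= x ℝ.:* y) ℝ.refl ∣ z ∣² ∣ w ∣²)
      (ℝ.trans (ℝ.sym (∣∣²-homo-* z w)) (ℝ.trans (∣∣²-cong zw≈1)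
        (ℝ.solve 0 (ℝ.:1 ℝ.:* ℝ.:1 ℝ.:+ ℝ.:0 ℝ.:* ℝ.:0 ℝ.:= ℝ.:1) ℝ.refl)))

  module Radius (q : ℂ) (∣q∣²<1 : ∣ q ∣² ℝ.< ℝ.1#) where
    t = ∣ q ∣²
    recip = ℝ.reciprocal (ℝ.0<+ ℝ.0<1 ℝ.0≤1)
    half = proj₁ recip
    0<half = proj₁ (proj₂ recip)

    -- r = (1 + |q|²) / 2 satisfies |q| ≤ r < 1 and avoids the square root.
    r = half ℝ.* (ℝ.1# ℝ.+ t)

    2half≈1 : (ℝ.1# ℝ.+ ℝ.1#) ℝ.* half ℝ.≈ ℝ.1#
    2half≈1 = proj₂ (proj₂ recip)

    0<r : ℝ.0# ℝ.< r
    0<r = ℝ.*-pos 0<half (ℝ.0<+ ℝ.0<1 (0≤∣∣² q))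

    r<1 : r ℝ.< ℝ.1#
    r<1 = ℝ.<-by
      (ℝ.trans (ℝ.+-congʳ (ℝ.sym 2half≈1))
        (ℝ.solve 2 (λ h t → (ℝ.:1 ℝ.:+ ℝ.:1) ℝ.:* h ℝ.:- h ℝ.:* (ℝ.:1 ℝ.:+ t) ℝ.:= h ℝ.:* (ℝ.:1 ℝ.:- t)) ℝ.refl half t))
      (ℝ.*-pos 0<half (ℝ.x<y⇒0<y-x ∣q∣²<1))

    -- With t = |q|², the difference r² - t is the square ((1 - t)/2)².
    ∥q∥≤r : ∥ q ∥≤ r
    ∥q∥≤r = ℝ.<⇒≤ 0<r , ℝ.≤-by
      (ℝ.trans
        (ℝ.+-congˡ (ℝ.-‿cong (ℝ.trans (ℝ.sym (ℝ.*-identityˡ t)) (ℝ.*-congʳ (ℝ.trans (ℝ.sym (ℝ.*-identityˡ ℝ.1#)) (ℝ.sym (ℝ.*-cong 2half≈1 2half≈1)))))))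
        (ℝ.solve 2 (λ h t →
          (h ℝ.:* (ℝ.:1 ℝ.:+ t)) ℝ.:* (h ℝ.:* (ℝ.:1 ℝ.:+ t)) ℝ.:- (((ℝ.:1 ℝ.:+ ℝ.:1) ℝ.:* h) ℝ.:* ((ℝ.:1 ℝ.:+ ℝ.:1) ℝ.:* h)) ℝ.:* t
          ℝ.:= (h ℝ.:* (ℝ.:1 ℝ.:- t)) ℝ.:* (h ℝ.:* (ℝ.:1 ℝ.:- t))) ℝ.refl half t))
      (ℝ.0≤x² (half ℝ.* (ℝ.1# ℝ.- t)))

  module FromSummation {q : ℂ} (summation : Summation {𝓝 = complexNormedRing} q) where
    open Summation summation
    open Units ℂ-commutativeRing

    f : ℕ → ℂ
    f n = q ^ ((n ℕ.^ 2 ℕ.+ 3 ℕ.* n) ℕ./ 2) * (⟨ - q ﹔ q ⟩ n)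

    E : ℕ → ℂ
    E n = (⟨ q ﹔ q ^ 2 ⟩ suc n) * (⟨ q ﹔ q ⟩ suc n)

    term : ℕ → ℂ
    term n = (q ^ (n ℕ.+ tri n) * poch (- q) q n) * reciprocal n

    q²≈qq : q ^ 2 ≈ᶜ q * q
    q²≈qq = ℂ′.*-congˡ {q} (ℂ′.*-identityʳ q)

    E*reciprocal : ∀ n → E n * reciprocal n ≈ᶜ 1#
    E*reciprocal n = ℂ′.trans
      (ℂ′.*-congʳ {reciprocal n} (ℂ′.*-cong
        (ℂ′.trans (⟨⟩≈poch q (q ^ 2) (suc n)) (poch-cong (ℂ′.refl {q}) q²≈qq (suc n)))
        (⟨⟩≈poch q q (suc n))))
      (denominator*reciprocal n)

    d : ∀ n → NonZero (E n)
    d n = unit⇒nonZero {E n} {reciprocal n} (E*reciprocal n)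

    F : ℂ
    F = A * B * (C₃ * C₄ * C₆ * C₇)

    F-unit : Unit F
    F-unit = denominator-unit

    e : NonZero F
    e = unit⇒nonZero {F} {proj₁ F-unit} (proj₂ F-unit)

    term≈ : ∀ n → term n ≈ᶜ f n / E n [ d n ]
    term≈ n = ℂ′.*-cong
      (ℂ′.*-cong (ℂ′.reflexive (≡.cong (q ^_) (≡.sym (exponent n)))) (ℂ′.sym (⟨⟩≈poch (- q) q n)))
      (inverse-unique {E n} (E*reciprocal n) (*-inverseʳ (E n) (d n)))

    partial-sum : ∀ N → ∑ N term ≈ᶜ sum {N} (λ k → f (toℕ k) / E (toℕ k) [ d (toℕ k) ])
    partial-sum N = ℂ′.trans (∑-cong N term≈) (ℂ′.sym (sum≈∑ N (λ n → f n / E n [ d n ])))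

    limB′ : poch q (q ^ 2) Lim.⟶ B
    limB′ = Lim.lim-cong (poch-cong (ℂ′.refl {q}) (ℂ′.sym q²≈qq)) (ℂ′.refl {B}) limB

    limit : S ≈ᶜ P / F [ e ]
    limit = x*y≈z⇒x≈z*y⁻¹ {S} {F} (*-inverseʳ F e) identity

    limS′ : (λ N → sum {N} (λ k → f (toℕ k) / E (toℕ k) [ d (toℕ k) ])) Lim.⟶ (P / F [ e ])
    limS′ = Lim.lim-cong partial-sum limit limS

theorem2p6 : ∀ {c ℓ₁ ℓ₂} (𝓡 : RealField c ℓ₁ ℓ₂) →
    let open Complex 𝓡 in
    (q : ℂ) → ∣ q ∣< RealField.1# 𝓡 →
    ∃[ P ] ∃[ A ] ∃[ B ] ∃[ C₃ ] ∃[ C₄ ] ∃[ C₆ ] ∃[ C₇ ]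
    (⟨ q ^ 10 ﹔ q ^ 10 ⟩∞⟶ P) ×
    (⟨ q ﹔ q ⟩∞⟶ A) ×
    (⟨ q ﹔ q ^ 2 ⟩∞⟶ B) ×
    (⟨ - (q ^ 3) ﹔ q ^ 10 ⟩∞⟶ C₃) ×
    (⟨ - (q ^ 4) ﹔ q ^ 10 ⟩∞⟶ C₄) ×
    (⟨ - (q ^ 6) ﹔ q ^ 10 ⟩∞⟶ C₆) ×
    (⟨ - (q ^ 7) ﹔ q ^ 10 ⟩∞⟶ C₇) ×
    (Σ[ d ∈ (∀ n → NonZero ((⟨ q ﹔ q ^ 2 ⟩ suc n) * (⟨ q ﹔ q ⟩ suc n))) ]
    Σ[ e ∈ NonZero (A * B * (C₃ * C₄ * C₆ * C₇)) ]
    (∑∞ (λ n → (q ^ ((n ℕ.^ 2 ℕ.+ 3 ℕ.* n) ℕ./ 2) * (⟨ - q ﹔ q ⟩ n))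
    / ((⟨ q ﹔ q ^ 2 ⟩ suc n) * (⟨ q ﹔ q ⟩ suc n)) [ d n ])
    ⟶ (P / (A * B * (C₃ * C₄ * C₆ * C₇)) [ e ])))
theorem2p6 𝓡 q (_ , ∣q∣²<1) = case summation of λ σ →
  let open Summation σ
      open FromSummation σ
  in P , A , B , C₃ , C₄ , C₆ , C₇ ,
     fromPoch^ q 10 10 limP , fromPoch {q} {q} {A} limA , fromPoch {q} {q ^ 2} {B} limB′ ,
     fromPoch-^ q 3 10 limC₃ , fromPoch-^ q 4 10 limC₄ ,
     fromPoch-^ q 6 10 limC₆ , fromPoch-^ q 7 10 limC₇ ,
     d , e , toStrict {L = P / F [ e ]} limS′
  where
  open Complex 𝓡
  open Transfer 𝓡
  open Radius q (RealOrder.<-resp 𝓡 (RealField.refl 𝓡) (RealField.*-identityˡ 𝓡 _) ∣q∣²<1)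
  summation : Summation {𝓝 = ComplexNormed.complexNormedRing 𝓡} q
  summation = Identity.Nome.summation (ComplexNormed.complexNormedRing 𝓡) 0<r r<1 {q} ∥q∥≤r
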